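{- Let $R$ be a random subset of the cyclic group $C_n$ obtained by choosing each element of $C_n$ independently with probability $p=p(n)$, and let $N^R_{n-1-k,d}$ be the number of zero-sum free sequences of length $n-1-k$ having exactly $d$ distinct elements that are contained in $R$. Let $\varphi(n)$ denote the number of generators of $C_n$. (1) If $0\le k\le\lfloor n/3\rfloor$ and $p\gg\frac{\log\log n}{n}$, then for any function $\omega=\omega(n)$ tending to $\infty$ (arbitrarily slowly) as $n\to\infty$, asymptotically almost surely $$p\,\varphi(n)-\omega\sqrt{p\,\varphi(n)}\le N^R_{n-1-k,1}\le p\,\varphi(n)+\omega\sqrt{p\,\varphi(n)} .$$ (2) Let $d\ge2$ be an integer. If $k$ is fixed and $$p\gg\frac{(\log n)^2(\log\log n)^{1/d}}{n^{1/d}},$$ then asymptotically almost surely $$N^R_{n-1-k,d}=p^d\varphi(n)\left(\sum_{j=\frac{(d-1)d}{2}}^{k}q(j,d-1)\right)+O_k\left(\sqrt{p^d\varphi(n)}\,(\log n)^d\right),$$ where $q(j,d-1)$ is the number of partitions of $j$ having exactly $d-1$ distinct parts.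
   Context: $C_n$ is the cyclic group of order $n$, written additively. A sequence of length $\ell$ over $C_n$ is an unordered collection with repetition allowed (a multiset) $S=a_1\cdot a_2\cdot\ldots\cdot a_\ell$ of $\ell$ elements of $C_n$. A subsequence of $S$ is a sequence $T$ in which the multiplicity of each $a\in C_n$ is at most its multiplicity in $S$. $S$ is a zero-sum sequence if $a_1+\dots+a_\ell=0$, and $S$ is zero-sum free if it contains no (nonempty) zero-sum subsequence. $S$ is contained in $A\subset C_n$ if every element occurring in $S$ lies in $A$. A partition of a positive integer $j$ is a non-decreasing sequence of positive integers with sum $j$. For $j,d\ge1$, $q(j,d)$ is the number of partitions of $j$ in which exactly $d$ different part sizes occur (parts may be repeated). Empty sums are $0$. For functions of $n$, $f\ll g$ (equivalently $g\gg f$) means $f/g\to0$ as $n\to\infty$. "Asymptotically almost surely" means with probability tending to $1$ as $n\to\infty$; a statement "a.a.s. $X=a+O_k(b)$" means that there is a constant $c_k$ depending only on $k$ such that $\Pr[|X-a|\le c_k b]\to1$ as $n\to\infty$. -}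

module Defs where

open import Algebra.Bundles.Raw using (RawMonoid; RawRing)
import Algebra.Definitions.RawMonoid as RawMonoidDefs
import Algebra.Definitions.RawSemiring as RawSemiringDefs
open import Data.Bool.Base using (Bool; true; if_then_else_)
open import Data.Fin.Base using (Fin; toℕ)
import Data.Fin.Properties as Fin
open import Data.Fin.Subset using (Subset; inside; outside; _⊆_; ∣_∣)
open import Data.Fin.Subset.Properties using (_⊆?_)
open import Data.Integer.Base as ℤ using ()
open import Data.List.Base as List using (List; []; _∷_; _++_; concatMap; deduplicate; filter; length; upTo)
open import Data.List.Membership.Propositional using (_∈_)
open import Data.List.Membership.Propositional.Properties using (∈-concatMap⁺; ∈-map⁺; ∈-upTo⁺)
open import Data.List.Relation.Unary.All as All using (All)
open import Data.List.Relation.Unary.Any as Any using (here)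
open import Data.List.Relation.Unary.Linked using (Linked; linked?)
open import Data.Nat.Base as ℕ using (ℕ; zero; suc; NonZero)
import Data.Nat.ListAction as ListAction
open import Data.Nat.DivMod using (_%_; _mod_; m%n<n; %-distribˡ-+; %-distribˡ-*; m%n%n≡m%n)
import Data.Nat.Properties as ℕ
open import Data.Product using (∃; _×_; _,_)
open import Data.Rational as ℚ using (ℚ; 0ℚ; 1ℚ; ½)
import Data.Rational.Properties as ℚ
open import Data.Rational.Solver using (module +-*-Solver)
open import Data.Sum.Base using (inj₁; inj₂)
open import Data.Vec.Base as Vec using (Vec; []; _∷_; lookup)
open import Data.Vec.Relation.Binary.Pointwise.Inductive as Pointwise using (Pointwise; []; _∷_)
open import Function.Base using (_∘_)
open import Level using (0ℓ)
open import Relation.Binary.PropositionalEquality using (_≡_; refl; sym; trans; cong; cong₂; subst; module ≡-Reasoning)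
open import Relation.Nullary using (¬_; Dec)
open import Relation.Nullary.Decidable using (map′; ¬?; _×-dec_; _→-dec_)
open import Relation.Unary using (Decidable)

------------------------------------------------------------------------
-- Real numbers: Cauchy sequences of rationals, with equality _≈_

record ℝ : Set where
  field
    seq    : ℕ → ℚ
    cauchy : ∀ ε → 0ℚ ℚ.< ε → ∃ λ N → ∀ m n → N ℕ.≤ m → N ℕ.≤ n →
             ℚ.∣ seq m ℚ.- seq n ∣ ℚ.≤ ε

open ℝ

infix 4 _≤_ _<_ _≈_

_≤_ : ℝ → ℝ → Set
x ≤ y = ∀ ε → 0ℚ ℚ.< ε → ∃ λ N → ∀ n → N ℕ.≤ n → seq x n ℚ.≤ seq y n ℚ.+ ε

_<_ : ℝ → ℝ → Set
x < y = ∃ λ ε → 0ℚ ℚ.< ε × ∃ λ N → ∀ n → N ℕ.≤ n → seq x n ℚ.+ ε ℚ.≤ seq y n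

_≈_ : ℝ → ℝ → Set
x ≈ y = x ≤ y × y ≤ x

private
  split : ∀ {ε} → 0ℚ ℚ.< ε → 0ℚ ℚ.< ½ ℚ.* ε
  split {ε} 0<ε = ℚ.positive⁻¹ (½ ℚ.* ε) {{ℚ.pos*pos⇒pos ½ ε {{ℚ.positive 0<ε}}}}

  halves : ∀ ε → ½ ℚ.* ε ℚ.+ ½ ℚ.* ε ≡ ε
  halves ε = trans (sym (ℚ.*-distribʳ-+ ε ½ ½)) (ℚ.*-identityˡ ε)

  +-diff : ∀ a b c d → (a ℚ.+ b) ℚ.- (c ℚ.+ d) ≡ (a ℚ.- c) ℚ.+ (b ℚ.- d)
  +-diff = solve 4 (λ a b c d → (a :+ b) :- (c :+ d) := (a :- c) :+ (b :- d)) refl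
    where open +-*-Solver

  neg-diff : ∀ a c → (ℚ.- a) ℚ.- (ℚ.- c) ≡ ℚ.- (a ℚ.- c)
  neg-diff = solve 2 (λ a c → (:- a) :- (:- c) := :- (a :- c)) refl
    where open +-*-Solver

  *-diff : ∀ a b c d → (a ℚ.* b) ℚ.- (c ℚ.* d) ≡ a ℚ.* (b ℚ.- d) ℚ.+ d ℚ.* (a ℚ.- c)
  *-diff = solve 4 (λ a b c d → (a :* b) :- (c :* d) := a :* (b :- d) :+ d :* (a :- c)) refl
    where open +-*-Solver

  cancel : ∀ a b → a ≡ (a ℚ.- b) ℚ.+ b
  cancel = solve 2 (λ a b → a := (a :- b) :+ b) refl
    where open +-*-Solver

  ∣∣-diff : ∀ a b → ℚ.∣ ℚ.∣ a ∣ ℚ.- ℚ.∣ b ∣ ∣ ℚ.≤ ℚ.∣ a ℚ.- b ∣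
  ∣∣-diff a b = ∣∣≤ {ℚ.∣ a ∣} {ℚ.∣ b ∣} (sub a b) (subst (ℚ.∣ b ∣ ℚ.- ℚ.∣ a ∣ ℚ.≤_) flip (sub b a))
    where
    sub : ∀ a b → ℚ.∣ a ∣ ℚ.- ℚ.∣ b ∣ ℚ.≤ ℚ.∣ a ℚ.- b ∣
    sub a b = begin
      ℚ.∣ a ∣ ℚ.- ℚ.∣ b ∣                             ≡⟨ cong (λ z → ℚ.∣ z ∣ ℚ.- ℚ.∣ b ∣) (cancel a b) ⟩
      ℚ.∣ (a ℚ.- b) ℚ.+ b ∣ ℚ.- ℚ.∣ b ∣               ≤⟨ ℚ.+-monoˡ-≤ (ℚ.- ℚ.∣ b ∣) (ℚ.∣p+q∣≤∣p∣+∣q∣ (a ℚ.- b) b) ⟩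
      (ℚ.∣ a ℚ.- b ∣ ℚ.+ ℚ.∣ b ∣) ℚ.- ℚ.∣ b ∣         ≡⟨ drop ℚ.∣ a ℚ.- b ∣ ℚ.∣ b ∣ ⟩
      ℚ.∣ a ℚ.- b ∣                                   ∎
      where
      open ℚ.≤-Reasoning
      drop : ∀ x y → (x ℚ.+ y) ℚ.- y ≡ x
      drop = solve 2 (λ x y → (x :+ y) :- y := x) refl
        where open +-*-Solver
    neg-sub : ∀ x y → x ℚ.- y ≡ ℚ.- (y ℚ.- x)
    neg-sub = solve 2 (λ x y → x :- y := :- (y :- x)) refl
      where open +-*-Solver
    flip : ℚ.∣ b ℚ.- a ∣ ≡ ℚ.∣ a ℚ.- b ∣
    flip = trans (cong ℚ.∣_∣ (neg-sub b a)) (ℚ.∣-p∣≡∣p∣ (a ℚ.- b))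
    ∣∣≤ : ∀ {x y z} → x ℚ.- y ℚ.≤ z → y ℚ.- x ℚ.≤ z → ℚ.∣ x ℚ.- y ∣ ℚ.≤ z
    ∣∣≤ {x} {y} p q with ℚ.∣p∣≡p∨∣p∣≡-p (x ℚ.- y)
    ... | inj₁ e = subst (ℚ._≤ _) (sym e) p
    ... | inj₂ e = subst (ℚ._≤ _) (trans (neg-sub y x) (sym e)) q

  bounded : (x : ℝ) → ∃ λ N → ∃ λ B → 0ℚ ℚ.< B × (∀ n → N ℕ.≤ n → ℚ.∣ seq x n ∣ ℚ.≤ B)
  bounded x = let (N , h) = cauchy x 1ℚ (ℚ.positive⁻¹ 1ℚ) in
    N , 1ℚ ℚ.+ ℚ.∣ seq x N ∣
      , ℚ.+-mono-<-≤ (ℚ.positive⁻¹ 1ℚ) (ℚ.0≤∣p∣ (seq x N))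
      , λ n N≤n → let open ℚ.≤-Reasoning in begin
        ℚ.∣ seq x n ∣                                      ≡⟨ cong ℚ.∣_∣ (cancel (seq x n) (seq x N)) ⟩
        ℚ.∣ (seq x n ℚ.- seq x N) ℚ.+ seq x N ∣            ≤⟨ ℚ.∣p+q∣≤∣p∣+∣q∣ (seq x n ℚ.- seq x N) (seq x N) ⟩
        ℚ.∣ seq x n ℚ.- seq x N ∣ ℚ.+ ℚ.∣ seq x N ∣        ≤⟨ ℚ.+-monoˡ-≤ ℚ.∣ seq x N ∣ (h n N N≤n ℕ.≤-refl) ⟩
        1ℚ ℚ.+ ℚ.∣ seq x N ∣                               ∎

  share : ∀ {ε B} → 0ℚ ℚ.< ε → 0ℚ ℚ.< B → ∃ λ δ → 0ℚ ℚ.< δ × B ℚ.* δ ≡ ½ ℚ.* ε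
  share {ε} {B} 0<ε 0<B = ℚ.1/ B ℚ.* (½ ℚ.* ε)
    , ℚ.positive⁻¹ _ {{ℚ.pos*pos⇒pos (ℚ.1/ B) {{ℚ.1/pos⇒pos B}} (½ ℚ.* ε) {{ℚ.positive (split 0<ε)}}}}
    , trans (sym (ℚ.*-assoc B (ℚ.1/ B) (½ ℚ.* ε)))
        (trans (cong (ℚ._* (½ ℚ.* ε)) (ℚ.*-inverseʳ B)) (ℚ.*-identityˡ (½ ℚ.* ε)))
    where
    instance
      B-pos : ℚ.Positive B
      B-pos = ℚ.positive 0<B
      B-nz : ℚ.NonZero B
      B-nz = ℚ.pos⇒nonZero B

  *-bound : ∀ {a b B δ} → 0ℚ ℚ.< B → ℚ.∣ a ∣ ℚ.≤ B → ℚ.∣ b ∣ ℚ.≤ δ → ℚ.∣ a ℚ.* b ∣ ℚ.≤ B ℚ.* δ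
  *-bound {a} {b} {B} {δ} 0<B a≤B b≤δ = begin
    ℚ.∣ a ℚ.* b ∣          ≡⟨ ℚ.∣p*q∣≡∣p∣*∣q∣ a b ⟩
    ℚ.∣ a ∣ ℚ.* ℚ.∣ b ∣    ≤⟨ ℚ.*-monoʳ-≤-nonNeg ℚ.∣ b ∣ {{ℚ.∣-∣-nonNeg b}} a≤B ⟩
    B ℚ.* ℚ.∣ b ∣          ≤⟨ ℚ.*-monoˡ-≤-nonNeg B {{ℚ.nonNegative (ℚ.<⇒≤ 0<B)}} b≤δ ⟩
    B ℚ.* δ                ∎
    where open ℚ.≤-Reasoning

fromℚ : ℚ → ℝ
fromℚ q = record
  { seq    = λ _ → q
  ; cauchy = λ ε 0<ε → 0 , λ _ _ _ _ →
      subst (ℚ._≤ ε) (sym (cong ℚ.∣_∣ (ℚ.+-inverseʳ q))) (ℚ.<⇒≤ 0<ε)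
  }

fromℕ : ℕ → ℝ
fromℕ n = fromℚ (ℤ.+ n ℚ./ 1)

infixl 6 _+_ _-_
infixl 7 _*_
infix  8 -_

_+_ : ℝ → ℝ → ℝ
seq    (x + y) n = seq x n ℚ.+ seq y n
cauchy (x + y) ε 0<ε =
  let (M , f) = cauchy x (½ ℚ.* ε) (split 0<ε)
      (N , g) = cauchy y (½ ℚ.* ε) (split 0<ε)
  in M ℕ.⊔ N , λ m n M⊔N≤m M⊔N≤n → let open ℚ.≤-Reasoning in begin
    ℚ.∣ (seq x m ℚ.+ seq y m) ℚ.- (seq x n ℚ.+ seq y n) ∣
      ≡⟨ cong ℚ.∣_∣ (+-diff (seq x m) (seq y m) (seq x n) (seq y n)) ⟩
    ℚ.∣ (seq x m ℚ.- seq x n) ℚ.+ (seq y m ℚ.- seq y n) ∣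
      ≤⟨ ℚ.∣p+q∣≤∣p∣+∣q∣ (seq x m ℚ.- seq x n) (seq y m ℚ.- seq y n) ⟩
    ℚ.∣ seq x m ℚ.- seq x n ∣ ℚ.+ ℚ.∣ seq y m ℚ.- seq y n ∣
      ≤⟨ ℚ.+-mono-≤
           (f m n (ℕ.m⊔n≤o⇒m≤o M N M⊔N≤m) (ℕ.m⊔n≤o⇒m≤o M N M⊔N≤n))
           (g m n (ℕ.m⊔n≤o⇒n≤o M N M⊔N≤m) (ℕ.m⊔n≤o⇒n≤o M N M⊔N≤n)) ⟩
    ½ ℚ.* ε ℚ.+ ½ ℚ.* ε
      ≡⟨ halves ε ⟩
    ε ∎

-_ : ℝ → ℝ
seq    (- x) n = ℚ.- seq x n
cauchy (- x) ε 0<ε =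
  let (N , f) = cauchy x ε 0<ε
  in N , λ m n N≤m N≤n →
    subst (ℚ._≤ ε)
      (sym (trans (cong ℚ.∣_∣ (neg-diff (seq x m) (seq x n))) (ℚ.∣-p∣≡∣p∣ (seq x m ℚ.- seq x n))))
      (f m n N≤m N≤n)

_-_ : ℝ → ℝ → ℝ
x - y = x + (- y)

_*_ : ℝ → ℝ → ℝ
seq    (x * y) n = seq x n ℚ.* seq y n
cauchy (x * y) ε 0<ε =
  let (K , A , 0<A , x≤A) = bounded x
      (L , B , 0<B , y≤B) = bounded y
      (δ , 0<δ , Aδ)      = share 0<ε 0<A
      (η , 0<η , Bη)      = share 0<ε 0<B
      (M , f)             = cauchy x η 0<η
      (N , g)             = cauchy y δ 0<δ
      P = (K ℕ.⊔ L) ℕ.⊔ (M ℕ.⊔ N)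
      KL : ∀ {m} → P ℕ.≤ m → K ℕ.⊔ L ℕ.≤ m
      KL = ℕ.m⊔n≤o⇒m≤o (K ℕ.⊔ L) (M ℕ.⊔ N)
      MN : ∀ {m} → P ℕ.≤ m → M ℕ.⊔ N ℕ.≤ m
      MN = ℕ.m⊔n≤o⇒n≤o (K ℕ.⊔ L) (M ℕ.⊔ N)
  in P , λ m n P≤m P≤n → let open ℚ.≤-Reasoning in begin
    ℚ.∣ (seq x m ℚ.* seq y m) ℚ.- (seq x n ℚ.* seq y n) ∣
      ≡⟨ cong ℚ.∣_∣ (*-diff (seq x m) (seq y m) (seq x n) (seq y n)) ⟩
    ℚ.∣ seq x m ℚ.* (seq y m ℚ.- seq y n) ℚ.+ seq y n ℚ.* (seq x m ℚ.- seq x n) ∣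
      ≤⟨ ℚ.∣p+q∣≤∣p∣+∣q∣ (seq x m ℚ.* (seq y m ℚ.- seq y n)) (seq y n ℚ.* (seq x m ℚ.- seq x n)) ⟩
    ℚ.∣ seq x m ℚ.* (seq y m ℚ.- seq y n) ∣ ℚ.+ ℚ.∣ seq y n ℚ.* (seq x m ℚ.- seq x n) ∣
      ≤⟨ ℚ.+-mono-≤
           (*-bound {seq x m} 0<A (x≤A m (ℕ.m⊔n≤o⇒m≤o K L (KL P≤m)))
             (g m n (ℕ.m⊔n≤o⇒n≤o M N (MN P≤m)) (ℕ.m⊔n≤o⇒n≤o M N (MN P≤n))))
           (*-bound {seq y n} 0<B (y≤B n (ℕ.m⊔n≤o⇒n≤o K L (KL P≤n)))
             (f m n (ℕ.m⊔n≤o⇒m≤o M N (MN P≤m)) (ℕ.m⊔n≤o⇒m≤o M N (MN P≤n)))) ⟩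
    A ℚ.* δ ℚ.+ B ℚ.* η
      ≡⟨ cong₂ ℚ._+_ Aδ Bη ⟩
    ½ ℚ.* ε ℚ.+ ½ ℚ.* ε
      ≡⟨ halves ε ⟩
    ε ∎

abs : ℝ → ℝ
seq    (abs x) n = ℚ.∣ seq x n ∣
cauchy (abs x) ε 0<ε =
  let (N , f) = cauchy x ε 0<ε
  in N , λ m n N≤m N≤n → ℚ.≤-trans (∣∣-diff (seq x m) (seq x n)) (f m n N≤m N≤n)

0ℝ 1ℝ : ℝ
0ℝ = fromℕ 0
1ℝ = fromℕ 1

ℝ-rawRing : RawRing 0ℓ 0ℓ
ℝ-rawRing = record
  { Carrier = ℝ ; _≈_ = _≈_ ; _+_ = _+_ ; _*_ = _*_ ; -_ = -_ ; 0# = 0ℝ ; 1# = 1ℝ }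

open RawSemiringDefs (RawRing.rawSemiring ℝ-rawRing) public using (_^_)
open RawSemiringDefs (RawRing.rawSemiring ℝ-rawRing) using (product)

------------------------------------------------------------------------
-- Asymptotics

Eventually : (ℕ → Set) → Set
Eventually P = ∃ λ n₀ → ∀ n → n₀ ℕ.≤ n → P n

Converges : (ℕ → ℝ) → ℝ → Set
Converges f x = ∀ ε → 0ℝ < ε → Eventually λ n → abs (f n - x) ≤ ε

TendsToInfinity : (ℕ → ℝ) → Set
TendsToInfinity f = ∀ M → Eventually λ n → M ≤ f n

-- f / g → 0, written without division.
infix 4 _≪_ _≫_

_≪_ _≫_ : (ℕ → ℝ) → (ℕ → ℝ) → Set
f ≪ g = ∀ ε → 0ℝ < ε → Eventually λ n → abs (f n) ≤ ε * abs (g n)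
g ≫ f = f ≪ g

-- Quotients, roots and logarithms are given by their graphs, so that no
-- proof of apartness from 0 or of positivity has to be carried around.

-- t = x / y, for y apart from 0
IsQuotient : (t x y : ℝ) → Set
IsQuotient t x y = t * y ≈ x

-- r = x ^ (1 / d), for d ≥ 1 and x ≥ 0
IsRoot : ℕ → (r x : ℝ) → Set
IsRoot d r x = 0ℝ ≤ r × r ^ d ≈ x

-- y = log x (natural logarithm), that is, exp y = x, with
-- exp y = lim (1 + y / m) ^ m; m is shifted by one to be nonzero.
IsLog : (y x : ℝ) → Set
IsLog y x = Converges (λ m → (1ℝ + y * fromℚ (ℤ.+ 1 ℚ./ suc m)) ^ suc m) x

------------------------------------------------------------------------
-- Random subsets

subsets : ∀ n → List (Subset n)
subsets zero    = [] ∷ []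
subsets (suc n) = List.map (outside ∷_) (subsets n) ++ List.map (inside ∷_) (subsets n)

weight : ∀ {n} → ℝ → Subset n → ℝ
weight p R = product λ i → if lookup R i then p else (1ℝ - p)

prob : ∀ {n} → ℝ → (Subset n → Bool) → ℝ
prob {n} p F = List.foldr (λ R s → (if F R then weight p R else 0ℝ) + s) 0ℝ (subsets n)

-- Pr[E] ≥ c. Inequalities between reals are not decidable, so the event E
-- is measured from inside, by decidable events F contained in it; if E is
-- itself decidable the best F is E.
ProbAtLeast : ∀ {n} → ℝ → (Subset n → Set) → ℝ → Set
ProbAtLeast p E c = ∃ λ F → (∀ R → F R ≡ true → E R) × c ≤ prob p F

AAS : (ℕ → ℝ) → (∀ n → .{{NonZero n}} → Subset n → Set) → Set
AAS p E = ∀ ε → 0ℝ < ε → Eventually λ n → .{{_ : NonZero n}} →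
  ProbAtLeast (p n) (E n) (1ℝ - ε)

------------------------------------------------------------------------
-- The cyclic group C n on the residues 0, …, n - 1

C : ∀ n → .{{NonZero n}} → RawMonoid 0ℓ 0ℓ
C n = record
  { Carrier = Fin n
  ; _≈_     = _≡_
  ; _∙_     = λ a b → (toℕ a ℕ.+ toℕ b) mod n
  ; ε       = 0 mod n
  }

module _ {n : ℕ} .{{_ : NonZero n}} where

  open RawMonoidDefs (C n) using () renaming (_×_ to _·_)

  Generator : Fin n → Set
  Generator g = ∀ a → ∃ λ m → m · g ≡ a

  private
    toℕ-· : ∀ m g → toℕ (m · g) ≡ (m ℕ.* toℕ g) % n
    toℕ-· zero    g = Fin.toℕ-fromℕ< (m%n<n 0 n)
    toℕ-· (suc m) g = begin
      toℕ (suc m · g)                              ≡⟨ Fin.toℕ-fromℕ< (m%n<n (toℕ g ℕ.+ toℕ (m · g)) n) ⟩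
      (toℕ g ℕ.+ toℕ (m · g)) % n                  ≡⟨ cong (λ z → (toℕ g ℕ.+ z) % n) (toℕ-· m g) ⟩
      (toℕ g ℕ.+ (m ℕ.* toℕ g) % n) % n            ≡⟨ %-distribˡ-+ (toℕ g) ((m ℕ.* toℕ g) % n) n ⟩
      (toℕ g % n ℕ.+ (m ℕ.* toℕ g) % n % n) % n    ≡⟨ cong (λ z → (toℕ g % n ℕ.+ z) % n) (m%n%n≡m%n (m ℕ.* toℕ g) n) ⟩
      (toℕ g % n ℕ.+ (m ℕ.* toℕ g) % n) % n        ≡⟨ %-distribˡ-+ (toℕ g) (m ℕ.* toℕ g) n ⟨
      (toℕ g ℕ.+ m ℕ.* toℕ g) % n                  ∎
      where open ≡-Reasoning

    reduce : ∀ m g → toℕ (m mod n) · g ≡ m · g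
    reduce m g = Fin.toℕ-injective (begin
      toℕ (toℕ (m mod n) · g)                ≡⟨ toℕ-· (toℕ (m mod n)) g ⟩
      (toℕ (m mod n) ℕ.* toℕ g) % n          ≡⟨ cong (λ z → (z ℕ.* toℕ g) % n) (Fin.toℕ-fromℕ< (m%n<n m n)) ⟩
      (m % n ℕ.* toℕ g) % n                  ≡⟨ %-distribˡ-* (m % n) (toℕ g) n ⟩
      (m % n % n ℕ.* (toℕ g % n)) % n        ≡⟨ cong (λ z → (z ℕ.* (toℕ g % n)) % n) (m%n%n≡m%n m n) ⟩
      (m % n ℕ.* (toℕ g % n)) % n            ≡⟨ %-distribˡ-* m (toℕ g) n ⟨
      (m ℕ.* toℕ g) % n                      ≡⟨ toℕ-· m g ⟨
      toℕ (m · g)                            ∎)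
      where open ≡-Reasoning

  generator? : Decidable Generator
  generator? g = Fin.all? λ a → map′
    (λ (i , e) → toℕ i , e)
    (λ (m , e) → m mod n , trans (reduce m g) e)
    (Fin.any? λ i → toℕ i · g Fin.≟ a)

φ : ∀ n → .{{NonZero n}} → ℕ
φ n = length (filter generator? (List.allFin n))

------------------------------------------------------------------------
-- Sequences (multisets) over C n, given by the multiplicity of each element

Sequence : ℕ → Set
Sequence n = Vec ℕ n

∥_∥ : ∀ {n} → Sequence n → ℕ
∥ S ∥ = Vec.sum S

infix 4 _⊑_

_⊑_ : ∀ {n} → Sequence n → Sequence n → Set
T ⊑ S = Pointwise ℕ._≤_ T S

support : ∀ {n} → Sequence n → Subset n
support = Vec.map λ { zero → outside ; (suc _) → inside }

module _ {n : ℕ} .{{_ : NonZero n}} where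

  open RawMonoidDefs (C n) using (sum) renaming (_×_ to _·_)
  open RawMonoid (C n) using (ε)

  σ : Sequence n → Fin n
  σ S = sum λ a → lookup S a · a

  ZeroSum : Sequence n → Set
  ZeroSum S = σ S ≡ ε

  ZeroSumFree : Sequence n → Set
  ZeroSumFree S = ∀ T → T ⊑ S → 0 ℕ.< ∥ T ∥ → ¬ ZeroSum T

private
  subsequences : ∀ {n} → Sequence n → List (Sequence n)
  subsequences []      = [] ∷ []
  subsequences (m ∷ S) = concatMap (λ i → List.map (i ∷_) (subsequences S)) (upTo (suc m))

  ∈-subsequences : ∀ {n} {T S : Sequence n} → T ⊑ S → T ∈ subsequences S
  ∈-subsequences []                  = here refl
  ∈-subsequences {T = i ∷ _} (i≤m ∷ T⊑S) = ∈-concatMap⁺ _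
    (Any.map (λ { refl → ∈-map⁺ (i ∷_) (∈-subsequences T⊑S) }) (∈-upTo⁺ (ℕ.s≤s i≤m)))

zeroSumFree? : ∀ {n} .{{_ : NonZero n}} → Decidable (ZeroSumFree {n})
zeroSumFree? S = map′
  (λ h T T⊑S → All.lookup h (∈-subsequences T⊑S) T⊑S)
  (λ h → All.universal h (subsequences S))
  (All.all? (λ T → Pointwise.decidable ℕ._≤?_ T S →-dec
                   (0 ℕ.<? ∥ T ∥ →-dec ¬? (σ T Fin.≟ _)))
            (subsequences S))

-- All sequences S over C n with ∥ S ∥ ≡ ℓ, without repetition
sequences : ∀ n → ℕ → List (Sequence n)
sequences zero    zero    = [] ∷ []
sequences zero    (suc _) = []
sequences (suc n) ℓ       =
  concatMap (λ m → List.map (m ∷_) (sequences n (ℓ ℕ.∸ m))) (upTo (suc ℓ))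

N : ∀ n → .{{NonZero n}} → (ℓ d : ℕ) → Subset n → ℕ
N n ℓ d R = length (filter
  (λ S → zeroSumFree? S ×-dec (∣ support S ∣ ℕ.≟ d) ×-dec (support S ⊆? R))
  (sequences n ℓ))

------------------------------------------------------------------------
-- Partitions

-- All lists of positive integers with sum j, without repetition: those of
-- j + 1 come from those of j by prepending 1 or by increasing the head.
compositions : ℕ → List (List ℕ)
compositions zero    = [] ∷ []
compositions (suc j) = concatMap grow (compositions j)
  where
  grow : List ℕ → List (List ℕ)
  grow []       = (1 ∷ []) ∷ []
  grow (x ∷ xs) = (1 ∷ x ∷ xs) ∷ (suc x ∷ xs) ∷ []

partitions : ℕ → List (List ℕ)
partitions j = filter (linked? ℕ._≤?_) (compositions j)

q : (j d : ℕ) → ℕ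
q j d = length (filter (λ xs → length (deduplicate ℕ._≟_ xs) ℕ.≟ d) (partitions j))

-- Σ f j over a ≤ j ≤ b, empty if b < a
sumFromTo : (a b : ℕ) → (ℕ → ℕ) → ℕ
sumFromTo a b f = ListAction.sum (List.map f (filter (a ℕ.≤?_) (upTo (suc b))))

-- Let S be a zero-sum free sequence of length n - 1 - k over C n in which
-- h has multiplicity m > k. The i h (i ≤ m), continued by the partial sums
-- of the remaining terms, and the x + j h (j < m), for another term x, are
-- more than n sums of subsequences, so two of them agree, and the only
-- coincidence compatible with zero-sum freeness is x = c h with 1 ≤ c ≤ m.
-- The subsums of S are then all i h with i up to the sum J of the
-- coordinates c, so the order of h exceeds J ≥ n - 1 - k: thus h generates
-- C n and J < n. Hence S is h together with the partition of some j ≤ k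
-- into the c - 1, which has one distinct part less than S has distinct terms.
--
-- So N counts the members inside R of a family of s φ(n) subsets of size d
-- such that each point lies in boundedly many of them. Its mean is
-- s p^d φ(n) and its variance is at most a constant times p^d φ(n), and
-- Chebyshev's inequality gives both parts, as ω and log n tend to infinity.
module Submission where

-- A frequent term `h` exists because `d` distinct terms of multiplicity at most `k` make up a
-- length of at most `d * k`. So `d * k < n - 1 - k` is all that the combinatorics asks of `n`; it
-- holds for `d = 1`, `k ≤ n / 3` and `n ≥ 6`, and for all large `n` when `k` and `d` are fixed.
--
-- The probabilistic half is shaped by the reals being Cauchy sequences whose order cannot be
-- decided: an event has to be certified by a decidable test, and the approximants of `p` may leave
-- the interval from 0 to 1. The estimates are therefore made at a rational `q` in that interval and
-- carried over to `p` by Lipschitz bounds for the polynomials `E` and `pow`. These bounds grow with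
-- `n`, which does no harm because `q` is chosen after `n`. Square roots are postponed to the very
-- end by comparing the squared deviation with `Q * T`.

module Combinatorics where

  import Algebra.Definitions.RawMonoid as RawMonoidDefs
  open import Data.Bool.Base using (true; false; if_then_else_)
  open import Data.Empty using (⊥; ⊥-elim)
  open import Data.Fin.Base as Fin using (Fin; zero; suc; toℕ; fromℕ<; splitAt)
  open import Data.Fin.Permutation using (Permutation; permutation)
  import Data.Fin.Properties as Fin
  open import Data.Fin.Subset using (Subset; _⊆_; ∣_∣) renaming (_∈_ to _∈ₛ_)
  open import Data.Fin.Subset.Properties using (_⊆?_; _∈?_)
  open import Data.List.Base as List using (List; []; _∷_; _++_; length; concatMap; map; filter; deduplicate; replicate; upTo; cartesianProduct; allFin)
  open import Data.List.Membership.Propositional using (_∈_; find; lose)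
  open import Data.List.Membership.Propositional.Properties
  open import Data.List.Membership.Propositional.Properties.WithK using (unique∧set⇒bag)
  import Data.List.Properties as List
  open import Data.List.Relation.Binary.BagAndSetEquality using (∼bag⇒↭)
  open import Data.List.Relation.Binary.Permutation.Propositional.Properties using (↭-length)
  open import Data.List.Relation.Unary.All as All using (All; []; _∷_)
  import Data.List.Relation.Unary.All.Properties as All
  open import Data.List.Relation.Unary.AllPairs as AllPairs using (AllPairs; []; _∷_)
  import Data.List.Relation.Unary.AllPairs.Properties as AllPairs
  open import Data.List.Relation.Unary.Any using (here; there)
  open import Data.List.Relation.Unary.Linked using (Linked; linked?)
  import Data.List.Relation.Unary.Linked.Properties as Linked
  open import Data.List.Relation.Unary.Unique.Propositional using (Unique)
  import Data.List.Relation.Unary.Unique.DecPropositional.Properties as UniqueDec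
  import Data.List.Relation.Unary.Unique.Propositional.Properties as Unique
  open import Data.Nat.Base
  open import Data.Nat.Coprimality using (coprime-Bézout; gcd≡1⇒coprime)
  open import Data.Nat.Divisibility
  open import Data.Nat.DivMod
  open import Data.Nat.GCD using (gcd; gcd[m,n]∣m; gcd[m,n]∣n; module Bézout)
  import Data.Nat.ListAction as ListAction
  open import Data.Nat.ListAction.Properties using (sum-++)
  open import Data.Nat.Properties
  open import Data.Nat.Tactic.RingSolver using (solve-∀)
  open import Algebra.Properties.Semiring.Sum +-*-semiring
  open import Data.Product using (∃; ∃₂; _×_; _,_; proj₁; proj₂)
  open import Data.Sum.Base using (_⊎_; inj₁; inj₂; [_,_]′)
  open import Data.Vec.Base as Vec using (Vec; []; _∷_; lookup; tabulate)
  import Data.Vec.Properties as Vec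
  open import Data.Vec.Relation.Binary.Pointwise.Extensional using (ext; extensional⇒inductive)
  import Data.Vec.Relation.Binary.Pointwise.Inductive as Pointwise
  open import Function.Base using (_∘_)
  open import Function.Bundles using (mk⇔)
  open import Relation.Binary.Definitions using (tri<; tri≈; tri>)
  open import Relation.Binary.PropositionalEquality
  open import Relation.Nullary
  open import Relation.Nullary.Decidable using (_×-dec_)
  open import Relation.Unary using (Decidable)

  -- Finite sums, linear functionals on multiplicity vectors, and congruences.

  module Sums where

    sum-mono : ∀ {n} {f g : Fin n → ℕ} → (∀ i → f i ≤ g i) → sum f ≤ sum g
    sum-mono {zero}  h = z≤n
    sum-mono {suc n} h = +-mono-≤ (h zero) (sum-mono (h ∘ suc))

    term≤sum : ∀ {n} (f : Fin n → ℕ) i → f i ≤ sum f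
    term≤sum f zero    = m≤m+n _ _
    term≤sum f (suc i) = ≤-trans (term≤sum (f ∘ suc) i) (m≤n+m _ _)

    sum-zero : ∀ {n} {f : Fin n → ℕ} → (∀ i → f i ≡ 0) → sum f ≡ 0
    sum-zero {n} h = trans (sum-cong-≗ h) (sum-replicate-zero n)

    δ : ∀ {n} → Fin n → Fin n → ℕ
    δ i j = if does (i Fin.≟ j) then 1 else 0

    δ-≢ : ∀ {n} {i j : Fin n} → i ≢ j → δ i j ≡ 0
    δ-≢ {i = i} {j} ne with i Fin.≟ j
    ... | yes e = ⊥-elim (ne e)
    ... | no _  = refl

    sum-δ : ∀ {n} (i : Fin n) (f : Fin n → ℕ) → sum (λ j → δ i j * f j) ≡ f i
    sum-δ {suc n} zero    f =
      trans (cong₂ _+_ (+-identityʳ (f zero)) (sum-zero {n} λ _ → refl)) (+-identityʳ (f zero))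
    sum-δ {suc n} (suc i) f = sum-δ i (f ∘ suc)

    sum-sub : ∀ {n} {f g : Fin n → ℕ} → (∀ i → f i ≤ g i) → sum (λ i → g i ∸ f i) + sum f ≡ sum g
    sum-sub {f = f} {g} h = trans (sym (∑-distrib-+ (λ i → g i ∸ f i) f)) (sum-cong-≗ (λ i → m∸n+n≡m (h i)))

    -- For `c = toℕ` this represents the sum of the sequence `T` in `C n`; for coordinates or
    -- logarithms `c` it is the integer total that gets compared with `n`.
    weight : ∀ {n} → (Fin n → ℕ) → (Fin n → ℕ) → ℕ
    weight c T = sum (λ a → T a * c a)

    weight-mono : ∀ {n} (c : Fin n → ℕ) {T U} → (∀ a → T a ≤ U a) → weight c T ≤ weight c U
    weight-mono c h = sum-mono (λ a → *-monoˡ-≤ (c a) (h a))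

    weight-+ : ∀ {n} (c T U : Fin n → ℕ) → weight c (λ a → T a + U a) ≡ weight c T + weight c U
    weight-+ c T U = trans (sum-cong-≗ (λ a → *-distribʳ-+ (c a) (T a) (U a)))
                           (∑-distrib-+ (λ a → T a * c a) (λ a → U a * c a))

    weight-δ : ∀ {n} (c : Fin n → ℕ) i h → weight c (λ a → i * δ h a) ≡ i * c h
    weight-δ c i h = trans (sum-cong-≗ (λ a → *-assoc i (δ h a) (c a)))
      (trans (sym (*-distribˡ-sum i (λ a → δ h a * c a))) (cong (i *_) (sum-δ h c)))

    sum-*δ : ∀ {n} i (h : Fin n) → sum (λ a → i * δ h a) ≡ i
    sum-*δ i h = trans (sum-cong-≗ (λ a → sym (*-identityʳ (i * δ h a))))
                   (trans (weight-δ (λ _ → 1) i h) (*-identityʳ i))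

    -- The first `t` terms of the multiset in the order of `Fin n`. A fixed order makes these
    -- subsequences increase with `t`, so that they form a chain.
    trunc : ∀ {n} → ℕ → (Fin n → ℕ) → Fin n → ℕ
    trunc t S zero    = S zero ⊓ t
    trunc t S (suc i) = trunc (t ∸ S zero) (S ∘ suc) i

    trunc-≤ : ∀ {n} t (S : Fin n → ℕ) a → trunc t S a ≤ S a
    trunc-≤ t S zero    = m⊓n≤m _ _
    trunc-≤ t S (suc a) = trunc-≤ (t ∸ S zero) (S ∘ suc) a

    trunc-mono : ∀ {n t t'} (S : Fin n → ℕ) → t ≤ t' → ∀ a → trunc t S a ≤ trunc t' S a
    trunc-mono S h zero    = ⊓-monoʳ-≤ (S zero) h
    trunc-mono S h (suc a) = trunc-mono (S ∘ suc) (∸-monoˡ-≤ (S zero) h) a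

    sum-trunc : ∀ {n} t (S : Fin n → ℕ) → t ≤ sum S → sum (trunc t S) ≡ t
    sum-trunc {zero}  t S h = sym (n≤0⇒n≡0 h)
    sum-trunc {suc n} t S h = trans
      (cong (S zero ⊓ t +_) (sum-trunc (t ∸ S zero) (S ∘ suc)
        (≤-trans (∸-monoˡ-≤ (S zero) h) (≤-reflexive (m+n∸m≡n (S zero) _)))))
      (m⊓n+n∸m≡n (S zero) t)

    %≡⇒∣∸ : ∀ {n a b} .{{_ : NonZero n}} → a % n ≡ b % n → a ≤ b → n ∣ b ∸ a
    %≡⇒∣∸ {n} {a} {b} e a≤b = divides (b / n ∸ a / n) (begin
      b ∸ a  ≡⟨ cong₂ _∸_ (m≡m%n+[m/n]*n b n) (m≡m%n+[m/n]*n a n) ⟩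
      (b % n + b / n * n) ∸ (a % n + a / n * n)  ≡⟨ cong (λ z → (b % n + b / n * n) ∸ (z + a / n * n)) e ⟩
      (b % n + b / n * n) ∸ (b % n + a / n * n)  ≡⟨ [m+n]∸[m+o]≡n∸o (b % n) _ _ ⟩
      b / n * n ∸ a / n * n  ≡⟨ *-distribʳ-∸ n (b / n) (a / n) ⟨
      (b / n ∸ a / n) * n  ∎)
      where open ≡-Reasoning

    +-cong-% : ∀ {n a a' b b'} .{{_ : NonZero n}} → a % n ≡ a' % n → b % n ≡ b' % n → (a + b) % n ≡ (a' + b') % n
    +-cong-% {n} {a} {a'} {b} {b'} p q = trans (%-distribˡ-+ a b n)
      (trans (cong₂ (λ x y → (x + y) % n) p q) (sym (%-distribˡ-+ a' b' n)))

    *-cong-% : ∀ {n a a' b b'} .{{_ : NonZero n}} → a % n ≡ a' % n → b % n ≡ b' % n → (a * b) % n ≡ (a' * b') % n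
    *-cong-% {n} {a} {a'} {b} {b'} p q = trans (%-distribˡ-* a b n)
      (trans (cong₂ (λ x y → (x * y) % n) p q) (sym (%-distribˡ-* a' b' n)))

    sum-cong-% : ∀ {n m} .{{_ : NonZero n}} {f g : Fin m → ℕ} → (∀ i → f i % n ≡ g i % n) → sum f % n ≡ sum g % n
    sum-cong-% {m = zero}  h = refl
    sum-cong-% {n} {suc m} {f = f} {g} h =
      +-cong-% {n} {f zero} {g zero} {sum (f ∘ suc)} {sum (g ∘ suc)} (h zero) (sum-cong-% (h ∘ suc))

  -- Zero-sum free sequences and the pigeonhole argument for a frequent term.

  module FreeSequence {n : ℕ} .{{_ : NonZero n}} (S : Fin n → ℕ) where

    open Sums

    Free : Set
    Free = ∀ T → (∀ a → T a ≤ S a) → 0 < sum T → ¬ n ∣ weight toℕ T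

    module _ (free : Free) where

      -- Otherwise the difference of `V` and `U` would be a nonempty zero-sum subsequence. All
      -- distinctness below comes from this, so only nested subsequences can be separated.
      strict : ∀ {U V} → (∀ a → U a ≤ V a) → (∀ a → V a ≤ S a) → sum U < sum V →
               weight toℕ U % n ≢ weight toℕ V % n
      strict {U} {V} U≤V V≤S U<V e = free T (λ a → ≤-trans (m∸n≤m (V a) (U a)) (V≤S a)) 0<T n∣T
        where
        T : Fin n → ℕ
        T a = V a ∸ U a
        0<T : 0 < sum T
        0<T = +-cancelʳ-< (sum U) 0 (sum T) (subst (sum U <_) (sym (sum-sub U≤V)) U<V)
        n∣T : n ∣ weight toℕ T
        n∣T = subst (n ∣_)
          (trans (cong (_∸ weight toℕ U) (sym (trans (sym (weight-+ toℕ T U))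
            (sum-cong-≗ (λ a → cong (_* toℕ a) (m∸n+n≡m (U≤V a)))))))
            (m+n∸n≡m (weight toℕ T) (weight toℕ U)))
          (%≡⇒∣∸ e (weight-mono toℕ U≤V))

      module Chain (h x : Fin n) (x≢h : x ≢ h) (0<Sx : 0 < S x) where

        m : ℕ
        m = S h

        base rest : Fin n → ℕ
        base a = m * δ h a + 1 * δ x a
        rest a = S a ∸ base a

        base≤S : ∀ a → base a ≤ S a
        base≤S a with h Fin.≟ a
        ... | yes refl = ≤-reflexive (trans (cong₂ _+_ (*-identityʳ m) (trans (*-identityˡ (δ x h)) (δ-≢ x≢h))) (+-identityʳ m))
        ... | no  h≢a with x Fin.≟ a
        ...   | yes refl = subst (_≤ S x) (sym (cong (_+ 1) (*-zeroʳ m))) 0<Sx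
        ...   | no  _    = subst (_≤ S a) (sym (cong (_+ 0) (*-zeroʳ m))) z≤n

        r : ℕ
        r = sum rest

        A : (i j t : ℕ) → Fin n → ℕ
        A i j t a = (i * δ h a + j * δ x a) + trunc t rest a

        A-mono : ∀ {i i' j j' t t'} → i ≤ i' → j ≤ j' → t ≤ t' → ∀ a → A i j t a ≤ A i' j' t' a
        A-mono p q s a = +-mono-≤ (+-mono-≤ (*-monoˡ-≤ (δ h a) p) (*-monoˡ-≤ (δ x a) q)) (trunc-mono rest s a)

        A≤S : ∀ {i j t} → i ≤ m → j ≤ 1 → ∀ a → A i j t a ≤ S a
        A≤S {i} {j} {t} p q a = ≤-trans
          (+-mono-≤ (+-mono-≤ (*-monoˡ-≤ (δ h a) p) (*-monoˡ-≤ (δ x a) q)) (trunc-≤ t rest a))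
          (≤-reflexive (m+[n∸m]≡n (base≤S a)))

        sum-hx : ∀ i j → sum (λ a → i * δ h a + j * δ x a) ≡ i + j
        sum-hx i j = trans (∑-distrib-+ (λ a → i * δ h a) (λ a → j * δ x a)) (cong₂ _+_ (sum-*δ i h) (sum-*δ j x))

        sum-A : ∀ i j {t} → t ≤ r → sum (A i j t) ≡ i + j + t
        sum-A i j {t} p = trans (∑-distrib-+ _ (trunc t rest)) (cong₂ _+_ (sum-hx i j) (sum-trunc t rest p))

        sum-S : m + 1 + r ≡ sum S
        sum-S = trans (+-comm (m + 1) r) (trans (cong (r +_) (sym (sum-hx m 1))) (sum-sub base≤S))

        weight-A0 : ∀ i j → weight toℕ (A i j 0) ≡ i * toℕ h + j * toℕ x
        weight-A0 i j = begin
          weight toℕ (A i j 0)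
            ≡⟨ weight-+ toℕ (λ a → i * δ h a + j * δ x a) (trunc 0 rest) ⟩
          weight toℕ (λ a → i * δ h a + j * δ x a) + weight toℕ (trunc 0 rest)
            ≡⟨ cong₂ _+_ (weight-+ toℕ (λ a → i * δ h a) (λ a → j * δ x a)) (sum-zero (λ a → cong (_* toℕ a) (trunc0 rest a))) ⟩
          weight toℕ (λ a → i * δ h a) + weight toℕ (λ a → j * δ x a) + 0
            ≡⟨ +-identityʳ _ ⟩
          weight toℕ (λ a → i * δ h a) + weight toℕ (λ a → j * δ x a)
            ≡⟨ cong₂ _+_ (weight-δ toℕ i h) (weight-δ toℕ j x) ⟩
          i * toℕ h + j * toℕ x ∎
          where
          open ≡-Reasoning
          trunc0 : ∀ {k} (T : Fin k → ℕ) a → trunc 0 T a ≡ 0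
          trunc0 T zero    = ⊓-zeroʳ (T zero)
          trunc0 T (suc a) = trans (cong (λ z → trunc z (T ∘ suc) a) (0∸n≡0 (T zero))) (trunc0 (T ∘ suc) a)

        A-strict : ∀ {i i' j j' t t'} → i ≤ i' → j ≤ j' → t ≤ t' → i' ≤ m → j' ≤ 1 → t' ≤ r →
                   i + j + t < i' + j' + t' → weight toℕ (A i j t) % n ≢ weight toℕ (A i' j' t') % n
        A-strict {i} {i'} {j} {j'} {t} {t'} p q s i'≤m j'≤1 t'≤r lt =
          strict (A-mono p q s) (A≤S {i'} {j'} {t'} i'≤m j'≤1)
            (subst₂ _<_ (sym (sum-A i j (≤-trans s t'≤r))) (sym (sum-A i' j' t'≤r)) lt)

        -- How `i` terms split into copies of `h`, the copy of `x`, and the rest, filled in this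
        -- order; hence `Z` increases with `i` and is `m h + x` at `i = m + 1`.
        zi zj zt : ℕ → ℕ
        zi i = m ⊓ i
        zj i = 1 ⊓ (i ∸ m)
        zt i = i ∸ m ∸ 1

        Z : ℕ → Fin n → ℕ
        Z i = A (zi i) (zj i) (zt i)

        size-Z : ∀ i → zi i + zj i + zt i ≡ i
        size-Z i = trans (+-assoc (zi i) (zj i) (zt i))
          (trans (cong (zi i +_) (m⊓n+n∸m≡n 1 (i ∸ m))) (m⊓n+n∸m≡n m i))

        zt≤r : ∀ {i} → i ≤ sum S → zt i ≤ r
        zt≤r {i} p = ≤-trans (∸-monoˡ-≤ 1 (∸-monoˡ-≤ m p))
          (≤-reflexive (trans (∸-+-assoc (sum S) m 1) (trans (cong (_∸ (m + 1)) (sym sum-S)) (m+n∸m≡n (m + 1) r))))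

        Z-injective : ∀ {i i'} → i < i' → i' ≤ sum S → weight toℕ (Z i) % n ≢ weight toℕ (Z i') % n
        Z-injective {i} {i'} i<i' p = A-strict
          (⊓-monoʳ-≤ m i≤i') (⊓-monoʳ-≤ 1 (∸-monoˡ-≤ m i≤i')) (∸-monoˡ-≤ 1 (∸-monoˡ-≤ m i≤i'))
          (m⊓n≤m m i') (m⊓n≤m 1 _) (zt≤r p) (subst₂ _<_ (sym (size-Z i)) (sym (size-Z i')) i<i')
          where i≤i' = <⇒≤ i<i'

        V : ℕ → Fin n → ℕ
        V j = A j 1 0

        V-injective : ∀ {j j'} → j < j' → j' < m → weight toℕ (V j) % n ≢ weight toℕ (V j') % n
        V-injective {j} {j'} p q = A-strict (<⇒≤ p) ≤-refl z≤n (<⇒≤ q) ≤-refl z≤n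
          (+-monoˡ-< 0 (+-monoˡ-< 1 p))

        Multiple : Set
        Multiple = ∃ λ c → 1 ≤ c × c ≤ m × (c * toℕ h) % n ≡ toℕ x % n

        -- Nested subsequences cannot agree. For `i > m` the set `Z i` contains `V j`, and for
        -- `i ≤ j` it is contained in `V j`. What remains is `j < i ≤ m`, where `i h = j h + x`
        -- gives `x = (i - j) h`.
        Z≡V : ∀ {i j} → i ≤ sum S → j < m → weight toℕ (Z i) % n ≡ weight toℕ (V j) % n → Multiple
        Z≡V {i} {j} i≤ℓ j<m e with i ≤? m
        ... | no i≰m = ⊥-elim (A-strict {j} {zi i} {1} {zj i} {0} {zt i}
                (subst (j ≤_) (sym (m≤n⇒m⊓n≡m (<⇒≤ m<i))) (<⇒≤ j<m))
                (subst (1 ≤_) (sym (m≤n⇒m⊓n≡m (m<n⇒0<n∸m m<i))) ≤-refl)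
                z≤n (m⊓n≤m m i) (m⊓n≤m 1 _) (zt≤r i≤ℓ)
                (subst (j + 1 + 0 <_) (sym (size-Z i))
                  (≤-trans (s≤s (≤-trans (≤-reflexive (trans (+-identityʳ _) (+-comm j 1))) j<m)) m<i))
                (sym e))
          where m<i = ≰⇒> i≰m
        ... | yes i≤m = go (i ≤? j)
          where
          open ≡-Reasoning
          Zi : weight toℕ (Z i) ≡ weight toℕ (A i 0 0)
          Zi = trans (cong₂ (λ u v → weight toℕ (A u (1 ⊓ v) (v ∸ 1))) (m≥n⇒m⊓n≡n i≤m) (m≤n⇒m∸n≡0 i≤m)) refl
          e' : weight toℕ (A i 0 0) % n ≡ weight toℕ (V j) % n
          e' = trans (cong (_% n) (sym Zi)) e
          go : Dec (i ≤ j) → Multiple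
          go (yes i≤j) = ⊥-elim (A-strict {i} {j} {0} {1} {0} {0} i≤j z≤n z≤n (<⇒≤ j<m) ≤-refl z≤n
            (subst₂ _<_ (sym (trans (+-identityʳ _) (+-identityʳ i))) (sym (trans (+-identityʳ _) (+-comm j 1))) (s≤s i≤j)) e')
          go (no i≰j) = c , m<n⇒0<n∸m j<i , ≤-trans (m∸n≤m i j) i≤m , cancel
            where
            j<i = ≰⇒> i≰j
            c = i ∸ j
            big : (j * toℕ h + c * toℕ h) % n ≡ (j * toℕ h + toℕ x) % n
            big = begin
              (j * toℕ h + c * toℕ h) % n  ≡⟨ cong (_% n) (*-distribʳ-+ (toℕ h) j c) ⟨
              ((j + c) * toℕ h) % n  ≡⟨ cong (λ z → (z * toℕ h) % n) (m+[n∸m]≡n (<⇒≤ j<i)) ⟩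
              (i * toℕ h) % n  ≡⟨ cong (_% n) (+-identityʳ (i * toℕ h)) ⟨
              (i * toℕ h + 0 * toℕ x) % n  ≡⟨ cong (_% n) (weight-A0 i 0) ⟨
              weight toℕ (A i 0 0) % n  ≡⟨ e' ⟩
              weight toℕ (V j) % n  ≡⟨ cong (_% n) (weight-A0 j 1) ⟩
              (j * toℕ h + 1 * toℕ x) % n  ≡⟨ cong (λ z → (j * toℕ h + z) % n) (*-identityˡ (toℕ x)) ⟩
              (j * toℕ h + toℕ x) % n  ∎
            cancel : (c * toℕ h) % n ≡ toℕ x % n
            cancel with ≤-total (c * toℕ h) (toℕ x)
            ... | inj₁ le = sym (trans (cong (_% n) (sym (m+[n∸m]≡n le)))
                    (%-remove-+ʳ (c * toℕ h) (subst (n ∣_) ([m+n]∸[m+o]≡n∸o (j * toℕ h) (toℕ x) (c * toℕ h))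
                      (%≡⇒∣∸ big (+-monoʳ-≤ (j * toℕ h) le)))))
            ... | inj₂ le = trans (cong (_% n) (sym (m+[n∸m]≡n le)))
                    (%-remove-+ʳ (toℕ x) (subst (n ∣_) ([m+n]∸[m+o]≡n∸o (j * toℕ h) (c * toℕ h) (toℕ x))
                      (%≡⇒∣∸ (sym big) (+-monoʳ-≤ (j * toℕ h) le))))

        -- The `Z i` number `sum S + 1` and the `V j` number `m`, at least `n + 1` subsequences in
        -- all for `n` residues.
        multiple : n ≤ sum S + m → Multiple
        multiple n≤ = pigeon (Fin.pigeonhole (s≤s n≤) f)
          where
          index : Fin (suc (sum S)) ⊎ Fin m → Fin n → ℕ
          index = [ Z ∘ toℕ , V ∘ toℕ ]′
          f : Fin (suc (sum S) + m) → Fin n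
          f i = weight toℕ (index (splitAt (suc (sum S)) i)) mod n
          mod⇒% : ∀ {a b} → a mod n ≡ b mod n → a % n ≡ b % n
          mod⇒% {a} {b} e = trans (sym (Fin.toℕ-fromℕ< (m%n<n a n))) (trans (cong toℕ e) (Fin.toℕ-fromℕ< (m%n<n b n)))
          distinct : ∀ u v → u ≢ v → weight toℕ (index u) % n ≡ weight toℕ (index v) % n → Multiple
          distinct (inj₁ i) (inj₁ j) ne e with <-cmp (toℕ i) (toℕ j)
          ... | tri< lt _ _ = ⊥-elim (Z-injective lt (≤-pred (Fin.toℕ<n j)) e)
          ... | tri≈ _ eq _ = ⊥-elim (ne (cong inj₁ (Fin.toℕ-injective eq)))
          ... | tri> _ _ gt = ⊥-elim (Z-injective gt (≤-pred (Fin.toℕ<n i)) (sym e))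
          distinct (inj₁ i) (inj₂ j) ne e = Z≡V (≤-pred (Fin.toℕ<n i)) (Fin.toℕ<n j) e
          distinct (inj₂ i) (inj₁ j) ne e = Z≡V (≤-pred (Fin.toℕ<n j)) (Fin.toℕ<n i) (sym e)
          distinct (inj₂ i) (inj₂ j) ne e with <-cmp (toℕ i) (toℕ j)
          ... | tri< lt _ _ = ⊥-elim (V-injective lt (Fin.toℕ<n j) e)
          ... | tri≈ _ eq _ = ⊥-elim (ne (cong inj₂ (Fin.toℕ-injective eq)))
          ... | tri> _ _ gt = ⊥-elim (V-injective gt (Fin.toℕ<n i) (sym e))
          pigeon : (∃₂ λ i j → i Fin.< j × f i ≡ f j) → Multiple
          pigeon (i , j , i<j , e) = distinct (splitAt _ i) (splitAt _ j)
            (λ eq → <⇒≢ i<j (cong toℕ (trans (sym (Fin.join-splitAt _ m i))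
                      (trans (cong (Fin.join _ m) eq) (Fin.join-splitAt _ m j)))))
            (mod⇒% e)

  -- Subset sums without gaps.

  module Reach where

    open Sums

    Reached : ∀ {n} → (T c : Fin n → ℕ) → ℕ → ℕ → Set
    Reached T c m o = ∃ λ i → ∃ λ U → i ≤ m × (∀ a → U a ≤ T a) × o ≡ i + weight c U

    -- Adding a term shifts the attained interval by at most its length `m`, so no gap opens.
    -- Concretely, an `o` that is too large without the next copy of a term exceeds `m`, hence the
    -- coordinate of that term, and the copy can be subtracted.
    reach : ∀ {n} (T c : Fin n → ℕ) m o → (∀ a → 0 < T a → c a ≤ m) → o ≤ m + weight c T → Reached T c m o
    reach {zero}  T c m o c≤m o≤ = o , T , subst (o ≤_) (+-identityʳ m) o≤ , (λ ()) , sym (+-identityʳ o)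
    reach {suc n} T c m o c≤m o≤ = go (T zero) o ≤-refl o≤
      where
      w = weight (c ∘ suc) (T ∘ suc)
      swap : ∀ m c t w → m + (c + t + w) ≡ c + (m + (t + w))
      swap = solve-∀
      cons : ℕ → (Fin n → ℕ) → Fin (suc n) → ℕ
      cons t U zero    = t
      cons t U (suc a) = U a
      Step : ℕ → ℕ → Set
      Step t o = ∃ λ i → ∃ λ U → i ≤ m × (U zero ≤ t) × (∀ a → U (suc a) ≤ T (suc a)) × o ≡ i + weight c U
      steps : ∀ t o → t ≤ T zero → o ≤ m + (t * c zero + w) → Step t o
      steps zero o t≤ o≤ with i , U , i≤m , U≤T , e ← reach (T ∘ suc) (c ∘ suc) m o (c≤m ∘ suc) o≤ =
        i , cons 0 U , i≤m , z≤n , U≤T , e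
      steps (suc t) o t≤ o≤ with o ≤? m + (t * c zero + w)
      ... | yes o≤' with i , U , i≤m , U0 , U≤T , e ← steps t o (<⇒≤ t≤) o≤' = i , U , i≤m , m≤n⇒m≤1+n U0 , U≤T , e
      ... | no  o≰  with i , U , i≤m , U0 , U≤T , e ← steps t (o ∸ c zero) (<⇒≤ t≤)
                (m≤n+o⇒m∸n≤o o (c zero) (subst (o ≤_) (swap m (c zero) (t * c zero) w) o≤)) =
        i , cons (suc (U zero)) (U ∘ suc) , i≤m , s≤s U0 , U≤T ,
        (begin
          o  ≡⟨ m+[n∸m]≡n c≤o ⟨
          c zero + (o ∸ c zero)  ≡⟨ cong (c zero +_) e ⟩
          c zero + (i + (U zero * c zero + weight (c ∘ suc) (U ∘ suc))) ≡⟨ rearr (c zero) i (U zero * c zero) _ ⟩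
          i + (c zero + U zero * c zero + weight (c ∘ suc) (U ∘ suc))  ∎)
        where
        open ≡-Reasoning
        rearr : ∀ c i u w → c + (i + (u + w)) ≡ i + (c + u + w)
        rearr = solve-∀
        c≤o : c zero ≤ o
        c≤o = ≤-trans (c≤m zero (<-≤-trans (s≤s z≤n) t≤)) (<⇒≤ (≤-<-trans (m≤m+n m _) (≰⇒> o≰)))
      go : ∀ t o → t ≤ T zero → o ≤ m + (t * c zero + w) → Reached T c m o
      go t o t≤ o≤ with i , U , i≤m , U0 , U≤T , e ← steps t o t≤ o≤ =
        i , U , i≤m , (λ { zero → ≤-trans U0 t≤ ; (suc a) → U≤T a }) , e

  -- Units modulo `n`.

  module Units {n : ℕ} .{{_ : NonZero n}} where

    Unit : ℕ → Set
    Unit h = ∃ λ u → (u * h) % n ≡ 1 % n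

    coprime⇒unit : ∀ h → gcd h n ≡ 1 → Unit h
    coprime⇒unit h e with coprime-Bézout (gcd≡1⇒coprime e)
    ... | Bézout.Identity.+- x y eq = x , trans (cong (_% n) (sym eq)) ([m+kn]%n≡m%n 1 y n)
    -- Here `1 + x h = y n`, so the inverse of `h` is `- x`, represented by `x * (n - 1)`.
    ... | Bézout.Identity.-+ x y eq = x * (n ∸ 1) , (begin
      (x * (n ∸ 1) * h) % n  ≡⟨ [m+kn]%n≡m%n (x * (n ∸ 1) * h) y n ⟨
      (x * (n ∸ 1) * h + y * n) % n  ≡⟨ cong (λ z → (x * (n ∸ 1) * h + z) % n) eq ⟨
      (x * (n ∸ 1) * h + (1 + x * h)) % n  ≡⟨ cong (_% n) (rearr x (n ∸ 1) h) ⟩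
      (1 + x * h * suc (n ∸ 1)) % n  ≡⟨ cong (λ z → (1 + x * h * z) % n) (suc-pred n) ⟩
      (1 + x * h * n) % n  ≡⟨ [m+kn]%n≡m%n 1 (x * h) n ⟩
      1 % n  ∎)
      where
      open ≡-Reasoning
      rearr : ∀ x p h → x * p * h + (1 + x * h) ≡ 1 + x * h * suc p
      rearr = solve-∀

    -- The multiple `n / gcd h n` of `h` is divisible by `n`, hence exceeds `J`; a gcd of at least 2
    -- would then give `n ≥ 2 (J + 1) > n`.
    unit : ∀ h J → (∀ o → 1 ≤ o → o ≤ J → ¬ n ∣ o * h) → n ≤ J + J → Unit h
    unit h J indiv n≤2J = coprime⇒unit h e≡1
      where
      e = gcd h n
      n∣n/e*h : (r : e ∣ n) → (s : e ∣ h) → n ∣ quotient r * h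
      n∣n/e*h r@(divides p eq) s@(divides q eq') = divides q
        (trans (cong (p *_) eq') (trans (rearr p q e) (cong (q *_) (sym eq))))
        where
        rearr : ∀ p q e → p * (q * e) ≡ q * (p * e)
        rearr = solve-∀
      e∣n = gcd[m,n]∣n h n
      p = quotient e∣n
      n≡pe : n ≡ p * e
      n≡pe = _∣_.equality e∣n
      1≤p : 1 ≤ p
      1≤p = n≢0⇒n>0 λ p≡0 → ≢-nonZero⁻¹ n (trans n≡pe (cong (_* e) p≡0))
      J<p : J < p
      J<p = ≰⇒> λ p≤J → indiv p 1≤p p≤J (n∣n/e*h e∣n (gcd[m,n]∣m h n))
      e≡1 : e ≡ 1
      e≡1 with e in eq
      ... | zero          = ⊥-elim (≢-nonZero⁻¹ n (trans n≡pe (trans (cong (p *_) eq) (*-zeroʳ p))))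
      ... | suc zero      = refl
      ... | suc (suc e')  = ⊥-elim (<-irrefl refl (begin-strict
        n  ≤⟨ n≤2J ⟩
        J + J  <⟨ +-mono-< J<p J<p ⟩
        p + p  ≤⟨ m≤m+n (p + p) (p * e') ⟩
        p + p + p * e'  ≡⟨ rearr p e' ⟩
        p * suc (suc e')  ≡⟨ cong (p *_) eq ⟨
        p * e  ≡⟨ n≡pe ⟨
        n  ∎))
        where
        open ≤-Reasoning
        rearr : ∀ p e' → p + p + p * e' ≡ p * suc (suc e')
        rearr = solve-∀

  -- Coordinates of a zero-sum free sequence with respect to a frequent term.

  module Coordinatization {n : ℕ} .{{_ : NonZero n}} (S : Fin n → ℕ) (free : FreeSequence.Free S) where

    open Sums
    open FreeSequence S
    open Reach
    open Units {n}

    record Coordinates (h : Fin n) : Set where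
      field
        coord    : Fin n → ℕ
        coord-h  : coord h ≡ 1
        1≤coord  : ∀ a → 0 < S a → 1 ≤ coord a
        coord≤m  : ∀ a → 0 < S a → coord a ≤ S h
        coord-≡  : ∀ a → 0 < S a → (coord a * toℕ h) % n ≡ toℕ a % n

    coordinates : ∀ h → 0 < S h → n ≤ sum S + S h → Coordinates h
    coordinates h 0<Sh n≤ = record
      { coord   = proj₁ ∘ choose
      ; coord-h = coord-h (choose h)
      ; 1≤coord = λ a → proj₁ ∘ proj₂ (proj₂ (choose a))
      ; coord≤m = λ a → proj₁ ∘ proj₂ ∘ proj₂ (proj₂ (choose a))
      ; coord-≡ = λ a → proj₂ ∘ proj₂ ∘ proj₂ (proj₂ (choose a))
      }
      where
      Choice : Fin n → Set
      Choice a = ∃ λ c → (a ≡ h → c ≡ 1) × (0 < S a → 1 ≤ c × c ≤ S h × (c * toℕ h) % n ≡ toℕ a % n)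
      choose : ∀ a → Choice a
      choose a with a Fin.≟ h | S a in eq
      ... | yes refl | _     = 1 , (λ _ → refl) , λ _ → ≤-refl , 0<Sh , cong (_% n) (*-identityˡ (toℕ h))
      -- The value 0 is a filler: the coordinate of an absent element is only ever multiplied by the
      -- multiplicity 0.
      ... | no a≢h   | zero  = 0 , (λ e → ⊥-elim (a≢h e)) , λ ()
      ... | no a≢h   | suc _ with c , p ← Chain.multiple free h a a≢h (subst (0 <_) (sym eq) (s≤s z≤n)) n≤ =
        c , (λ e → ⊥-elim (a≢h e)) , λ _ → p
      coord-h : (u : Choice h) → proj₁ u ≡ 1
      coord-h (c , e , _) = e refl

    module _ {h : Fin n} (C : Coordinates h) where

      open Coordinates C

      -- The multiples of h in S fill the gaps between the partial sums of
      -- the other coordinates, none of which exceeds S h.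
      indivisible : ∀ o → 1 ≤ o → o ≤ weight coord S → ¬ n ∣ o * toℕ h
      indivisible o 1≤o o≤J n∣ = finish (reach S° coord (S h) o
          (λ a 0<S° → coord≤m a (≤-trans 0<S° (m∸n≤m (S a) (S h * δ h a)))) (≤-trans o≤J (≤-reflexive J≡)))
        where
        S° : Fin n → ℕ
        S° a = S a ∸ S h * δ h a
        δ≤S : ∀ a → S h * δ h a ≤ S a
        δ≤S a with h Fin.≟ a
        ... | yes refl = ≤-reflexive (*-identityʳ (S h))
        ... | no _     = subst (_≤ S a) (sym (*-zeroʳ (S h))) z≤n
        J≡ : weight coord S ≡ S h + weight coord S°
        J≡ = begin
          weight coord S
            ≡⟨ sum-cong-≗ (λ a → cong (_* coord a) (m+[n∸m]≡n (δ≤S a))) ⟨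
          weight coord (λ a → S h * δ h a + S° a)
            ≡⟨ weight-+ coord (λ a → S h * δ h a) S° ⟩
          weight coord (λ a → S h * δ h a) + weight coord S°
            ≡⟨ cong (_+ weight coord S°) (trans (weight-δ coord (S h) h) (trans (cong (S h *_) coord-h) (*-identityʳ (S h)))) ⟩
          S h + weight coord S° ∎
          where open ≡-Reasoning
        finish : Reached S° coord (S h) o → ⊥
        finish (i , U , i≤m , U≤ , e) = free T T≤S 0<T (m%n≡0⇒n∣m _ n (trans weight-T (n∣m⇒m%n≡0 _ n n∣)))
          where
          -- `T` has coordinate sum `o`, so its sum in `C n` is `o h`, which `n∣` makes zero;
          -- `1 ≤ o` keeps `T` nonempty.
          T : Fin n → ℕ
          T a = i * δ h a + U a
          T≤S : ∀ a → T a ≤ S a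
          T≤S a with h Fin.≟ a | U≤ a
          ... | yes refl | p = ≤-trans (+-mono-≤ (≤-reflexive (*-identityʳ i)) p)
                  (≤-trans (+-monoʳ-≤ i (∸-monoʳ-≤ (S h) (≤-trans i≤m (≤-reflexive (sym (*-identityʳ (S h)))))))
                    (≤-reflexive (m+[n∸m]≡n i≤m)))
          ... | no _ | p = ≤-trans (+-mono-≤ (≤-reflexive (*-zeroʳ i)) p) (m∸n≤m (S a) (S h * 0))
          o≡ : weight coord T ≡ o
          o≡ = trans (weight-+ coord (λ a → i * δ h a) U)
            (trans (cong (_+ weight coord U) (trans (weight-δ coord i h) (trans (cong (i *_) coord-h) (*-identityʳ i)))) (sym e))
          0<T : 0 < sum T
          0<T = n≢0⇒n>0 λ T≡0 → <⇒≢ 1≤o (trans (sym (sum-zero (λ a → cong (_* coord a)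
            (n≤0⇒n≡0 (≤-trans (term≤sum T a) (≤-reflexive T≡0)))))) o≡)
          weight-T : weight toℕ T % n ≡ (o * toℕ h) % n
          weight-T = begin
            weight toℕ T % n  ≡⟨ sum-cong-% {n} {f = λ a → T a * toℕ a} {g = λ a → T a * coord a * toℕ h} term ⟩
            sum (λ a → T a * coord a * toℕ h) % n  ≡⟨ cong (_% n) (*-distribʳ-sum (toℕ h) (λ a → T a * coord a)) ⟨
            (weight coord T * toℕ h) % n  ≡⟨ cong (λ z → (z * toℕ h) % n) o≡ ⟩
            (o * toℕ h) % n  ∎
            where
            open ≡-Reasoning
            term : ∀ a → (T a * toℕ a) % n ≡ (T a * coord a * toℕ h) % n
            term a with T a in eq
            ... | zero  = refl
            ... | suc t = trans
              (*-cong-% {n} {suc t} {suc t} {toℕ a} {coord a * toℕ h} refl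
                (sym (coord-≡ a (≤-trans (subst (0 <_) (sym eq) (s≤s z≤n)) (T≤S a)))))
              (cong (_% n) (sym (*-assoc (suc t) (coord a) (toℕ h))))

      size≤ : sum S ≤ weight coord S
      size≤ = sum-mono λ a → 1≤ a
        where
        1≤ : ∀ a → S a ≤ S a * coord a
        1≤ a with S a in eq
        ... | zero  = z≤n
        ... | suc s = ≤-trans (≤-reflexive (sym (*-identityʳ (suc s))))
                (*-monoʳ-≤ (suc s) (1≤coord a (subst (0 <_) (sym eq) (s≤s z≤n))))

      -- The case `o = n` of `indivisible`, as `n` divides `n * toℕ h`.
      weight< : weight coord S < n
      weight< = ≰⇒> λ n≤J → indivisible n (>-nonZero⁻¹ n) n≤J (m∣m*n (toℕ h))

      -- Coordinates are at least 1, so the total `J` is at least the length, and half of `n` in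
      -- particular, as `unit` requires.
      h-unit : n ≤ sum S + sum S → Unit (toℕ h)
      h-unit p = unit (toℕ h) (weight coord S) indivisible (≤-trans p (+-mono-≤ size≤ size≤))

  -- Lists without repetition and their lengths.

  module Lists where

    -- `key` recovers from an entry the block that produced it, so different blocks are disjoint.
    concatMap-unique : ∀ {A B : Set} (f : A → List B) (key : B → A) {xs} → Unique xs →
                       (∀ x → Unique (f x)) → (∀ {x y} → y ∈ f x → key y ≡ x) → Unique (concatMap f xs)
    concatMap-unique f key {xs} u uf k = Unique.concat⁺
      (All.map⁺ (All.universal uf xs))
      (AllPairs.map⁺ (AllPairs.map (λ x≢y {_} (p , q) → x≢y (trans (sym (k p)) (k q))) u))

    length-unique : ∀ {A : Set} {xs ys : List A} → Unique xs → Unique ys →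
                    (∀ {x} → x ∈ xs → x ∈ ys) → (∀ {x} → x ∈ ys → x ∈ xs) → length xs ≡ length ys
    length-unique u v f g = ↭-length (∼bag⇒↭ (unique∧set⇒bag u v (mk⇔ f g)))

    map-unique : ∀ {A B : Set} (f : A → B) {xs} → Unique xs →
                 (∀ {x y} → x ∈ xs → y ∈ xs → f x ≡ f y → x ≡ y) → Unique (map f xs)
    map-unique f []      inj = []
    map-unique f (p ∷ u) inj =
      All.map⁺ (All.tabulate λ y∈ e → All.lookup p y∈ (inj (here refl) (there y∈) e))
      ∷ map-unique f u (λ x∈ y∈ → inj (there x∈) (there y∈))

    -- Each step deletes one occurrence of an image from `ys`; injectivity keeps the images of the
    -- remaining entries in what is left.
    length-inject : ∀ {A B : Set} (f : A → B) {xs ys} → Unique xs →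
                    (∀ {x y} → x ∈ xs → y ∈ xs → f x ≡ f y → x ≡ y) →
                    (∀ {x} → x ∈ xs → f x ∈ ys) → length xs ≤ length ys
    length-inject f {[]}     u       inj mem = z≤n
    length-inject f {x ∷ xs} {ys} (p ∷ u) inj mem with as , bs , refl ← ∈-∃++ (mem (here refl)) =
      ≤-trans (s≤s (length-inject f {xs} {as ++ bs} u (λ a b → inj (there a) (there b)) mem'))
        (≤-reflexive (sym (List.length-++-sucʳ as (f x) bs)))
      where
      mem' : ∀ {y} → y ∈ xs → f y ∈ as ++ bs
      mem' {y} y∈ with ∈-++⁻ as (mem (there y∈))
      ... | inj₁ q         = ∈-++⁺ˡ q
      ... | inj₂ (here e)  = ⊥-elim (All.lookup p y∈ (inj (here refl) (there y∈) (sym e)))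
      ... | inj₂ (there q) = ∈-++⁺ʳ as q

    length-concatMap : ∀ {A B : Set} (f : A → List B) xs →
                       length (concatMap f xs) ≡ ListAction.sum (map (length ∘ f) xs)
    length-concatMap f []       = refl
    length-concatMap f (x ∷ xs) = trans (List.length-++ (f x)) (cong (length (f x) +_) (length-concatMap f xs))

    length-filter-map : ∀ {A B : Set} {P : B → Set} (P? : Decidable P) (f : A → B) xs →
                        length (filter P? (map f xs)) ≡ length (filter (λ x → P? (f x)) xs)
    length-filter-map P? f []       = refl
    length-filter-map P? f (x ∷ xs) with does (P? (f x))
    ... | true  = cong suc (length-filter-map P? f xs)
    ... | false = length-filter-map P? f xs

  -- Multiplicities in lists of natural numbers.

  module Counting where

    open Sums
    open Lists

    ind : ℕ → ℕ → ℕ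
    ind x y = if x ≡ᵇ y then 1 else 0

    ind-refl : ∀ x → ind x x ≡ 1
    ind-refl zero    = refl
    ind-refl (suc x) = ind-refl x

    ind-≢ : ∀ {x y} → x ≢ y → ind x y ≡ 0
    ind-≢ {zero}  {zero}  ne = ⊥-elim (ne refl)
    ind-≢ {zero}  {suc y} ne = refl
    ind-≢ {suc x} {zero}  ne = refl
    ind-≢ {suc x} {suc y} ne = ind-≢ (ne ∘ cong suc)

    count : ℕ → List ℕ → ℕ
    count x []       = 0
    count x (y ∷ ys) = ind x y + count x ys

    pos : ℕ → ℕ
    pos zero    = 0
    pos (suc _) = 1

    pos≤1 : ∀ x → pos x ≤ 1
    pos≤1 zero    = z≤n
    pos≤1 (suc x) = ≤-refl

    pos-> : ∀ {x} → 0 < x → pos x ≡ 1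
    pos-> (s≤s _) = refl

    sum-ind : ∀ {B y} (f : ℕ → ℕ) → y < B → sum {B} (λ x → ind (toℕ x) y * f (toℕ x)) ≡ f y
    sum-ind {suc B} {zero}  f _         = trans (cong₂ _+_ (+-identityʳ (f 0)) (sum-zero {B} λ _ → refl)) (+-identityʳ (f 0))
    sum-ind {suc B} {suc y} f (s≤s y<B) = sum-ind (f ∘ suc) y<B

    sum-count : ∀ {B L} (f : ℕ → ℕ) → All (_< B) L →
                sum {B} (λ x → count (toℕ x) L * f (toℕ x)) ≡ ListAction.sum (map f L)
    sum-count {B} f [] = sum-zero {B} λ _ → refl
    sum-count {B} {y ∷ L} f (y<B ∷ h) = trans
      (sum-cong-≗ {B} (λ x → *-distribʳ-+ (f (toℕ x)) (ind (toℕ x) y) (count (toℕ x) L)))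
      (trans (∑-distrib-+ {B} (λ x → ind (toℕ x) y * f (toℕ x)) (λ x → count (toℕ x) L * f (toℕ x)))
        (cong₂ _+_ (sum-ind f y<B) (sum-count f h)))

    sum-1 : ∀ (L : List ℕ) → ListAction.sum (map (λ _ → 1) L) ≡ length L
    sum-1 []      = refl
    sum-1 (x ∷ L) = cong suc (sum-1 L)

    length-count : ∀ {B L} → All (_< B) L → sum {B} (λ x → count (toℕ x) L) ≡ length L
    length-count {B} {L} h = trans (sum-cong-≗ {B} (λ x → sym (*-identityʳ (count (toℕ x) L))))
      (trans (sum-count {B} (λ _ → 1) h) (sum-1 L))

    ∈⇒count : ∀ {x L} → x ∈ L → 0 < count x L
    ∈⇒count {x} (here refl) = ≤-trans (≤-reflexive (sym (ind-refl x))) (m≤m+n (ind x x) _)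
    ∈⇒count {x} {y ∷ L} (there p) = ≤-trans (∈⇒count p) (m≤n+m (count x L) (ind x y))

    count⇒∈ : ∀ {x L} → 0 < count x L → x ∈ L
    count⇒∈ {x} {y ∷ L} p with x ≟ y
    ... | yes refl = here refl
    ... | no  ne   = there (count⇒∈ (subst (λ z → 0 < z + count x L) (ind-≢ ne) p))

    ∉⇒count : ∀ {x L} → ¬ x ∈ L → count x L ≡ 0
    ∉⇒count {x} {L} ∉ = n≤0⇒n≡0 (≮⇒≥ (∉ ∘ count⇒∈))

    count-++ : ∀ x L M → count x (L ++ M) ≡ count x L + count x M
    count-++ x []      M = refl
    count-++ x (y ∷ L) M = trans (cong (ind x y +_) (count-++ x L M)) (sym (+-assoc (ind x y) _ _))

    count-replicate : ∀ x m y → count x (replicate m y) ≡ m * ind x y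
    count-replicate x zero    y = refl
    count-replicate x (suc m) y = cong (ind x y +_) (count-replicate x m y)

    count-unique : ∀ {x L} → Unique L → count x L ≤ 1
    count-unique {x} [] = z≤n
    count-unique {x} {y ∷ L} (p ∷ u) with x ≟ y
    ... | yes refl = ≤-reflexive (cong₂ _+_ (ind-refl x) (∉⇒count (λ x∈ → All.lookup p x∈ refl)))
    ... | no ne    = ≤-trans (≤-reflexive (cong (_+ count x L) (ind-≢ ne))) (count-unique u)

    -- Deduplication replaces each positive multiplicity by 1. In this form the number of distinct
    -- parts can be compared with the size of a support, which is the same kind of sum.
    length-deduplicate : ∀ {B L} → All (_< B) L →
                         length (deduplicate _≟_ L) ≡ sum {B} (λ x → pos (count (toℕ x) L))
    length-deduplicate {B} {L} h = trans (sym (length-count {B} {D} (All.tabulate (λ x∈ → All.lookup h (∈-deduplicate⁻ _≟_ L x∈)))))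
      (sum-cong-≗ {B} (λ x → step (toℕ x)))
      where
      D = deduplicate _≟_ L
      step : ∀ x → count x D ≡ pos (count x L)
      step x with count x L in eq
      ... | zero  = ∉⇒count (λ x∈ → <⇒≢ (∈⇒count (∈-deduplicate⁻ _≟_ L x∈)) (sym eq))
      ... | suc _ = ≤-antisym (count-unique (UniqueDec.deduplicate-! _≟_ L))
                      (∈⇒count (∈-deduplicate⁺ _≟_ (count⇒∈ {x} {L} (subst (0 <_) (sym eq) (s≤s z≤n)))))

    sorted-injective : ∀ {xs ys} → AllPairs _≤_ xs → AllPairs _≤_ ys → (∀ x → count x xs ≡ count x ys) → xs ≡ ys
    sorted-injective {[]}     {[]}     _ _ _ = refl
    sorted-injective {[]}     {y ∷ ys} _ _ e = ⊥-elim (<⇒≢ (∈⇒count {y} {y ∷ ys} (here refl)) (e y))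
    sorted-injective {x ∷ xs} {[]}     _ _ e = ⊥-elim (<⇒≢ (∈⇒count {x} {x ∷ xs} (here refl)) (sym (e x)))
    sorted-injective {x ∷ xs} {y ∷ ys} (p ∷ s) (q ∷ t) e
      with ≤-antisym (least p (count⇒∈ (subst (0 <_) (sym (e y)) (∈⇒count {y} {y ∷ ys} (here refl)))))
                     (least q (count⇒∈ (subst (0 <_) (e x) (∈⇒count {x} {x ∷ xs} (here refl)))))
      where
      least : ∀ {z w zs} → All (z ≤_) zs → w ∈ z ∷ zs → z ≤ w
      least _ (here refl) = ≤-refl
      least p (there w∈)  = All.lookup p w∈
    ... | refl = cong (x ∷_) (sorted-injective s t (λ z → +-cancelˡ-≡ (ind z x) _ _ (e z)))

    -- Inverse to `count` on sorted lists whose entries lie between `x` and `x + r - 1`.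
    expand : (ℕ → ℕ) → (x r : ℕ) → List ℕ
    expand μ x zero    = []
    expand μ x (suc r) = replicate (μ x) x ++ expand μ (suc x) r

    expand-≥ : ∀ μ x r → All (x ≤_) (expand μ x r)
    expand-≥ μ x zero    = []
    expand-≥ μ x (suc r) = All.++⁺ (All.replicate⁺ (μ x) ≤-refl) (All.map <⇒≤ (expand-≥ μ (suc x) r))

    expand-< : ∀ μ x r → All (_< x + r) (expand μ x r)
    expand-< μ x zero    = []
    expand-< μ x (suc r) = All.++⁺ (All.replicate⁺ (μ x) (m<m+n x (s≤s z≤n)))
      (subst (λ z → All (_< z) (expand μ (suc x) r)) (sym (+-suc x r)) (expand-< μ (suc x) r))

    expand-sorted : ∀ μ x r → AllPairs _≤_ (expand μ x r)
    expand-sorted μ x zero    = []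
    expand-sorted μ x (suc r) = AllPairs.++⁺ (rep (μ x)) (expand-sorted μ (suc x) r)
      (All.replicate⁺ (μ x) (All.map <⇒≤ (expand-≥ μ (suc x) r)))
      where
      rep : ∀ m → AllPairs _≤_ (replicate m x)
      rep zero    = []
      rep (suc m) = All.replicate⁺ m ≤-refl ∷ rep m

    count-expand : ∀ μ x r y → x ≤ y → y < x + r → count y (expand μ x r) ≡ μ y
    count-expand μ x zero    y x≤y y< = ⊥-elim (<-irrefl refl (<-≤-trans y< (≤-trans (≤-reflexive (+-identityʳ x)) x≤y)))
    count-expand μ x (suc r) y x≤y y< = trans (count-++ y (replicate (μ x) x) (expand μ (suc x) r)) go
      where
      go : count y (replicate (μ x) x) + count y (expand μ (suc x) r) ≡ μ y
      go with x ≟ y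
      ... | yes refl = trans (cong₂ _+_
              (trans (count-replicate x (μ x) x) (trans (cong (μ x *_) (ind-refl x)) (*-identityʳ (μ x))))
              (∉⇒count (λ x∈ → <-irrefl refl (All.lookup (expand-≥ μ (suc x) r) x∈))))
            (+-identityʳ (μ x))
      ... | no  ne   = cong₂ _+_
              (trans (count-replicate y (μ x) x) (trans (cong (μ x *_) (ind-≢ (ne ∘ sym))) (*-zeroʳ (μ x))))
              (count-expand μ (suc x) r y (≤∧≢⇒< x≤y ne) (subst (y <_) (+-suc x r) y<))

    sum-snoc : ∀ B (f : ℕ → ℕ) → sum {suc B} (f ∘ toℕ) ≡ sum {B} (f ∘ toℕ) + f B
    sum-snoc B f = trans (sum-init-last {B} (f ∘ toℕ))
      (cong₂ _+_ (sum-cong-≗ {B} (cong f ∘ Fin.toℕ-inject₁)) (cong f (Fin.toℕ-fromℕ B)))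

    -- The induction splits off the largest value `suc B`. If it occurs, it contributes at least
    -- `suc e`, the increment of the triangular number; the bound `e ≤ B` is carried along for this
    -- comparison.
    triangular : ∀ B (μ : ℕ → ℕ) → let e = sum {B} (λ x → pos (μ (toℕ x))) in
                 e ≤ B × e * suc e ≤ 2 * sum {B} (λ x → μ (toℕ x) * suc (toℕ x))
    triangular zero    μ = z≤n , z≤n
    triangular (suc B) μ with e≤B , ih ← triangular B μ =
      subst₂ (λ e w → e ≤ suc B × e * suc e ≤ 2 * w)
        (sym (sum-snoc B (pos ∘ μ))) (sym (sum-snoc B (λ x → μ x * suc x)))
        (≤-trans (+-mono-≤ e≤B (pos≤1 (μ B))) (≤-reflexive (+-comm B 1)) , step (μ B))
      where
      e = sum {B} (λ x → pos (μ (toℕ x)))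
      w = sum {B} (λ x → μ (toℕ x) * suc (toℕ x))
      open ≤-Reasoning
      step : ∀ m → (e + pos m) * suc (e + pos m) ≤ 2 * (w + m * suc B)
      step zero    = subst₂ (λ a b → a * suc a ≤ 2 * b) (sym (+-identityʳ e)) (sym (+-identityʳ w)) ih
      step (suc m) = begin
        (e + 1) * suc (e + 1)  ≡⟨ alg e ⟩
        e * suc e + 2 * suc e  ≤⟨ +-mono-≤ ih (*-monoʳ-≤ 2 (s≤s e≤B)) ⟩
        2 * w + 2 * suc B  ≤⟨ m≤m+n _ (2 * (m * suc B)) ⟩
        2 * w + 2 * suc B + 2 * (m * suc B) ≡⟨ alg₂ w (suc B) m ⟩
        2 * (w + suc m * suc B)  ∎
        where
        alg : ∀ e → (e + 1) * suc (e + 1) ≡ e * suc e + 2 * suc e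
        alg = solve-∀
        alg₂ : ∀ w b m → 2 * w + 2 * b + 2 * (m * b) ≡ 2 * (w + suc m * b)
        alg₂ = solve-∀

  -- Partitions enumerated by their number of distinct parts.

  module Partitions where

    open import Defs using (compositions; partitions; q; sumFromTo)
    open Lists
    open Counting
    open Sums

    Positive : List ℕ → Set
    Positive = All (1 ≤_)

    -- Undoes either way of growing a list of positive integers, and so tells from which composition
    -- of `j` a composition of `j + 1` arose.
    shrink : List ℕ → List ℕ
    shrink []                = []
    shrink (zero ∷ xs)       = xs
    shrink (suc zero ∷ xs)   = xs
    shrink (suc (suc x) ∷ xs) = suc x ∷ xs

    -- `grow` is local to the definition of `compositions`; its two defining equations stand in for
    -- it here and hold by `refl` at the place of use.
    module Grow (grow : List ℕ → List (List ℕ)) (grow-[] : grow [] ≡ (1 ∷ []) ∷ [])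
                (grow-∷ : ∀ x xs → grow (x ∷ xs) ≡ (1 ∷ x ∷ xs) ∷ (suc x ∷ xs) ∷ []) where

      ∈-grow⁻ : ∀ {xs ys} → Positive xs → ys ∈ grow xs →
                shrink ys ≡ xs × Positive ys × ListAction.sum ys ≡ suc (ListAction.sum xs)
      ∈-grow⁻ {[]} _ p with subst (_ ∈_) grow-[] p
      ... | here refl = refl , ≤-refl ∷ [] , refl
      ∈-grow⁻ {zero ∷ xs} (() ∷ _) p
      ∈-grow⁻ {suc x ∷ xs} (1≤x ∷ 1≤xs) p with subst (_ ∈_) (grow-∷ (suc x) xs) p
      ... | here refl         = refl , ≤-refl ∷ 1≤x ∷ 1≤xs , refl
      ... | there (here refl) = refl , s≤s z≤n ∷ 1≤xs , refl

      grow-unique : ∀ {xs} → Positive xs → Unique (grow xs)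
      grow-unique {[]} _ rewrite grow-[] = [] ∷ []
      grow-unique {x ∷ xs} _ rewrite grow-∷ x xs =
        ((λ ()) ∷ []) ∷ [] ∷ []

      ∈-grow⁺ : ∀ {ys j} → Positive ys → ListAction.sum ys ≡ suc j →
                Positive (shrink ys) × ListAction.sum (shrink ys) ≡ j × ys ∈ grow (shrink ys)
      ∈-grow⁺ {zero ∷ ys} (() ∷ _) e
      ∈-grow⁺ {suc zero ∷ []} _ e = [] , suc-injective e , subst (_ ∈_) (sym grow-[]) (here refl)
      ∈-grow⁺ {suc zero ∷ y ∷ ys} (_ ∷ p) e = p , suc-injective e , subst (_ ∈_) (sym (grow-∷ y ys)) (here refl)
      ∈-grow⁺ {suc (suc x) ∷ ys} (_ ∷ p) e =
        s≤s z≤n ∷ p , suc-injective e , subst (_ ∈_) (sym (grow-∷ (suc x) ys)) (there (here refl))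

      Compositions : ℕ → List (List ℕ) → Set
      Compositions j xss = Unique xss ×
        (∀ {xs} → xs ∈ xss → Positive xs × ListAction.sum xs ≡ j) ×
        (∀ {xs} → Positive xs → ListAction.sum xs ≡ j → xs ∈ xss)

      step : ∀ {j xss} → Compositions j xss → Compositions (suc j) (concatMap grow xss)
      step {j} {xss} (u , sound , complete) =
        Unique.concat⁺
          (All.map⁺ (All.tabulate (λ xs∈ → grow-unique (proj₁ (sound xs∈)))))
          (AllPairs.map⁺ (disjoint u sound)) ,
        sound′ , complete′
        where
        disjoint : ∀ {yss} → Unique yss → (∀ {xs} → xs ∈ yss → Positive xs × ListAction.sum xs ≡ j) →
                   AllPairs (λ xs ys → ∀ {zs} → ¬ (zs ∈ grow xs × zs ∈ grow ys)) yss
        disjoint []      s = []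
        disjoint (p ∷ u) s = All.tabulate (λ y∈ {_} (a , b) → All.lookup p y∈
            (trans (sym (proj₁ (∈-grow⁻ (proj₁ (s (here refl))) a))) (proj₁ (∈-grow⁻ (proj₁ (s (there y∈))) b))))
          ∷ disjoint u (s ∘ there)
        sound′ : ∀ {xs} → xs ∈ concatMap grow xss → Positive xs × ListAction.sum xs ≡ suc j
        sound′ p with ys , ys∈ , xs∈ ← find (∈-concatMap⁻ grow {xss} p) with P , s ← sound ys∈
          with _ , P' , s' ← ∈-grow⁻ P xs∈ = P' , trans s' (cong suc s)
        complete′ : ∀ {xs} → Positive xs → ListAction.sum xs ≡ suc j → xs ∈ concatMap grow xss
        complete′ {xs} P e with P' , s' , xs∈ ← ∈-grow⁺ P e = ∈-concatMap⁺ grow (lose (complete P' s') xs∈)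

    compositions-spec : ∀ j → Unique (compositions j) ×
        (∀ {xs} → xs ∈ compositions j → Positive xs × ListAction.sum xs ≡ j) ×
        (∀ {xs} → Positive xs → ListAction.sum xs ≡ j → xs ∈ compositions j)
    compositions-spec zero = [] ∷ [] , (λ { (here refl) → [] , refl }) , empty
      where
      empty : ∀ {xs} → Positive xs → ListAction.sum xs ≡ 0 → xs ∈ [] ∷ []
      empty {[]} _ _ = here refl
      empty {zero ∷ _} (() ∷ _) _
    compositions-spec (suc j) = Grow.step _ refl (λ _ _ → refl) (compositions-spec j)

    distinct : List ℕ → ℕ
    distinct xs = length (deduplicate _≟_ xs)

    -- What remains of a sequence with `suc e` distinct terms when 1 is subtracted from every
    -- coordinate and the zeros are dropped.
    record Parts (k e : ℕ) (xs : List ℕ) : Set where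
      constructor parts
      field
        sorted   : AllPairs _≤_ xs
        positive : Positive xs
        sum≤     : ListAction.sum xs ≤ k
        distinct≡ : distinct xs ≡ e

    withDistinct : ℕ → ℕ → List (List ℕ)
    withDistinct e j = filter (λ xs → distinct xs ≟ e) (partitions j)

    family : ℕ → ℕ → ℕ → List (List ℕ)
    family a k e = concatMap (withDistinct e) (filter (a ≤?_) (upTo (suc k)))

    length-family : ∀ a k e → length (family a k e) ≡ sumFromTo a k (λ j → q j e)
    length-family a k e = length-concatMap (withDistinct e) (filter (a ≤?_) (upTo (suc k)))

    ∈-withDistinct⁻ : ∀ {e j xs} → xs ∈ withDistinct e j →
                      distinct xs ≡ e × Linked _≤_ xs × Positive xs × ListAction.sum xs ≡ j
    ∈-withDistinct⁻ {e} {j} p with r , d ← ∈-filter⁻ (λ xs → distinct xs ≟ e) {xs = partitions j} p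
      with r' , l ← ∈-filter⁻ (linked? _≤?_) {xs = compositions j} r = d , l , proj₁ (proj₂ (compositions-spec j)) r'

    family-unique : ∀ a k e → Unique (family a k e)
    family-unique a k e = concatMap-unique (withDistinct e) ListAction.sum
      (Unique.filter⁺ (a ≤?_) (Unique.upTo⁺ (suc k)))
      (λ j → Unique.filter⁺ (λ xs → distinct xs ≟ e) (Unique.filter⁺ (linked? _≤?_) (proj₁ (compositions-spec j))))
      (λ p → proj₂ (proj₂ (proj₂ (∈-withDistinct⁻ p))))

    ∈-family⁻ : ∀ {a k e xs} → xs ∈ family a k e → Parts k e xs
    ∈-family⁻ {a} {k} {e} p with j , j∈ , xs∈ ← find (∈-concatMap⁻ (withDistinct e) {filter (a ≤?_) (upTo (suc k))} p)
      with d , l , P , s ← ∈-withDistinct⁻ {e} {j} xs∈ =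
      parts (Linked.Linked⇒AllPairs ≤-trans l) P
        (≤-trans (≤-reflexive s) (≤-pred (∈-upTo⁻ (proj₁ (∈-filter⁻ (a ≤?_) j∈))))) d

    parts≤sum : ∀ {xs} → All (_≤ ListAction.sum xs) xs
    parts≤sum {[]}     = []
    parts≤sum {x ∷ xs} = m≤m+n x _ ∷ All.map (λ p → ≤-trans p (m≤n+m _ x)) (parts≤sum {xs})

    map-id : ∀ (xs : List ℕ) → map (λ x → x) xs ≡ xs
    map-id []       = refl
    map-id (x ∷ xs) = cong (x ∷_) (map-id xs)

    triangular≤sum : ∀ {xs} → Positive xs → distinct xs * suc (distinct xs) ≤ 2 * ListAction.sum xs
    triangular≤sum {xs} P = subst₂ (λ e s → e * suc e ≤ 2 * s)
      (sym (trans (length-deduplicate {suc s} bound) (cong (_+ rest) zero-count)))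
      (trans (cong (_+ rest') (sym (*-zeroʳ (count 0 xs)))) (trans (sum-count {suc s} (λ x → x) bound) (cong ListAction.sum (map-id xs))))
      (proj₂ (triangular s (λ x → count (suc x) xs)))
      where
      s = ListAction.sum xs
      bound : All (_< suc s) xs
      bound = All.map s≤s (parts≤sum {xs})
      rest = sum {s} (λ x → pos (count (suc (toℕ x)) xs))
      rest' = sum {s} (λ x → count (suc (toℕ x)) xs * suc (toℕ x))
      zero-count : pos (count 0 xs) ≡ 0
      zero-count = cong pos (∉⇒count (λ 0∈ → <-irrefl refl (All.lookup P 0∈)))

    -- The lower limit of summation loses nothing: `e` distinct positive parts sum to at least
    -- `1 + 2 + ... + e`.
    ∈-family⁺ : ∀ {k e xs} → Parts k e xs → xs ∈ family (e * suc e / 2) k e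
    ∈-family⁺ {k} {e} {xs} (parts so P s≤ d) = ∈-concatMap⁺ (withDistinct e)
      (lose (∈-filter⁺ (e * suc e / 2 ≤?_) (∈-upTo⁺ (s≤s s≤)) bound)
        (∈-filter⁺ (λ xs → distinct xs ≟ e)
          (∈-filter⁺ (linked? _≤?_) (proj₂ (proj₂ (compositions-spec _)) P refl) (Linked.AllPairs⇒Linked so)) d))
      where
      bound : e * suc e / 2 ≤ ListAction.sum xs
      bound = ≤-trans (/-monoˡ-≤ 2 (subst (λ e → e * suc e ≤ 2 * ListAction.sum xs) d (triangular≤sum P)))
        (≤-reflexive (trans (cong (_/ 2) (*-comm 2 (ListAction.sum xs))) (m*n/n≡m (ListAction.sum xs) 2)))

    length≤sum : ∀ {xs} → Positive xs → length xs ≤ ListAction.sum xs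
    length≤sum []      = z≤n
    length≤sum (p ∷ P) = +-mono-≤ p (length≤sum P)

    no-parts : ∀ {k xs} → Parts k 0 xs → xs ≡ []
    no-parts {xs = []} _ = refl
    no-parts {xs = x ∷ xs} p with () ← Parts.distinct≡ p

    -- A sequence with one distinct term leaves only the empty pattern, whatever `k` is. Hence the
    -- mean in the first part has the factor 1 in front of `p φ(n)`.
    length-family-0 : ∀ k → length (family 0 k 0) ≡ 1
    length-family-0 k = length-unique (family-unique 0 k 0) ([] ∷ [])
      (λ p → here (no-parts (∈-family⁻ {0} {k} p))) (λ { (here refl) → ∈-family⁺ {k} (parts [] [] z≤n refl) })

  -- Translation between sequences over `C n` and multiplicity functions.

  module Sequences where

    open import Defs using (C; Sequence; support; σ; ZeroSum; ZeroSumFree; sequences)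
    open Sums
    open Lists
    open Counting using (pos)

    vec-sum : ∀ {m} (S : Vec ℕ m) → Vec.sum S ≡ sum (lookup S)
    vec-sum []      = refl
    vec-sum (x ∷ S) = cong (x +_) (vec-sum S)

    lookup-tabulate : ∀ {m} (f : Fin m → ℕ) → sum (lookup (tabulate f)) ≡ sum f
    lookup-tabulate f = sum-cong-≗ (Vec.lookup∘tabulate f)

    size-support : ∀ {m} (S : Sequence m) → ∣ support S ∣ ≡ sum (pos ∘ lookup S)
    size-support []          = refl
    size-support (zero ∷ S)  = size-support S
    size-support (suc x ∷ S) = cong suc (size-support S)

    ∈-support⁻ : ∀ {m} (S : Sequence m) {a} → a ∈ₛ support S → 0 < lookup S a
    ∈-support⁻ (suc x ∷ S) {zero}  p             = s≤s z≤n
    ∈-support⁻ (x ∷ S)     {suc a} (Vec.there p) = ∈-support⁻ S p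

    sequences-unique : ∀ m ℓ → Unique (sequences m ℓ)
    sequences-unique zero    zero    = [] ∷ []
    sequences-unique zero    (suc ℓ) = []
    sequences-unique (suc m) ℓ = concatMap-unique _ Vec.head (Unique.upTo⁺ (suc ℓ))
      (λ x → Unique.map⁺ (λ { refl → refl }) (sequences-unique m (ℓ ∸ x)))
      (λ {x} p → head≡ x p)
      where
      head≡ : ∀ x {y} → y ∈ map (x ∷_) (sequences m (ℓ ∸ x)) → Vec.head y ≡ x
      head≡ x p with _ , _ , refl ← ∈-map⁻ (x ∷_) p = refl

    ∈-sequences⁻ : ∀ {m ℓ S} → S ∈ sequences m ℓ → sum (lookup S) ≡ ℓ
    ∈-sequences⁻ {zero} {zero} {[]} p = refl
    ∈-sequences⁻ {suc m} {ℓ} p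
      with x , x∈ , S∈ ← find (∈-concatMap⁻ (λ x → map (x ∷_) (sequences m (ℓ ∸ x))) {upTo (suc ℓ)} p)
      with T , T∈ , refl ← ∈-map⁻ (x ∷_) S∈ =
      trans (cong (x +_) (∈-sequences⁻ T∈)) (m+[n∸m]≡n (≤-pred (∈-upTo⁻ x∈)))

    ∈-sequences⁺ : ∀ {m ℓ} (S : Sequence m) → sum (lookup S) ≡ ℓ → S ∈ sequences m ℓ
    ∈-sequences⁺ []      refl = here refl
    ∈-sequences⁺ {suc m} {ℓ} (x ∷ S) e = ∈-concatMap⁺ (λ x → map (x ∷_) (sequences m (ℓ ∸ x)))
      (lose (∈-upTo⁺ (s≤s (≤-trans (m≤m+n x _) (≤-reflexive e))))
        (∈-map⁺ (x ∷_) (∈-sequences⁺ S (trans (sym (m+n∸m≡n x _)) (cong (_∸ x) e)))))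

    module _ {n : ℕ} .{{_ : NonZero n}} where

      open RawMonoidDefs (C n) using () renaming (_×_ to _·_; sum to sumC)

      toℕ-· : ∀ m (g : Fin n) → toℕ (m · g) ≡ (m * toℕ g) % n
      toℕ-· zero    g = Fin.toℕ-fromℕ< (m%n<n 0 n)
      toℕ-· (suc m) g = trans (Fin.toℕ-fromℕ< (m%n<n (toℕ g + toℕ (m · g)) n))
        (+-cong-% {n} {toℕ g} {toℕ g} {toℕ (m · g)} {m * toℕ g} refl
          (trans (cong (_% n) (toℕ-· m g)) (m%n%n≡m%n (m * toℕ g) n)))

      toℕ-sum : ∀ {m} (f : Fin m → Fin n) → toℕ (sumC f) ≡ sum (toℕ ∘ f) % n
      toℕ-sum {zero}  f = Fin.toℕ-fromℕ< (m%n<n 0 n)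
      toℕ-sum {suc m} f = trans (Fin.toℕ-fromℕ< (m%n<n (toℕ (f zero) + toℕ (sumC (f ∘ suc))) n))
        (+-cong-% {n} {toℕ (f zero)} {toℕ (f zero)} {toℕ (sumC (f ∘ suc))} {sum (toℕ ∘ f ∘ suc)} refl
          (trans (cong (_% n) (toℕ-sum (f ∘ suc))) (m%n%n≡m%n _ n)))

      toℕ-σ : ∀ (S : Sequence n) → toℕ (σ S) ≡ weight toℕ (lookup S) % n
      toℕ-σ S = trans (toℕ-sum (λ a → lookup S a · a))
        (sum-cong-% {n} {n} {f = λ a → toℕ (lookup S a · a)} {g = λ a → lookup S a * toℕ a}
          (λ a → trans (cong (_% n) (toℕ-· (lookup S a) a)) (m%n%n≡m%n (lookup S a * toℕ a) n)))

      zeroSum⇒∣ : ∀ S → ZeroSum S → n ∣ weight toℕ (lookup S)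
      zeroSum⇒∣ S e = m%n≡0⇒n∣m _ n (trans (sym (toℕ-σ S))
        (trans (cong toℕ e) (trans (Fin.toℕ-fromℕ< (m%n<n 0 n)) (m*n%n≡0 0 n))))

      ∣⇒zeroSum : ∀ S → n ∣ weight toℕ (lookup S) → ZeroSum S
      ∣⇒zeroSum S d = Fin.toℕ-injective (trans (toℕ-σ S)
        (trans (n∣m⇒m%n≡0 _ n d) (sym (trans (Fin.toℕ-fromℕ< (m%n<n 0 n)) (m*n%n≡0 0 n)))))

      free⇒zeroSumFree : ∀ S → FreeSequence.Free (lookup S) → ZeroSumFree S
      free⇒zeroSumFree S free T T⊑S 0<T z =
        free (lookup T) (Pointwise.lookup T⊑S) (subst (0 <_) (vec-sum T) 0<T) (zeroSum⇒∣ T z)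

      zeroSumFree⇒free : ∀ S → ZeroSumFree S → FreeSequence.Free (lookup S)
      zeroSumFree⇒free S free T T≤S 0<T d = free (tabulate T)
        (extensional⇒inductive (ext λ a → subst (_≤ lookup S a) (sym (Vec.lookup∘tabulate T a)) (T≤S a)))
        (subst (0 <_) (sym (trans (vec-sum (tabulate T)) (lookup-tabulate T))) 0<T)
        (∣⇒zeroSum (tabulate T) (subst (n ∣_)
          (sym (sum-cong-≗ (λ a → cong (_* toℕ a) (Vec.lookup∘tabulate T a)))) d))

  -- Discrete logarithms to the base of a generator.

  module Logarithms {n : ℕ} .{{_ : NonZero n}} where

    open import Defs using (Generator; generator?)
    open Sums
    open Units {n}
    open Sequences using (toℕ-·)

    generator⇒unit : ∀ {g} → Generator g → Unit (toℕ g)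
    generator⇒unit {g} G with m , e ← G (1 mod n) =
      m , trans (sym (toℕ-· m g)) (trans (cong toℕ e) (Fin.toℕ-fromℕ< (m%n<n 1 n)))

    unit⇒generator : ∀ {g} → Unit (toℕ g) → Generator g
    unit⇒generator {g} (u , e) a = toℕ a * u , Fin.toℕ-injective (begin
      toℕ _  ≡⟨ toℕ-· (toℕ a * u) g ⟩
      (toℕ a * u * toℕ g) % n  ≡⟨ cong (_% n) (*-assoc (toℕ a) u (toℕ g)) ⟩
      (toℕ a * (u * toℕ g)) % n  ≡⟨ *-cong-% {n} {toℕ a} {toℕ a} {u * toℕ g} {1} refl e ⟩
      (toℕ a * 1) % n  ≡⟨ cong (_% n) (*-identityʳ (toℕ a)) ⟩
      toℕ a % n  ≡⟨ m<n⇒m%n≡m (Fin.toℕ<n a) ⟩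
      toℕ a  ∎)
      where open ≡-Reasoning

    unit-cancel : ∀ {h x y} → Unit h → (x * h) % n ≡ (y * h) % n → x % n ≡ y % n
    unit-cancel {h} {x} {y} (u , e) eq = begin
      x % n  ≡⟨ recover x ⟩
      (x * h * u) % n  ≡⟨ *-cong-% {n} {x * h} {y * h} {u} {u} eq refl ⟩
      (y * h * u) % n  ≡⟨ recover y ⟨
      y % n  ∎
      where
      open ≡-Reasoning
      recover : ∀ x → x % n ≡ (x * h * u) % n
      recover x = begin
        x % n  ≡⟨ cong (_% n) (*-identityʳ x) ⟨
        (x * 1) % n  ≡⟨ *-cong-% {n} {x} {x} {u * h} {1} refl e ⟨
        (x * (u * h)) % n  ≡⟨ cong (_% n) (trans (cong (x *_) (*-comm u h)) (sym (*-assoc x h u))) ⟩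
        (x * h * u) % n  ∎

    -- The exponent supplied by the generator proof is arbitrary and becomes unique by reduction
    -- modulo `n`; 0 is a filler when `g` does not generate.
    log : Fin n → Fin n → ℕ
    log g a with generator? g
    ... | yes G = proj₁ (G a) % n
    ... | no _  = 0

    at : Fin n → ℕ → Fin n
    at g x = (x * toℕ g) mod n

    toℕ-at : ∀ g x → toℕ (at g x) ≡ (x * toℕ g) % n
    toℕ-at g x = Fin.toℕ-fromℕ< (m%n<n (x * toℕ g) n)

    log<n : ∀ g a → log g a < n
    log<n g a with generator? g
    ... | yes G = m%n<n (proj₁ (G a)) n
    ... | no _  = >-nonZero⁻¹ n

    log-spec : ∀ {g} → Generator g → ∀ a → (log g a * toℕ g) % n ≡ toℕ a
    log-spec {g} G a with generator? g
    ... | no ¬G = ⊥-elim (¬G G)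
    ... | yes G' with m , e ← G' a = trans
      (*-cong-% {n} {m % n} {m} {toℕ g} {toℕ g} (m%n%n≡m%n m n) refl)
      (trans (sym (toℕ-· m g)) (cong toℕ e))

    log-unique : ∀ {g} → Generator g → ∀ {a x} → x < n → (x * toℕ g) % n ≡ toℕ a → log g a ≡ x
    log-unique {g} G {a} {x} x<n e = begin
      log g a  ≡⟨ m<n⇒m%n≡m (log<n g a) ⟨
      log g a % n  ≡⟨ unit-cancel {toℕ g} (generator⇒unit G) (trans (log-spec G a) (sym e)) ⟩
      x % n  ≡⟨ m<n⇒m%n≡m x<n ⟩
      x  ∎
      where open ≡-Reasoning

    log-at : ∀ {g} → Generator g → ∀ {x} → x < n → log g (at g x) ≡ x
    log-at {g} G {x} x<n = log-unique G x<n (sym (toℕ-at g x))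

    at-log : ∀ {g} → Generator g → ∀ a → at g (log g a) ≡ a
    at-log {g} G a = Fin.toℕ-injective (trans (toℕ-at g (log g a)) (log-spec G a))

    -- `log g` permutes the residues, with inverse `at g`, so a sum over elements becomes a sum over
    -- exponents.
    sum-log : ∀ {g} → Generator g → (F : ℕ → ℕ) → sum (λ a → F (log g a)) ≡ sum {n} (F ∘ toℕ)
    sum-log {g} G F = sym (trans (sum-permute (F ∘ toℕ) π)
        (sum-cong-≗ (λ a → cong F (Fin.toℕ-fromℕ< (log<n g a)))))
      where
      π : Permutation n n
      π = permutation (λ a → fromℕ< (log<n g a)) (λ x → at g (toℕ x))
        (λ x → Fin.toℕ-injective (trans (Fin.toℕ-fromℕ< _) (log-at G (Fin.toℕ<n x))))
        (λ a → trans (cong (at g) (Fin.toℕ-fromℕ< (log<n g a))) (at-log G a))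

  -- From a generator and a partition to a zero-sum free sequence.

  module Encoding (n ℓ′ k e : ℕ) .{{_ : NonZero n}} (n≡ : n ≡ suc (suc (ℓ′ + k))) (big : suc e * k < suc ℓ′) where

    open import Defs using (Generator; Sequence; support)
    open Sums
    open Lists
    open Counting
    open Partitions
    open Sequences

    -- The length `n - 1 - k`; `suc e` stands for the number `d` of distinct terms.
    ℓ : ℕ
    ℓ = suc ℓ′

    -- This is `n - 2`: the nonzero elements have the exponents `suc x` with `x ≤ B`.
    B : ℕ
    B = ℓ′ + k

    open Logarithms {n}
    open Units {n}

    sum-coord : ∀ {g} → Generator g → (F : ℕ → ℕ) →
                sum (λ a → F (log g a)) ≡ F 0 + sum {suc B} (λ x → F (suc (toℕ x)))
    sum-coord G F = trans (sum-log G F) (cong (λ m → sum {m} (F ∘ toℕ)) n≡)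

    k<ℓ : k < ℓ
    k<ℓ = ≤-<-trans (m≤m+n k (e * k)) big

    pad : List ℕ → List ℕ
    pad xs = replicate (ℓ ∸ length xs) 0 ++ xs

    -- A partition is read as a multiset of ℓ coordinates: the ones of the
    -- sequence come from the zeros added by pad.
    multiplicity : List ℕ → ℕ → ℕ
    multiplicity xs zero    = 0
    multiplicity xs (suc x) = count x (pad xs)

    Φ : Fin n × List ℕ → Sequence n
    Φ (g , xs) = tabulate (λ a → multiplicity xs (log g a))

    lookup-Φ : ∀ g xs a → lookup (Φ (g , xs)) a ≡ multiplicity xs (log g a)
    lookup-Φ g xs = Vec.lookup∘tabulate (λ a → multiplicity xs (log g a))

    module _ {xs} (P : Parts k e xs) where

      open Parts P

      length≤k : length xs ≤ k
      length≤k = ≤-trans (length≤sum positive) sum≤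

      count-pad-0 : count 0 (pad xs) ≡ ℓ ∸ length xs
      count-pad-0 = trans (count-++ 0 (replicate (ℓ ∸ length xs) 0) xs)
        (trans (cong₂ _+_ (trans (count-replicate 0 (ℓ ∸ length xs) 0) (*-identityʳ _))
                          (∉⇒count (λ 0∈ → <-irrefl refl (All.lookup positive 0∈))))
          (+-identityʳ _))

      count-pad-suc : ∀ x → count (suc x) (pad xs) ≡ count (suc x) xs
      count-pad-suc x = trans (count-++ (suc x) (replicate (ℓ ∸ length xs) 0) xs)
        (cong (_+ count (suc x) xs) (trans (count-replicate (suc x) (ℓ ∸ length xs) 0) (*-zeroʳ (ℓ ∸ length xs))))

      0<count-pad-0 : 0 < count 0 (pad xs)
      0<count-pad-0 = subst (0 <_) (sym count-pad-0) (m<n⇒0<n∸m (≤-<-trans length≤k k<ℓ))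

      bound : All (_< suc B) xs
      bound = All.map (λ x≤ → ≤-<-trans (≤-trans x≤ sum≤) (s≤s (m≤n+m k ℓ′))) (parts≤sum {xs})

      bound-pad : All (_< suc B) (pad xs)
      bound-pad = All.++⁺ (All.replicate⁺ (ℓ ∸ length xs) (s≤s z≤n)) bound

      length-pad : length (pad xs) ≡ ℓ
      length-pad = trans (List.length-++ (replicate (ℓ ∸ length xs) 0))
        (trans (cong (_+ length xs) (List.length-replicate (ℓ ∸ length xs))) (m∸n+n≡m (<⇒≤ (≤-<-trans length≤k k<ℓ))))

      sum-suc : ∀ ys → ListAction.sum (map suc ys) ≡ length ys + ListAction.sum ys
      sum-suc []       = refl
      sum-suc (y ∷ ys) = cong suc (trans (cong (y +_) (sum-suc ys)) (alg y (length ys) (ListAction.sum ys)))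
        where
        alg : ∀ y l s → y + (l + s) ≡ l + (y + s)
        alg = solve-∀

      sum-pad : ListAction.sum (pad xs) ≡ ListAction.sum xs
      sum-pad = trans (sum-++ (replicate (ℓ ∸ length xs) 0) xs) (cong (_+ ListAction.sum xs) (zeros (ℓ ∸ length xs)))
        where
        zeros : ∀ m → ListAction.sum (replicate m 0) ≡ 0
        zeros zero    = refl
        zeros (suc m) = zeros m

      zero-count : count 0 xs ≡ 0
      zero-count = ∉⇒count (λ 0∈ → <-irrefl refl (All.lookup positive 0∈))

      distinct-positive : distinct xs ≡ sum {B} (λ x → pos (count (suc (toℕ x)) xs))
      distinct-positive = trans (length-deduplicate {suc B} bound)
        (cong (_+ sum {B} (λ x → pos (count (suc (toℕ x)) xs))) (cong pos zero-count))

      module _ {g} (G : Generator g) where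

        sum-Φ : sum (lookup (Φ (g , xs))) ≡ ℓ
        sum-Φ = trans (sum-cong-≗ (lookup-Φ g xs))
          (trans (sum-coord G (multiplicity xs)) (trans (length-count {suc B} bound-pad) length-pad))

        weight-log : weight (log g) (lookup (Φ (g , xs))) ≡ ℓ + ListAction.sum xs
        weight-log = trans (sum-cong-≗ (λ a → cong (_* log g a) (lookup-Φ g xs a)))
          (trans (sum-coord G (λ x → multiplicity xs x * x))
          (trans (sum-count {suc B} suc bound-pad)
          (trans (sum-suc (pad xs)) (cong₂ _+_ length-pad sum-pad))))

        size-Φ : ∣ support (Φ (g , xs)) ∣ ≡ suc e
        size-Φ = begin
          ∣ support (Φ (g , xs)) ∣  ≡⟨ size-support (Φ (g , xs)) ⟩
          sum (pos ∘ lookup (Φ (g , xs)))  ≡⟨ sum-cong-≗ (λ a → cong pos (lookup-Φ g xs a)) ⟩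
          sum (λ a → pos (multiplicity xs (log g a)))  ≡⟨ sum-coord G (pos ∘ multiplicity xs) ⟩
          pos (count 0 (pad xs)) + sum {B} (λ x → pos (count (suc (toℕ x)) (pad xs)))
            ≡⟨ cong₂ _+_ (pos-> 0<count-pad-0) (sum-cong-≗ {B} (λ x → cong pos (count-pad-suc (toℕ x)))) ⟩
          suc (sum {B} (λ x → pos (count (suc (toℕ x)) xs)))  ≡⟨ cong suc distinct-positive ⟨
          suc (distinct xs)  ≡⟨ cong suc distinct≡ ⟩
          suc e  ∎
          where open ≡-Reasoning

        -- All logarithms together amount to at most `ℓ + k = n - 1`, and each one in use is at
        -- least 1. A nonempty subsequence thus has total logarithm `W` strictly between 0 and `n`;
        -- as `g` is a unit, its sum `W g` is not zero.
        free-Φ : FreeSequence.Free (lookup (Φ (g , xs)))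
        free-Φ T T≤ 0<T n∣ = <-irrefl refl (<-≤-trans W<n (∣⇒≤ {{>-nonZero 0<W}} n∣W))
          where
          W = weight (log g) T
          T0 : ∀ a → log g a ≡ 0 → T a ≡ 0
          T0 a l0 = n≤0⇒n≡0 (subst (T a ≤_) (trans (lookup-Φ g xs a) (cong (multiplicity xs) l0)) (T≤ a))
          T≤W : ∀ a → T a ≤ T a * log g a
          T≤W a with log g a in eq
          ... | zero  = ≤-reflexive (trans (T0 a eq) (sym (*-zeroʳ (T a))))
          ... | suc x = m≤m*n (T a) (suc x)
          0<W : 0 < W
          0<W = <-≤-trans 0<T (sum-mono T≤W)
          W<n : W < n
          W<n = subst (W <_) (sym n≡) (s≤s (≤-trans (≤-trans (weight-mono (log g) T≤) (≤-reflexive weight-log)) (+-monoʳ-≤ ℓ sum≤)))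
          n∣W : n ∣ W
          n∣W = m%n≡0⇒n∣m W n (trans (unit-cancel {toℕ g} {W} {0} (generator⇒unit G) (begin
            (W * toℕ g) % n  ≡⟨ cong (_% n) (*-distribʳ-sum (toℕ g) (λ a → T a * log g a)) ⟩
            sum (λ a → T a * log g a * toℕ g) % n  ≡⟨ sum-cong-% {n} {f = λ a → T a * log g a * toℕ g} {g = λ a → T a * toℕ a} term ⟩
            weight toℕ T % n  ≡⟨ n∣m⇒m%n≡0 _ n n∣ ⟩
            0  ≡⟨ m*n%n≡0 0 n ⟨
            0 % n  ∎)) (m*n%n≡0 0 n))
            where
            open ≡-Reasoning
            term : ∀ a → (T a * log g a * toℕ g) % n ≡ (T a * toℕ a) % n
            term a = trans (cong (_% n) (*-assoc (T a) (log g a) (toℕ g)))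
              (*-cong-% {n} {T a} {T a} {log g a * toℕ g} {toℕ a} refl
                (trans (log-spec G a) (sym (m<n⇒m%n≡m (Fin.toℕ<n a)))))

    count≤length : ∀ x ys → count x ys ≤ length ys
    count≤length x []       = z≤n
    count≤length x (y ∷ ys) with x ≟ y
    ... | yes refl = +-mono-≤ (≤-reflexive (ind-refl x)) (count≤length x ys)
    ... | no ne    = ≤-trans (≤-reflexive (cong (_+ count x ys) (ind-≢ ne))) (m≤n⇒m≤1+n (count≤length x ys))

    -- For positive `e` the bound `big` gives `2 k < ℓ`. For `e = 0` it gives only `k < ℓ`, but then
    -- both lists are empty.
    lengths<ℓ : ∀ {xs ys} → Parts k e xs → Parts k e ys → length xs + length ys < ℓ
    lengths<ℓ {xs} {ys} P Q = aux e refl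
      where
      aux : ∀ e' → e ≡ e' → length xs + length ys < ℓ
      aux zero    refl rewrite no-parts P | no-parts Q = s≤s z≤n
      aux (suc e') refl = ≤-<-trans (≤-trans (+-mono-≤ (length≤k P) (length≤k Q))
        (+-monoʳ-≤ k (m≤m+n k (e' * k)))) big

    1<n : 1 < n
    1<n = subst (1 <_) (sym n≡) (s≤s (s≤s z≤n))

    log-self : ∀ {g} → Generator g → log g g ≡ 1
    log-self {g} G = log-unique G 1<n (trans (cong (_% n) (*-identityˡ (toℕ g))) (m<n⇒m%n≡m (Fin.toℕ<n g)))

    log≡1 : ∀ {g a} → Generator g → log g a ≡ 1 → a ≡ g
    log≡1 {g} {a} G e = Fin.toℕ-injective (trans (sym (log-spec G a))
      (trans (cong (λ z → (z * toℕ g) % n) e) (trans (cong (_% n) (*-identityˡ (toℕ g))) (m<n⇒m%n≡m (Fin.toℕ<n g)))))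

    -- g is the only element of multiplicity above ℓ / 2.
    Φ-injective : ∀ {g h xs ys} → Generator g → Generator h → Parts k e xs → Parts k e ys →
                  Φ (g , xs) ≡ Φ (h , ys) → (g , xs) ≡ (h , ys)
    Φ-injective {g} {h} {xs} {ys} G H P Q eq with same
      where
      agree : ∀ a → multiplicity xs (log g a) ≡ multiplicity ys (log h a)
      agree a = trans (sym (lookup-Φ g xs a)) (trans (cong (λ S → lookup S a) eq) (lookup-Φ h ys a))
      at-g : ℓ ∸ length xs ≡ multiplicity ys (log h g)
      at-g = trans (sym (count-pad-0 P)) (trans (cong (multiplicity xs) (sym (log-self G))) (agree g))
      same : g ≡ h
      same with log h g in eq'
      ... | zero        = ⊥-elim (<⇒≢ (m<n⇒0<n∸m (≤-<-trans (length≤k P) k<ℓ))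
                            (sym (trans at-g (cong (multiplicity ys) eq'))))
      ... | suc zero    = log≡1 H eq'
      -- The multiplicity of `g` is `ℓ - length xs` on the left, but would be at most `length ys` on
      -- the right, against `lengths<ℓ`.
      ... | suc (suc y) = ⊥-elim (<-irrefl refl (≤-<-trans (≤-trans (m≤n+m∸n ℓ (length xs)) (+-monoʳ-≤ (length xs) (≤-trans
                            (≤-reflexive (trans at-g (trans (cong (multiplicity ys) eq') (count-pad-suc Q y))))
                            (count≤length (suc y) ys)))) (lengths<ℓ P Q)))
    ... | refl = cong (g ,_) (sorted-injective (Parts.sorted P) (Parts.sorted Q) counts)
      where
      counts : ∀ x → count x xs ≡ count x ys
      counts zero    = trans (zero-count P) (sym (zero-count Q))
      counts (suc x) with suc x <? suc B
      ... | yes x<B = trans (sym (count-pad-suc P x)) (trans agree′ (count-pad-suc Q x))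
        where
        agree′ : multiplicity xs (suc (suc x)) ≡ multiplicity ys (suc (suc x))
        agree′ = subst (λ z → multiplicity xs z ≡ multiplicity ys z) (log-at G (subst (suc (suc x) <_) (sym n≡) (s≤s x<B)))
          (trans (sym (lookup-Φ g xs (at g (suc (suc x)))))
            (trans (cong (λ S → lookup S (at g (suc (suc x)))) eq) (lookup-Φ g ys (at g (suc (suc x))))))
      ... | no x≮B = trans (∉⇒count (λ x∈ → x≮B (All.lookup (bound P) x∈)))
                       (sym (∉⇒count (λ x∈ → x≮B (All.lookup (bound Q) x∈))))

  -- From a zero-sum free sequence back to a generator and a partition.

  module Decoding (n ℓ′ k e : ℕ) .{{_ : NonZero n}} (n≡ : n ≡ suc (suc (ℓ′ + k))) (big : suc e * k < suc ℓ′) where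

    open import Defs using (Generator; generator?; Sequence)
    open Sums
    open Lists
    open Counting
    open Partitions
    open Sequences
    open Logarithms {n}
    open Units {n}
    open Encoding n ℓ′ k e n≡ big

    n≡ℓ+k+1 : n ≡ suc (ℓ + k)
    n≡ℓ+k+1 = n≡

    module _ (S : Sequence n) (free : FreeSequence.Free (lookup S))
             (size : sum (lookup S) ≡ ℓ) (supp : sum (pos ∘ lookup S) ≡ suc e) where

      open Coordinatization (lookup S) free

      frequent : ∃ λ h → k < lookup S h
      frequent with Fin.any? (λ h → k <? lookup S h)
      ... | yes p = p
      ... | no ¬p = ⊥-elim (<-irrefl refl (<-≤-trans big (begin
        ℓ  ≡⟨ size ⟨
        sum (lookup S)  ≤⟨ sum-mono few ⟩
        sum (λ a → pos (lookup S a) * k) ≡⟨ *-distribʳ-sum k (pos ∘ lookup S) ⟨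
        sum (pos ∘ lookup S) * k  ≡⟨ cong (_* k) supp ⟩
        suc e * k  ∎)))
        where
        open ≤-Reasoning
        few : ∀ a → lookup S a ≤ pos (lookup S a) * k
        few a with lookup S a in eq
        ... | zero  = z≤n
        ... | suc s = ≤-trans (≮⇒≥ (λ lt → ¬p (a , subst (k <_) (sym eq) lt))) (≤-reflexive (sym (+-identityʳ k)))

      -- Multiplicity above `k` is exactly what the pigeonhole argument asks for:
      -- `n = ℓ + k + 1 ≤ ℓ + lookup S h`.
      heavy-coordinates : ∀ {h} → k < lookup S h → Coordinates h
      heavy-coordinates {h} k<Sh = coordinates h (≤-<-trans z≤n k<Sh)
        (subst₂ _≤_ (trans (+-suc ℓ k) (sym n≡ℓ+k+1)) (cong (_+ lookup S h) (sym size)) (+-monoʳ-≤ ℓ k<Sh))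

      -- From `k < ℓ` follows `n = ℓ + k + 1 ≤ 2 ℓ`, the hypothesis of `h-unit`.
      heavy-generator : ∀ {h} → k < lookup S h → Generator h
      heavy-generator k<Sh = unit⇒generator (h-unit (heavy-coordinates k<Sh)
        (subst₂ _≤_ (trans (+-suc ℓ k) (sym n≡ℓ+k+1)) (cong₂ _+_ (sym size) (sym size)) (+-monoʳ-≤ ℓ k<ℓ)))

    module Decode (S : Sequence n) (free : FreeSequence.Free (lookup S))
             (size : sum (lookup S) ≡ ℓ) (supp : sum (pos ∘ lookup S) ≡ suc e)
             (h : Fin n) (0<Sh : 0 < lookup S h) (C : Coordinatization.Coordinates (lookup S) free h) (G : Generator h) where

      open Coordinatization (lookup S) free
      open Coordinates C

      log≡coord : ∀ a → 0 < lookup S a → log h a ≡ coord a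
      log≡coord a 0<Sa = log-unique G
        (≤-<-trans (coord≤m a 0<Sa) (≤-<-trans (term≤sum (lookup S) h) (subst₂ _<_ (sym size) (sym n≡ℓ+k+1) (s≤s (m≤m+n ℓ k)))))
        (trans (coord-≡ a 0<Sa) (m<n⇒m%n≡m (Fin.toℕ<n a)))

      -- Shifted by one, since the parts are the coordinates minus 1; `μ 0` is the multiplicity of
      -- `h` itself.
      μ : ℕ → ℕ
      μ x = lookup S (at h (suc x))

      F : ℕ → ℕ
      F x = lookup S (at h x)

      F-log : ∀ a → F (log h a) ≡ lookup S a
      F-log a = cong (lookup S) (at-log G a)

      -- The zero element has logarithm 0, whereas the coordinate of a term is at least 1.
      F0 : F 0 ≡ 0
      F0 = n≤0⇒n≡0 (≮⇒≥ λ 0<F → <⇒≢ (1≤coord (at h 0) 0<F)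
        (sym (trans (sym (log≡coord (at h 0) 0<F)) (log-at G (>-nonZero⁻¹ n)))))

      sum-F : ∀ (f : ℕ → ℕ → ℕ) → sum (λ a → f (log h a) (lookup S a)) ≡ f 0 0 + sum {suc B} (λ x → f (suc (toℕ x)) (μ (toℕ x)))
      sum-F f = trans (sum-cong-≗ (λ a → cong (f (log h a)) (sym (F-log a))))
        (trans (sum-coord G (λ x → f x (F x))) (cong (λ z → f 0 z + sum {suc B} (λ x → f (suc (toℕ x)) (μ (toℕ x)))) F0))

      sum-μ : sum {suc B} (μ ∘ toℕ) ≡ ℓ
      sum-μ = trans (sym (sum-F (λ _ s → s))) size

      scale : ∀ s {x y} → (0 < s → x ≡ y) → s * x ≡ s * y
      scale zero    eq = refl
      scale (suc s) eq = cong (suc s *_) (eq (s≤s z≤n))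

      -- The `ℓ` coordinates have a sum below `n = ℓ + k + 1`; taking 1 from each leaves at most
      -- `k`.
      weight-μ : sum {suc B} (λ x → μ (toℕ x) * toℕ x) ≤ k
      weight-μ = +-cancelˡ-≤ ℓ _ _ (≤-pred (begin-strict
        ℓ + sum {suc B} (λ x → μ (toℕ x) * toℕ x)
          ≡⟨ cong (_+ sum {suc B} (λ x → μ (toℕ x) * toℕ x)) sum-μ ⟨
        sum {suc B} (μ ∘ toℕ) + sum {suc B} (λ x → μ (toℕ x) * toℕ x)
          ≡⟨ ∑-distrib-+ {suc B} (μ ∘ toℕ) (λ x → μ (toℕ x) * toℕ x) ⟨
        sum {suc B} (λ x → μ (toℕ x) + μ (toℕ x) * toℕ x)
          ≡⟨ sum-cong-≗ {suc B} (λ x → sym (*-suc (μ (toℕ x)) (toℕ x))) ⟩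
        sum {suc B} (λ x → μ (toℕ x) * suc (toℕ x))
          ≡⟨ sum-F (λ x s → s * x) ⟨
        weight (log h) (lookup S)
          ≡⟨ sum-cong-≗ logs ⟩
        weight coord (lookup S)
          <⟨ weight< C ⟩
        n
          ≡⟨ n≡ℓ+k+1 ⟩
        suc (ℓ + k) ∎))
        where
        open ≤-Reasoning
        logs : ∀ a → lookup S a * log h a ≡ lookup S a * coord a
        logs a = scale (lookup S a) (log≡coord a)

      μ-zero : ∀ x → x < suc B → k < x → μ x ≡ 0
      μ-zero x x<B k<x = n≤0⇒n≡0 (≮⇒≥ λ 0<μ → <-irrefl refl (<-≤-trans k<x (begin
        x  ≤⟨ m≤n*m x (μ x) {{>-nonZero 0<μ}} ⟩
        μ x * x  ≡⟨ cong (λ z → μ z * z) (Fin.toℕ-fromℕ< x<B) ⟨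
        μ (toℕ (fromℕ< x<B)) * toℕ (fromℕ< x<B)  ≤⟨ term≤sum {suc B} (λ x → μ (toℕ x) * toℕ x) (fromℕ< x<B) ⟩
        sum {suc B} (λ x → μ (toℕ x) * toℕ x)  ≤⟨ weight-μ ⟩
        k  ∎)))
        where open ≤-Reasoning

      -- Values from 1 to `k` suffice by `μ-zero`. The value 0 is omitted, and `pad` restores it
      -- from the length.
      xs : List ℕ
      xs = expand μ 1 k

      positive-xs : Positive xs
      positive-xs = expand-≥ μ 1 k

      bound-xs : All (_< suc B) xs
      bound-xs = All.map (λ lt → <-≤-trans lt (s≤s (m≤n+m k ℓ′))) (expand-< μ 1 k)

      count-xs-0 : count 0 xs ≡ 0
      count-xs-0 = ∉⇒count (λ 0∈ → <-irrefl refl (All.lookup positive-xs 0∈))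

      count-xs : ∀ x → suc x < suc B → count (suc x) xs ≡ μ (suc x)
      count-xs x x<B with suc x ≤? k
      ... | yes x≤k = count-expand μ 1 k (suc x) (s≤s z≤n) (s≤s x≤k)
      ... | no x≰k  = trans (∉⇒count (λ x∈ → x≰k (≤-pred (All.lookup (expand-< μ 1 k) x∈))))
                        (sym (μ-zero (suc x) x<B (≰⇒> x≰k)))

      sum-xs : ∀ (f : ℕ → ℕ → ℕ) → sum {suc B} (λ x → f (toℕ x) (count (toℕ x) xs))
                                 ≡ f 0 0 + sum {B} (λ x → f (suc (toℕ x)) (μ (suc (toℕ x))))
      sum-xs f = cong₂ _+_ (cong (f 0) count-xs-0)
        (sum-cong-≗ {B} (λ x → cong (f (suc (toℕ x))) (count-xs (toℕ x) (s≤s (Fin.toℕ<n x)))))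

      length-xs : μ 0 + length xs ≡ ℓ
      length-xs = trans (cong (μ 0 +_) (trans (sym (length-count {suc B} bound-xs)) (sum-xs (λ _ c → c)))) sum-μ

      parts-xs : Parts k e xs
      parts-xs = parts (expand-sorted μ 1 k) positive-xs sum≤ distinct≡
        where
        sum≤ : ListAction.sum xs ≤ k
        sum≤ = ≤-trans (≤-reflexive (trans
            (sym (trans (sum-count {suc B} (λ x → x) bound-xs) (cong ListAction.sum (map-id xs))))
            (sum-xs (λ x c → c * x))))
          (≤-trans (m≤n+m _ (μ 0 * 0)) weight-μ)
        distinct≡ : distinct xs ≡ e
        distinct≡ = suc-injective (begin
          suc (distinct xs)  ≡⟨ cong suc (trans (length-deduplicate {suc B} bound-xs) (sum-xs (λ _ c → pos c))) ⟩
          1 + sum {B} (λ x → pos (μ (suc (toℕ x))))  ≡⟨ cong (_+ sum {B} (λ x → pos (μ (suc (toℕ x))))) (pos-> 0<μ0) ⟨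
          sum {suc B} (λ x → pos (μ (toℕ x)))  ≡⟨ sum-F (λ _ s → pos s) ⟨
          sum (pos ∘ lookup S)  ≡⟨ supp ⟩
          suc e  ∎)
          where
          open ≡-Reasoning
          0<μ0 : 0 < μ 0
          0<μ0 = subst (0 <_) (sym (trans (cong (λ z → lookup S (at h z)) (sym (log-self G))) (F-log h))) 0<Sh

      decode : (h , xs) ∈ cartesianProduct (filter generator? (allFin n)) (family (e * suc e / 2) k e)
      decode = ∈-cartesianProduct⁺ (∈-filter⁺ generator? (∈-allFin h) G) (∈-family⁺ parts-xs)

      Φ-decode : Φ (h , xs) ≡ S
      Φ-decode = trans (Vec.tabulate-cong (λ a → trans (same (log h a) (log<n h a)) (F-log a))) (Vec.tabulate∘lookup S)
        where
        same : ∀ x → x < n → multiplicity xs x ≡ F x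
        same zero          _ = sym F0
        same (suc zero)    _ = trans (count-pad-0 parts-xs) (trans (cong (_∸ length xs) (sym length-xs)) (m+n∸n≡m (μ 0) (length xs)))
        same (suc (suc x)) p = trans (count-pad-suc parts-xs x) (count-xs x (≤-pred (subst (suc (suc x) <_) n≡ p)))

  -- `N` as the number of supports inside `R`, and the degree of a point.

  module Model (n ℓ′ k e : ℕ) .{{_ : NonZero n}} (n≡ : n ≡ suc (suc (ℓ′ + k))) (big : suc e * k < suc ℓ′) where

    open import Defs using (Generator; generator?; φ; support; ZeroSumFree; zeroSumFree?; sequences; N)
    open Sums
    open Lists
    open Counting
    open Partitions
    open Sequences
    open Logarithms {n}
    open Encoding n ℓ′ k e n≡ big
    open Decoding n ℓ′ k e n≡ big

    generators : List (Fin n)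
    generators = filter generator? (allFin n)

    patterns : List (List ℕ)
    patterns = family (e * suc e / 2) k e

    pairs : List (Fin n × List ℕ)
    pairs = cartesianProduct generators patterns

    -- A list with possible repetitions: `(g , 1 ∷ [])` and `(g , 1 ∷ 1 ∷ [])`, for instance, give
    -- the same support, and each pair has to be counted.
    supports : List (Subset n)
    supports = map (support ∘ Φ) pairs

    pairs-unique : Unique pairs
    pairs-unique = Unique.cartesianProduct⁺ (Unique.filter⁺ generator? (Unique.allFin⁺ n)) (family-unique (e * suc e / 2) k e)

    ∈-pairs⁻ : ∀ {g xs} → (g , xs) ∈ pairs → Generator g × Parts k e xs
    ∈-pairs⁻ p =
      let (g∈ , xs∈) = ∈-cartesianProduct⁻ generators patterns p in
      proj₂ (∈-filter⁻ generator? {xs = allFin n} g∈) , ∈-family⁻ {e * suc e / 2} xs∈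

    length-cartesianProduct : ∀ {A B : Set} (xs : List A) (ys : List B) →
                              length (cartesianProduct xs ys) ≡ length xs * length ys
    length-cartesianProduct []       ys = refl
    length-cartesianProduct (x ∷ xs) ys = trans (List.length-++ (map (x ,_) ys))
      (cong₂ _+_ (List.length-map (x ,_) ys) (length-cartesianProduct xs ys))

    length-supports : length supports ≡ φ n * length patterns
    length-supports = trans (List.length-map (support ∘ Φ) pairs) (length-cartesianProduct generators patterns)

    size-supports : All (λ A → ∣ A ∣ ≡ suc e) supports
    size-supports = All.map⁺ (All.tabulate λ {(g , xs)} p → size-Φ (proj₂ (∈-pairs⁻ p)) (proj₁ (∈-pairs⁻ p)))

    -- `Φ` is a bijection from the pairs with support inside `R` to the sequences that `N` counts:
    -- `Φ-injective` makes it injective and `Φ-decode` surjective.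
    N≡ : ∀ R → N n ℓ (suc e) R ≡ length (filter (_⊆? R) supports)
    N≡ R = sym (begin
      length (filter (_⊆? R) supports)  ≡⟨ length-filter-map (_⊆? R) (support ∘ Φ) pairs ⟩
      length (filter inR pairs)  ≡⟨ List.length-map Φ (filter inR pairs) ⟨
      length (map Φ (filter inR pairs))  ≡⟨ length-unique
        (map-unique Φ (Unique.filter⁺ inR pairs-unique)
          (λ {(g , xs)} {(h , ys)} p q →
            let (G , P) = ∈-pairs⁻ (proj₁ (∈-filter⁻ inR {xs = pairs} p))
                (H , Q) = ∈-pairs⁻ (proj₁ (∈-filter⁻ inR {xs = pairs} q))
            in Φ-injective G H P Q))
        (Unique.filter⁺ good (sequences-unique n ℓ)) to from ⟩
      length (filter good (sequences n ℓ))  ∎)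
      where
      open ≡-Reasoning
      inR : Decidable (λ p → support (Φ p) ⊆ R)
      inR p = support (Φ p) ⊆? R
      good : Decidable (λ S → ZeroSumFree S × (∣ support S ∣ ≡ suc e) × support S ⊆ R)
      good S = zeroSumFree? S ×-dec (∣ support S ∣ ≟ suc e) ×-dec (support S ⊆? R)
      to : ∀ {S} → S ∈ map Φ (filter inR pairs) → S ∈ filter good (sequences n ℓ)
      to {S} p =
        let (_ , p∈ , S≡)   = ∈-map⁻ Φ p
            (p∈pairs , sub) = ∈-filter⁻ inR {xs = pairs} p∈
            (G , P)         = ∈-pairs⁻ p∈pairs
        in subst (_∈ filter good (sequences n ℓ)) (sym S≡)
          (∈-filter⁺ good (∈-sequences⁺ (Φ _) (sum-Φ P G))
            (free⇒zeroSumFree (Φ _) (free-Φ P G) , size-Φ P G , sub))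
      from : ∀ {S} → S ∈ filter good (sequences n ℓ) → S ∈ map Φ (filter inR pairs)
      from {S} p =
        let (p∈ , free , supp , sub) = ∈-filter⁻ good {xs = sequences n ℓ} p in
        encoded (∈-sequences⁻ {n} {ℓ} p∈) (zeroSumFree⇒free S free) (trans (sym (size-support S)) supp) sub
        where
        encoded : sum (lookup S) ≡ ℓ → FreeSequence.Free (lookup S) → sum (pos ∘ lookup S) ≡ suc e →
                  support S ⊆ R → S ∈ map Φ (filter inR pairs)
        encoded size free supp sub with h , k<Sh ← frequent S free size supp =
          subst (_∈ map Φ (filter inR pairs)) Φ-decode
            (∈-map⁺ Φ (∈-filter⁺ inR decode (subst (λ T → support T ⊆ R) (sym Φ-decode) sub)))
          where
          open Decode S free size supp h (≤-<-trans z≤n k<Sh)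
            (heavy-coordinates S free size supp k<Sh) (heavy-generator S free size supp k<Sh)

    -- If `a` lies in the support of `Φ (g , xs)`, then `a = c g` with `1 ≤ c ≤ b + 1`, and for
    -- given `c` at most `c` elements `g` qualify. The bound is in terms of `b` and not `k` for the
    -- sake of `e = 0`, where `k` may grow with `n` but `b = 0` works.
    degree : ∀ b → (∀ {xs} → Parts k e xs → All (_≤ b) xs) → ∀ a →
             length (filter (a ∈?_) supports) ≤ length patterns * ((2 + b) * (2 + b))
    degree b parts≤b a = begin
      length (filter (a ∈?_) supports)  ≡⟨ length-filter-map (a ∈?_) (support ∘ Φ) pairs ⟩
      length (filter hits pairs)  ≤⟨ length-inject key (Unique.filter⁺ hits pairs-unique) key-injective key∈ ⟩
      length (cartesianProduct patterns (cartesianProduct (upTo (2 + b)) (upTo (2 + b))))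
        ≡⟨ trans (length-cartesianProduct patterns _) (cong (length patterns *_)
             (trans (length-cartesianProduct (upTo (2 + b)) (upTo (2 + b)))
               (cong₂ _*_ (List.length-upTo (2 + b)) (List.length-upTo (2 + b))))) ⟩
      length patterns * ((2 + b) * (2 + b)) ∎
      where
      open ≤-Reasoning
      hits : Decidable (λ p → a ∈ₛ support (Φ p))
      hits p = a ∈? support (Φ p)
      -- A generator g with c g = a in C n is determined by c and the
      -- integer quotient of c g by n.
      key : Fin n × List ℕ → List ℕ × ℕ × ℕ
      key (g , xs) = xs , log g a , log g a * toℕ g / n
      range : ∀ {xs} → Parts k e xs → ∀ x → 0 < multiplicity xs x → 1 ≤ x × x < 2 + b
      range {xs} P (suc x) 0<m = s≤s z≤n , s≤s (s≤s (All.lookup all≤b (count⇒∈ {x} {pad xs} 0<m)))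
        where
        all≤b : All (_≤ b) (pad xs)
        all≤b = All.++⁺ (All.replicate⁺ (ℓ ∸ length xs) z≤n) (parts≤b P)
      hit : ∀ {g xs} → (g , xs) ∈ filter hits pairs →
            Generator g × Parts k e xs × xs ∈ patterns × 1 ≤ log g a × log g a < 2 + b
      hit {g} {xs} p =
        let (p∈ , a∈) = ∈-filter⁻ hits {xs = pairs} p
            (G , P)   = ∈-pairs⁻ p∈
        in G , P , proj₂ (∈-cartesianProduct⁻ generators patterns p∈) , range P (log g a)
          (subst (0 <_) (lookup-Φ g xs a) (∈-support⁻ (Φ (g , xs)) a∈))
      quotient-injective : ∀ {g h} → Generator g → Generator h → 1 ≤ log g a → log g a ≡ log h a →
                           log g a * toℕ g / n ≡ log h a * toℕ h / n → g ≡ h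
      quotient-injective {g} {h} G H 1≤c c≡ q≡ =
        Fin.toℕ-injective (*-cancelˡ-≡ (toℕ g) (toℕ h) (log g a) {{>-nonZero 1≤c}} cg≡ch)
        where
        cg≡ch : log g a * toℕ g ≡ log g a * toℕ h
        cg≡ch = trans (m≡m%n+[m/n]*n (log g a * toℕ g) n)
          (trans (cong₂ (λ r s → r + s * n) (trans (log-spec G a) (sym (log-spec H a))) q≡)
          (trans (sym (m≡m%n+[m/n]*n (log h a * toℕ h) n)) (cong (_* toℕ h) (sym c≡))))
      key-injective : ∀ {p q} → p ∈ filter hits pairs → q ∈ filter hits pairs → key p ≡ key q → p ≡ q
      key-injective {g , xs} {h , ys} p q eq =
        let (G , _ , _ , 1≤c , _) = hit p
            (H , _)               = hit q
        in cong₂ _,_ (quotient-injective G H 1≤c (cong (proj₁ ∘ proj₂) eq) (cong (proj₂ ∘ proj₂) eq)) (cong proj₁ eq)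
      key∈ : ∀ {p} → p ∈ filter hits pairs → key p ∈ cartesianProduct patterns (cartesianProduct (upTo (2 + b)) (upTo (2 + b)))
      key∈ {g , xs} p =
        let (_ , _ , xs∈ , 1≤c , c<) = hit p in
        ∈-cartesianProduct⁺ xs∈ (∈-cartesianProduct⁺ (∈-upTo⁺ c<)
          (∈-upTo⁺ (<-trans (m<n*o⇒m/o<n (*-monoʳ-< (log g a) {{>-nonZero 1≤c}} (Fin.toℕ<n g))) c<)))

module RandomSubsets where

  open import Data.Bool.Base using (true; false; if_then_else_)
  open import Data.Fin.Base using (Fin; zero; suc)
  open import Data.Fin.Subset using (Subset; inside; outside; ∣_∣; _∩_; _∪_)
  open import Data.Fin.Subset.Properties using (_⊆?_; _∈?_; ∣p∣≤∣p∪q∣)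
  open import Data.Integer.Base as ℤ using ()
  import Data.Integer.Properties as ℤ
  open import Data.List.Base using (List; []; _∷_; length; map; filter)
  open import Data.List.Relation.Unary.All as All using (All; []; _∷_)
  open import Data.Nat.Base as ℕ using (ℕ; zero; suc; z≤n; s≤s)
  import Data.Nat.ListAction as ListAction
  import Data.Nat.Properties as ℕ
  open import Data.Rational hiding (∣_∣)
  open import Data.Rational.Properties
  import Data.Rational.Unnormalised.Base as ℚᵘ
  import Data.Rational.Unnormalised.Properties as ℚᵘ
  open import Data.Sum.Base using (inj₁; inj₂)
  open import Data.Vec.Base using ([]; _∷_)
  open import Level using (0ℓ)
  open import Relation.Binary.PropositionalEquality
  open import Relation.Nullary
  open import Relation.Nullary.Decidable using (dec⇒maybe)
  open import Tactic.RingSolver using (solve-∀)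
  open import Tactic.RingSolver.Core.AlmostCommutativeRing using (AlmostCommutativeRing; fromCommutativeRing)
  import Algebra.Properties.Semiring.Sum ℕ.+-*-semiring as ℕΣ
  open Combinatorics using (module Sums)

  -- Rational arithmetic and sums over lists.

  module Rationals where

    ℚ-ring : AlmostCommutativeRing 0ℓ 0ℓ
    ℚ-ring = fromCommutativeRing +-*-commutativeRing (λ x → dec⇒maybe (0ℚ ≟ x))

    ι : ℕ → ℚ
    ι m = ℤ.+ m / 1

    toℚᵘ-ι : ∀ m → toℚᵘ (ι m) ℚᵘ.≃ ℚᵘ.mkℚᵘ (ℤ.+ m) 0
    toℚᵘ-ι m = toℚᵘ-fromℚᵘ (ℚᵘ.mkℚᵘ (ℤ.+ m) 0)

    ι-+ : ∀ a b → ι (a ℕ.+ b) ≡ ι a + ι b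
    ι-+ a b = toℚᵘ-injective (ℚᵘ.≃-trans (toℚᵘ-ι (a ℕ.+ b)) (ℚᵘ.≃-sym
      (ℚᵘ.≃-trans (toℚᵘ-homo-+ (ι a) (ι b)) (ℚᵘ.≃-trans (ℚᵘ.+-cong (toℚᵘ-ι a) (toℚᵘ-ι b))
        (ℚᵘ.*≡* (cong (ℤ._* ℤ.+ 1) (cong₂ ℤ._+_ (ℤ.*-identityʳ (ℤ.+ a)) (ℤ.*-identityʳ (ℤ.+ b)))))))))

    ι-* : ∀ a b → ι (a ℕ.* b) ≡ ι a * ι b
    ι-* a b = toℚᵘ-injective (ℚᵘ.≃-trans (toℚᵘ-ι (a ℕ.* b)) (ℚᵘ.≃-sym
      (ℚᵘ.≃-trans (toℚᵘ-homo-* (ι a) (ι b)) (ℚᵘ.≃-trans (ℚᵘ.*-cong (toℚᵘ-ι a) (toℚᵘ-ι b))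
        (ℚᵘ.*≡* (cong (ℤ._* ℤ.+ 1) (sym (ℤ.pos-* a b))))))))

    0≤ι : ∀ m → 0ℚ ≤ ι m
    0≤ι m = nonNegative⁻¹ (ι m) {{normalize-nonNeg m 1}}

    ι-mono : ∀ {a b} → a ℕ.≤ b → ι a ≤ ι b
    ι-mono {a} {b} a≤b = begin
      ι a  ≡⟨ +-identityʳ (ι a) ⟨
      ι a + 0ℚ  ≤⟨ +-monoʳ-≤ (ι a) (0≤ι (b ℕ.∸ a)) ⟩
      ι a + ι (b ℕ.∸ a)  ≡⟨ ι-+ a (b ℕ.∸ a) ⟨
      ι (a ℕ.+ (b ℕ.∸ a))  ≡⟨ cong ι (ℕ.m+[n∸m]≡n a≤b) ⟩
      ι b  ∎
      where open ≤-Reasoning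

    0≤* : ∀ {a b} → 0ℚ ≤ a → 0ℚ ≤ b → 0ℚ ≤ a * b
    0≤* {a} {b} 0≤a 0≤b = nonNegative⁻¹ (a * b) {{nonNeg*nonNeg⇒nonNeg a {{nonNegative 0≤a}} b {{nonNegative 0≤b}}}}

    *-monoʳ : ∀ {a b c} → 0ℚ ≤ c → a ≤ b → c * a ≤ c * b
    *-monoʳ {c = c} 0≤c = *-monoˡ-≤-nonNeg c {{nonNegative 0≤c}}

    *-mono : ∀ {a b c d} → 0ℚ ≤ b → 0ℚ ≤ c → a ≤ b → c ≤ d → a * c ≤ b * d
    *-mono {a} {b} {c} {d} 0≤b 0≤c a≤b c≤d =
      ≤-trans (*-monoʳ-≤-nonNeg c {{nonNegative 0≤c}} a≤b) (*-monoʳ {c} {d} {b} 0≤b c≤d)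

    ≤⇒0≤- : ∀ {a b} → a ≤ b → 0ℚ ≤ b - a
    ≤⇒0≤- {a} {b} h = subst (_≤ b - a) (+-inverseʳ a) (+-monoˡ-≤ (- a) h)

    0≤-⇒≤ : ∀ {a b} → 0ℚ ≤ b - a → a ≤ b
    0≤-⇒≤ {a} {b} h = subst₂ _≤_ (+-identityˡ a) (cancel b a) (+-monoˡ-≤ a h)
      where
      cancel : ∀ b a → b - a + a ≡ b
      cancel = solve-∀ ℚ-ring

    0≤square : ∀ a → 0ℚ ≤ a * a
    0≤square a with ≤-total 0ℚ a
    ... | inj₁ 0≤a = 0≤* 0≤a 0≤a
    ... | inj₂ a≤0 = subst (0ℚ ≤_) (square-neg a) (0≤* 0≤-a 0≤-a)
      where
      square-neg : ∀ a → (- a) * (- a) ≡ a * a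
      square-neg = solve-∀ ℚ-ring
      0≤-a : 0ℚ ≤ - a
      0≤-a = subst (_≤ - a) refl (neg-antimono-≤ a≤0)

    pow : ℚ → ℕ → ℚ
    pow q zero    = 1ℚ
    pow q (suc d) = q * pow q d

    pow-+ : ∀ q a b → pow q (a ℕ.+ b) ≡ pow q a * pow q b
    pow-+ q zero    b = sym (*-identityˡ (pow q b))
    pow-+ q (suc a) b = trans (cong (q *_) (pow-+ q a b)) (sym (*-assoc q (pow q a) (pow q b)))

    0≤pow : ∀ {q} → 0ℚ ≤ q → ∀ d → 0ℚ ≤ pow q d
    0≤pow 0≤q zero    = nonNegative⁻¹ 1ℚ
    0≤pow 0≤q (suc d) = 0≤* 0≤q (0≤pow 0≤q d)

    pow≤1 : ∀ {q} → 0ℚ ≤ q → q ≤ 1ℚ → ∀ d → pow q d ≤ 1ℚ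
    pow≤1 0≤q q≤1 zero    = ≤-refl
    pow≤1 0≤q q≤1 (suc d) = *-mono (nonNegative⁻¹ 1ℚ) (0≤pow 0≤q d) q≤1 (pow≤1 0≤q q≤1 d)

    pow-anti : ∀ {q} → 0ℚ ≤ q → q ≤ 1ℚ → ∀ {a b} → a ℕ.≤ b → pow q b ≤ pow q a
    pow-anti {q} 0≤q q≤1 {a} {b} a≤b = begin
      pow q b  ≡⟨ cong (pow q) (ℕ.m+[n∸m]≡n a≤b) ⟨
      pow q (a ℕ.+ (b ℕ.∸ a))  ≡⟨ pow-+ q a (b ℕ.∸ a) ⟩
      pow q a * pow q (b ℕ.∸ a)  ≤⟨ *-monoʳ (0≤pow 0≤q a) (pow≤1 0≤q q≤1 (b ℕ.∸ a)) ⟩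
      pow q a * 1ℚ  ≡⟨ *-identityʳ (pow q a) ⟩
      pow q a  ∎
      where open ≤-Reasoning

    sumL : ∀ {A : Set} → (A → ℚ) → List A → ℚ
    sumL f []       = 0ℚ
    sumL f (x ∷ xs) = f x + sumL f xs

    sumL-mono : ∀ {A : Set} {f g : A → ℚ} {xs} → All (λ x → f x ≤ g x) xs → sumL f xs ≤ sumL g xs
    sumL-mono []      = ≤-refl
    sumL-mono (p ∷ h) = +-mono-≤ p (sumL-mono h)

    sumL-cong : ∀ {A : Set} {f g : A → ℚ} → (∀ x → f x ≡ g x) → ∀ xs → sumL f xs ≡ sumL g xs
    sumL-cong h []       = refl
    sumL-cong h (x ∷ xs) = cong₂ _+_ (h x) (sumL-cong h xs)

    sumL-const : ∀ {A : Set} c (xs : List A) → sumL (λ _ → c) xs ≡ ι (length xs) * c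
    sumL-const c []       = sym (*-zeroˡ c)
    sumL-const c (x ∷ xs) = begin
      c + sumL (λ _ → c) xs  ≡⟨ cong (c +_) (sumL-const c xs) ⟩
      c + ι (length xs) * c  ≡⟨ cong (_+ ι (length xs) * c) (*-identityˡ c) ⟨
      1ℚ * c + ι (length xs) * c  ≡⟨ *-distribʳ-+ c 1ℚ (ι (length xs)) ⟨
      (1ℚ + ι (length xs)) * c  ≡⟨ cong (_* c) (ι-+ 1 (length xs)) ⟨
      ι (suc (length xs)) * c  ∎
      where open ≡-Reasoning

    sumL-+ : ∀ {A : Set} (f g : A → ℚ) xs → sumL (λ x → f x + g x) xs ≡ sumL f xs + sumL g xs
    sumL-+ f g []       = refl
    sumL-+ f g (x ∷ xs) = trans (cong (f x + g x +_) (sumL-+ f g xs)) (alg (f x) (g x) (sumL f xs) (sumL g xs))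
      where
      alg : ∀ a b c d → a + b + (c + d) ≡ a + c + (b + d)
      alg = solve-∀ ℚ-ring

    sumL-* : ∀ {A : Set} c (f : A → ℚ) xs → sumL (λ x → c * f x) xs ≡ c * sumL f xs
    sumL-* c f []       = sym (*-zeroʳ c)
    sumL-* c f (x ∷ xs) = trans (cong (c * f x +_) (sumL-* c f xs)) (sym (*-distribˡ-+ c (f x) (sumL f xs)))

    sumL-ι : ∀ {A : Set} (f : A → ℕ) xs → sumL (λ x → ι (f x)) xs ≡ ι (ListAction.sum (map f xs))
    sumL-ι f []       = refl
    sumL-ι f (x ∷ xs) = trans (cong (ι (f x) +_) (sumL-ι f xs)) (sym (ι-+ (f x) _))

  -- First and second moments at a rational probability.

  module Expectation where

    open Rationals

    -- Conditioning on the first element of the random set. It is a polynomial in `q`, meaningful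
    -- also outside the interval from 0 to 1, where approximants of a probability may lie.
    E : ℚ → ∀ {n} → (Subset n → ℚ) → ℚ
    E q {zero}  f = f []
    E q {suc n} f = (1ℚ - q) * E q (λ R → f (outside ∷ R)) + q * E q (λ R → f (inside ∷ R))

    module _ (q : ℚ) where

      E-cong : ∀ {n} {f g : Subset n → ℚ} → (∀ R → f R ≡ g R) → E q f ≡ E q g
      E-cong {zero}  h = h []
      E-cong {suc n} h = cong₂ (λ a b → (1ℚ - q) * a + q * b) (E-cong (λ R → h (outside ∷ R))) (E-cong (λ R → h (inside ∷ R)))

      E-+ : ∀ {n} (f g : Subset n → ℚ) → E q (λ R → f R + g R) ≡ E q f + E q g
      E-+ {zero}  f g = refl
      E-+ {suc n} f g = trans (cong₂ (λ a b → (1ℚ - q) * a + q * b)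
            (E-+ (λ R → f (outside ∷ R)) (λ R → g (outside ∷ R))) (E-+ (λ R → f (inside ∷ R)) (λ R → g (inside ∷ R))))
          (alg (1ℚ - q) q (E q (λ R → f (outside ∷ R))) (E q (λ R → g (outside ∷ R))) (E q (λ R → f (inside ∷ R))) (E q (λ R → g (inside ∷ R))))
        where
        alg : ∀ p q a b c d → p * (a + b) + q * (c + d) ≡ p * a + q * c + (p * b + q * d)
        alg = solve-∀ ℚ-ring

      E-* : ∀ {n} c (f : Subset n → ℚ) → E q (λ R → c * f R) ≡ c * E q f
      E-* {zero}  c f = refl
      E-* {suc n} c f = trans (cong₂ (λ a b → (1ℚ - q) * a + q * b) (E-* c (λ R → f (outside ∷ R))) (E-* c (λ R → f (inside ∷ R))))
          (alg (1ℚ - q) q c (E q (λ R → f (outside ∷ R))) (E q (λ R → f (inside ∷ R))))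
        where
        alg : ∀ p q c a b → p * (c * a) + q * (c * b) ≡ c * (p * a + q * b)
        alg = solve-∀ ℚ-ring

      convex : ∀ a → (1ℚ - q) * a + q * a ≡ a
      convex a = trans (alg q a) (*-identityˡ a)
        where
        alg : ∀ q a → (1ℚ - q) * a + q * a ≡ 1ℚ * a
        alg q a = trans (sym (*-distribʳ-+ a (1ℚ - q) q)) (cong (_* a) (alg′ 1ℚ q))
          where
          alg′ : ∀ o q → o - q + q ≡ o
          alg′ = solve-∀ ℚ-ring

      E-const : ∀ {n} c → E q {n} (λ _ → c) ≡ c
      E-const {zero}  c = refl
      E-const {suc n} c = trans (cong₂ (λ a b → (1ℚ - q) * a + q * b) (E-const {n} c) (E-const {n} c)) (convex c)

      E-sumL : ∀ {n} {A : Set} (f : A → Subset n → ℚ) xs → E q (λ R → sumL (λ x → f x R) xs) ≡ sumL (λ x → E q (f x)) xs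
      E-sumL {n} f []       = E-const {n} 0ℚ
      E-sumL f (x ∷ xs) = trans (E-+ (f x) (λ R → sumL (λ x → f x R) xs)) (cong (E q (f x) +_) (E-sumL f xs))

      module _ (0≤q : 0ℚ ≤ q) (q≤1 : q ≤ 1ℚ) where

        E-mono : ∀ {n} {f g : Subset n → ℚ} → (∀ R → f R ≤ g R) → E q f ≤ E q g
        E-mono {zero}  h = h []
        E-mono {suc n} h = +-mono-≤ (*-monoʳ (≤⇒0≤- q≤1) (E-mono (λ R → h (outside ∷ R))))
                                    (*-monoʳ 0≤q (E-mono (λ R → h (inside ∷ R))))

    -- The indicator of inclusion, by recursion in step with `E`, so that independence of the
    -- elements is used one coordinate at a time.
    sub : ∀ {n} → Subset n → Subset n → ℚ
    sub []            []            = 1ℚ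
    sub (outside ∷ A) (_ ∷ R)       = sub A R
    sub (inside ∷ A)  (outside ∷ R) = 0ℚ
    sub (inside ∷ A)  (inside ∷ R)  = sub A R

    sub-does : ∀ {n} (A R : Subset n) → sub A R ≡ (if does (A ⊆? R) then 1ℚ else 0ℚ)
    sub-does []            []            = refl
    sub-does (outside ∷ A) (_ ∷ R)       = sub-does A R
    sub-does (inside ∷ A)  (outside ∷ R) = refl
    sub-does (inside ∷ A)  (inside ∷ R)  = sub-does A R

    ι-filter : ∀ {n} (R : Subset n) (𝒜 : List (Subset n)) → ι (length (filter (_⊆? R) 𝒜)) ≡ sumL (λ A → sub A R) 𝒜
    ι-filter R []      = refl
    ι-filter R (A ∷ 𝒜) rewrite sub-does A R with does (A ⊆? R)
    ... | true  = trans (ι-+ 1 (length (filter (_⊆? R) 𝒜))) (cong (1ℚ +_) (ι-filter R 𝒜))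
    ... | false = trans (ι-filter R 𝒜) (sym (+-identityˡ _))

    sub-∪ : ∀ {n} (A B R : Subset n) → sub A R * sub B R ≡ sub (A ∪ B) R
    sub-∪ []            []            []            = refl
    sub-∪ (outside ∷ A) (outside ∷ B) (_ ∷ R)       = sub-∪ A B R
    sub-∪ (outside ∷ A) (inside ∷ B)  (outside ∷ R) = *-zeroʳ (sub A R)
    sub-∪ (outside ∷ A) (inside ∷ B)  (inside ∷ R)  = sub-∪ A B R
    sub-∪ (inside ∷ A)  (b ∷ B)       (outside ∷ R) = *-zeroˡ (sub (b ∷ B) (outside ∷ R))
    sub-∪ (inside ∷ A)  (outside ∷ B) (inside ∷ R)  = sub-∪ A B R
    sub-∪ (inside ∷ A)  (inside ∷ B)  (inside ∷ R)  = sub-∪ A B R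

    E-sub : ∀ q {n} (A : Subset n) → E q (sub A) ≡ pow q ∣ A ∣
    E-sub q []            = refl
    E-sub q (outside ∷ A) = trans (convex q (E q (sub A))) (E-sub q A)
    E-sub q {suc n} (inside ∷ A)  = begin
      (1ℚ - q) * E q {n} (λ _ → 0ℚ) + q * E q (sub A)  ≡⟨ cong₂ (λ a b → (1ℚ - q) * a + q * b) (E-const q {n} 0ℚ) (E-sub q A) ⟩
      (1ℚ - q) * 0ℚ + q * pow q ∣ A ∣  ≡⟨ cong (_+ q * pow q ∣ A ∣) (*-zeroʳ (1ℚ - q)) ⟩
      0ℚ + q * pow q ∣ A ∣  ≡⟨ +-identityˡ _ ⟩
      q * pow q ∣ A ∣  ∎
      where open ≡-Reasoning

    size-∪∩ : ∀ {n} (A B : Subset n) → ∣ A ∪ B ∣ ℕ.+ ∣ A ∩ B ∣ ≡ ∣ A ∣ ℕ.+ ∣ B ∣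
    size-∪∩ []            []            = refl
    size-∪∩ (outside ∷ A) (outside ∷ B) = size-∪∩ A B
    size-∪∩ (outside ∷ A) (inside ∷ B)  = trans (cong suc (size-∪∩ A B)) (sym (ℕ.+-suc ∣ A ∣ ∣ B ∣))
    size-∪∩ (inside ∷ A)  (outside ∷ B) = cong suc (size-∪∩ A B)
    size-∪∩ (inside ∷ A)  (inside ∷ B)  = cong suc (trans (ℕ.+-suc ∣ A ∪ B ∣ ∣ A ∩ B ∣)
      (trans (cong suc (size-∪∩ A B)) (sym (ℕ.+-suc ∣ A ∣ ∣ B ∣))))

    -- Disjoint sets are independent; otherwise A alone bounds the probability.
    E-pair : ∀ {q} → 0ℚ ≤ q → q ≤ 1ℚ → ∀ {n} (A B : Subset n) →
             E q (λ R → sub A R * sub B R) ≤ pow q ∣ A ∣ * pow q ∣ B ∣ + pow q ∣ A ∣ * ι ∣ A ∩ B ∣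
    E-pair {q} 0≤q q≤1 A B = ≤-trans (≤-reflexive (trans (E-cong q (sub-∪ A B)) (E-sub q (A ∪ B)))) (go ∣ A ∩ B ∣ refl)
      where
      open ≤-Reasoning
      go : ∀ m → ∣ A ∩ B ∣ ≡ m → pow q ∣ A ∪ B ∣ ≤ pow q ∣ A ∣ * pow q ∣ B ∣ + pow q ∣ A ∣ * ι m
      go zero eq = begin
        pow q ∣ A ∪ B ∣  ≡⟨ cong (pow q) (trans (trans (sym (ℕ.+-identityʳ _)) (cong (∣ A ∪ B ∣ ℕ.+_) (sym eq))) (size-∪∩ A B)) ⟩
        pow q (∣ A ∣ ℕ.+ ∣ B ∣)  ≡⟨ pow-+ q ∣ A ∣ ∣ B ∣ ⟩
        pow q ∣ A ∣ * pow q ∣ B ∣  ≡⟨ trans (cong (pow q ∣ A ∣ * pow q ∣ B ∣ +_) (*-zeroʳ (pow q ∣ A ∣))) (+-identityʳ _) ⟨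
        pow q ∣ A ∣ * pow q ∣ B ∣ + pow q ∣ A ∣ * 0ℚ  ∎
      go (suc m) eq = begin
        pow q ∣ A ∪ B ∣  ≤⟨ pow-anti 0≤q q≤1 (∣p∣≤∣p∪q∣ A B) ⟩
        pow q ∣ A ∣  ≡⟨ trans (+-identityˡ _) (*-identityʳ (pow q ∣ A ∣)) ⟨
        0ℚ + pow q ∣ A ∣ * 1ℚ  ≤⟨ +-mono-≤ (0≤* (0≤pow 0≤q ∣ A ∣) (0≤pow 0≤q ∣ B ∣)) (*-monoʳ (0≤pow 0≤q ∣ A ∣) (ι-mono {1} {suc m} (s≤s z≤n))) ⟩
        pow q ∣ A ∣ * pow q ∣ B ∣ + pow q ∣ A ∣ * ι (suc m) ∎

    mem : ∀ {n} → Subset n → Fin n → ℕ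
    mem A a = if does (a ∈? A) then 1 else 0

    size-mem : ∀ {n} (A : Subset n) → ∣ A ∣ ≡ ℕΣ.sum (mem A)
    size-mem []            = refl
    size-mem (outside ∷ A) = size-mem A
    size-mem (inside ∷ A)  = cong suc (size-mem A)

    mem-∩ : ∀ {n} (A B : Subset n) a → mem (A ∩ B) a ≡ mem A a ℕ.* mem B a
    mem-∩ (outside ∷ A) (_ ∷ B)       zero    = refl
    mem-∩ (inside ∷ A)  (outside ∷ B) zero    = refl
    mem-∩ (inside ∷ A)  (inside ∷ B)  zero    = refl
    mem-∩ (outside ∷ A) (outside ∷ B) (suc a) = mem-∩ A B a
    mem-∩ (outside ∷ A) (inside ∷ B)  (suc a) = mem-∩ A B a
    mem-∩ (inside ∷ A)  (outside ∷ B) (suc a) = mem-∩ A B a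
    mem-∩ (inside ∷ A)  (inside ∷ B)  (suc a) = mem-∩ A B a

    -- Double counting of the pairs of a point of `A` and a member `B` containing it. This is why
    -- `E-pair` weighs an overlap by its size instead of merely noting it.
    sum-∩≤ : ∀ {n} Δ (𝒜 : List (Subset n)) → (∀ a → length (filter (a ∈?_) 𝒜) ℕ.≤ Δ) → ∀ A →
              ListAction.sum (map (λ B → ∣ A ∩ B ∣) 𝒜) ℕ.≤ ∣ A ∣ ℕ.* Δ
    sum-∩≤ Δ 𝒜 deg A = begin
      ListAction.sum (map (λ B → ∣ A ∩ B ∣) 𝒜)  ≡⟨ exchange 𝒜 ⟩
      ℕΣ.sum (λ a → mem A a ℕ.* length (filter (a ∈?_) 𝒜))  ≤⟨ Sums.sum-mono (λ a → ℕ.*-monoʳ-≤ (mem A a) (deg a)) ⟩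
      ℕΣ.sum (λ a → mem A a ℕ.* Δ)  ≡⟨ ℕΣ.*-distribʳ-sum Δ (mem A) ⟨
      ℕΣ.sum (mem A) ℕ.* Δ  ≡⟨ cong (ℕ._* Δ) (size-mem A) ⟨
      ∣ A ∣ ℕ.* Δ  ∎
      where
      open ℕ.≤-Reasoning
      length-∷ : ∀ a B 𝒜 → length (filter (a ∈?_) (B ∷ 𝒜)) ≡ mem B a ℕ.+ length (filter (a ∈?_) 𝒜)
      length-∷ a B 𝒜 with does (a ∈? B)
      ... | true  = refl
      ... | false = refl
      exchange : ∀ 𝒜 → ListAction.sum (map (λ B → ∣ A ∩ B ∣) 𝒜) ≡ ℕΣ.sum (λ a → mem A a ℕ.* length (filter (a ∈?_) 𝒜))
      exchange []      = sym (Sums.sum-zero (λ a → ℕ.*-zeroʳ (mem A a)))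
      exchange (B ∷ 𝒜) = trans (cong₂ ℕ._+_ (trans (size-mem (A ∩ B)) (ℕΣ.sum-cong-≗ (mem-∩ A B))) (exchange 𝒜))
        (trans (sym (ℕΣ.∑-distrib-+ (λ a → mem A a ℕ.* mem B a) (λ a → mem A a ℕ.* length (filter (a ∈?_) 𝒜))))
          (ℕΣ.sum-cong-≗ (λ a → trans (sym (ℕ.*-distribˡ-+ (mem A a) (mem B a) _)) (cong (mem A a ℕ.*_) (sym (length-∷ a B 𝒜))))))

    module Moments {n} (q : ℚ) (0≤q : 0ℚ ≤ q) (q≤1 : q ≤ 1ℚ) (𝒜 : List (Subset n)) (d Δ : ℕ)
                   (sizes : All (λ A → ∣ A ∣ ≡ d) 𝒜) (deg : ∀ a → length (filter (a ∈?_) 𝒜) ℕ.≤ Δ) where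

      X : Subset n → ℚ
      X R = ι (length (filter (_⊆? R) 𝒜))

      M v μ : ℚ
      M = ι (length 𝒜)
      v = pow q d
      μ = M * v

      0≤v : 0ℚ ≤ v
      0≤v = 0≤pow 0≤q d

      sumL-sizes : ∀ {𝒜 : List (Subset n)} → All (λ A → ∣ A ∣ ≡ d) 𝒜 → sumL (λ A → pow q ∣ A ∣) 𝒜 ≡ sumL (λ _ → v) 𝒜
      sumL-sizes []       = refl
      sumL-sizes (e ∷ es) = cong₂ _+_ (cong (pow q) e) (sumL-sizes es)

      mean : E q X ≡ μ
      mean = begin
        E q X  ≡⟨ E-cong q {n} (λ R → ι-filter R 𝒜) ⟩
        E q {n} (λ R → sumL (λ A → sub A R) 𝒜)  ≡⟨ E-sumL q {n} sub 𝒜 ⟩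
        sumL (λ A → E q (sub A)) 𝒜  ≡⟨ sumL-cong (λ A → E-sub q A) 𝒜 ⟩
        sumL (λ A → pow q ∣ A ∣) 𝒜  ≡⟨ sumL-sizes sizes ⟩
        sumL (λ _ → v) 𝒜  ≡⟨ sumL-const v 𝒜 ⟩
        μ  ∎
        where open ≡-Reasoning

      -- For each `A`, the products of the separate probabilities add up to `v * μ`, and the overlap
      -- terms to at most `v * d * Δ` by `sum-∩≤`.
      second : E q {n} (λ R → X R * X R) ≤ μ * μ + ι (length 𝒜 ℕ.* (d ℕ.* Δ)) * v
      second = begin
        E q {n} (λ R → X R * X R)
          ≡⟨ E-cong q {n} (λ R → trans (cong₂ _*_ (ι-filter R 𝒜) (ι-filter R 𝒜)) (square R)) ⟩
        E q {n} (λ R → sumL (λ A → sumL (λ B → sub A R * sub B R) 𝒜) 𝒜)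
          ≡⟨ E-sumL q {n} (λ A R → sumL (λ B → sub A R * sub B R) 𝒜) 𝒜 ⟩
        sumL (λ A → E q {n} (λ R → sumL (λ B → sub A R * sub B R) 𝒜)) 𝒜
          ≡⟨ sumL-cong (λ A → E-sumL q {n} (λ B R → sub A R * sub B R) 𝒜) 𝒜 ⟩
        sumL (λ A → sumL (λ B → E q {n} (λ R → sub A R * sub B R)) 𝒜) 𝒜
          ≤⟨ sumL-mono (All.map (λ {A} → row {A}) sizes) ⟩
        sumL (λ _ → v * μ + v * ι (d ℕ.* Δ)) 𝒜
          ≡⟨ sumL-const _ 𝒜 ⟩
        M * (v * μ + v * ι (d ℕ.* Δ))
          ≡⟨ alg M v μ (ι (d ℕ.* Δ)) ⟩
        M * v * μ + M * ι (d ℕ.* Δ) * v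
          ≡⟨ cong (λ z → μ * μ + z * v) (ι-* (length 𝒜) (d ℕ.* Δ)) ⟨
        μ * μ + ι (length 𝒜 ℕ.* (d ℕ.* Δ)) * v ∎
        where
        open ≤-Reasoning
        alg : ∀ M v μ x → M * (v * μ + v * x) ≡ M * v * μ + M * x * v
        alg = solve-∀ ℚ-ring
        square : ∀ R → sumL (λ A → sub A R) 𝒜 * sumL (λ A → sub A R) 𝒜 ≡ sumL (λ A → sumL (λ B → sub A R * sub B R) 𝒜) 𝒜
        square R = sym (begin-equality
          sumL (λ A → sumL (λ B → sub A R * sub B R) 𝒜) 𝒜  ≡⟨ sumL-cong (λ A → sumL-* (sub A R) (λ B → sub B R) 𝒜) 𝒜 ⟩
          sumL (λ A → sub A R * sumL (λ B → sub B R) 𝒜) 𝒜  ≡⟨ sumL-cong (λ A → *-comm (sub A R) (sumL (λ B → sub B R) 𝒜)) 𝒜 ⟩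
          sumL (λ A → sumL (λ B → sub B R) 𝒜 * sub A R) 𝒜  ≡⟨ sumL-* (sumL (λ B → sub B R) 𝒜) (λ A → sub A R) 𝒜 ⟩
          sumL (λ B → sub B R) 𝒜 * sumL (λ A → sub A R) 𝒜  ∎)
        row : ∀ {A} → ∣ A ∣ ≡ d → sumL (λ B → E q {n} (λ R → sub A R * sub B R)) 𝒜 ≤ v * μ + v * ι (d ℕ.* Δ)
        row {A} eA = begin
          sumL (λ B → E q {n} (λ R → sub A R * sub B R)) 𝒜
            ≤⟨ sumL-mono (All.universal (E-pair 0≤q q≤1 A) 𝒜) ⟩
          sumL (λ B → pow q ∣ A ∣ * pow q ∣ B ∣ + pow q ∣ A ∣ * ι ∣ A ∩ B ∣) 𝒜
            ≡⟨ cong (λ m → sumL (λ B → pow q m * pow q ∣ B ∣ + pow q m * ι ∣ A ∩ B ∣) 𝒜) eA ⟩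
          sumL (λ B → v * pow q ∣ B ∣ + v * ι ∣ A ∩ B ∣) 𝒜
            ≡⟨ trans (sumL-+ (λ B → v * pow q ∣ B ∣) (λ B → v * ι ∣ A ∩ B ∣) 𝒜)
                 (cong₂ _+_ (sumL-* v (λ B → pow q ∣ B ∣) 𝒜) (sumL-* v (λ B → ι ∣ A ∩ B ∣) 𝒜)) ⟩
          v * sumL (λ B → pow q ∣ B ∣) 𝒜 + v * sumL (λ B → ι ∣ A ∩ B ∣) 𝒜
            ≡⟨ cong₂ (λ a b → v * a + v * b) (trans (sumL-sizes sizes) (sumL-const v 𝒜)) (sumL-ι (λ B → ∣ A ∩ B ∣) 𝒜) ⟩
          v * μ + v * ι (ListAction.sum (map (λ B → ∣ A ∩ B ∣) 𝒜))
            ≤⟨ +-monoʳ-≤ (v * μ) (*-monoʳ 0≤v (ι-mono (ℕ.≤-trans (sum-∩≤ Δ 𝒜 deg A) (ℕ.≤-reflexive (cong (ℕ._* Δ) eA))))) ⟩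
          v * μ + v * ι (d ℕ.* Δ) ∎

      variance : E q {n} (λ R → (X R - μ) * (X R - μ)) ≤ ι (length 𝒜 ℕ.* (d ℕ.* Δ)) * v
      variance = begin
        E q {n} (λ R → (X R - μ) * (X R - μ))
          ≡⟨ E-cong q {n} (λ R → expand (X R) μ) ⟩
        E q {n} (λ R → X R * X R + ((- (μ + μ)) * X R + μ * μ))
          ≡⟨ trans (E-+ q {n} (λ R → X R * X R) (λ R → (- (μ + μ)) * X R + μ * μ)) (cong (E q {n} (λ R → X R * X R) +_)
               (trans (E-+ q {n} (λ R → (- (μ + μ)) * X R) (λ _ → μ * μ))
                 (cong₂ _+_ (trans (E-* q {n} (- (μ + μ)) X) (cong ((- (μ + μ)) *_) mean)) (E-const q {n} (μ * μ))))) ⟩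
        E q {n} (λ R → X R * X R) + ((- (μ + μ)) * μ + μ * μ)
          ≤⟨ +-monoˡ-≤ _ second ⟩
        μ * μ + V + ((- (μ + μ)) * μ + μ * μ)
          ≡⟨ collapse μ V ⟩
        V ∎
        where
        open ≤-Reasoning
        V = ι (length 𝒜 ℕ.* (d ℕ.* Δ)) * v
        expand : ∀ x m → (x - m) * (x - m) ≡ x * x + ((- (m + m)) * x + m * m)
        expand = solve-∀ ℚ-ring
        collapse : ∀ m V → m * m + V + ((- (m + m)) * m + m * m) ≡ V
        collapse = solve-∀ ℚ-ring

module Probability where

  open import Data.Bool.Base using (Bool; true; false; if_then_else_)
  open import Data.Empty using (⊥-elim)
  open import Data.Fin.Subset using (Subset; inside; outside) renaming (∣_∣ to size)
  open import Data.Fin.Subset.Properties using (_⊆?_; _∈?_)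
  open import Data.Integer.Base as ℤ using ()
  import Data.Integer.Properties as ℤ
  open import Data.List.Base using (List; []; _∷_; _++_; length; map; filter; foldr)
  open import Data.List.Relation.Unary.All as All using (All; []; _∷_)
  open import Data.Nat.Base as ℕ using (ℕ; zero; suc; z≤n; s≤s)
  import Data.Nat.DivMod as ℕ
  import Data.Nat.Properties as ℕ
  import Data.Nat.Tactic.RingSolver as ℕSolver
  open import Data.Product using (∃; _×_; _,_; proj₁; proj₂)
  open import Data.Rational
  open import Data.Rational.Properties
  import Data.Rational.Unnormalised.Base as ℚᵘ
  import Data.Rational.Unnormalised.Properties as ℚᵘ
  open import Data.Sum.Base using (_⊎_; inj₁; inj₂)
  open import Data.Vec.Base using ([]; _∷_)
  open import Relation.Binary.PropositionalEquality
  open import Relation.Nullary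
  open import Tactic.RingSolver using (solve-∀)
  open Combinatorics using (module Partitions; module Model)
  open RandomSubsets using (module Rationals; module Expectation)

  -- Lipschitz bounds for polynomials in the probability.

  module Approximation where

    open Rationals
    open Expectation using (E)

    ι-cancel : ∀ m → ι (suc m) * (ℤ.+ 1 / suc m) ≡ 1ℚ
    ι-cancel m = toℚᵘ-injective (ℚᵘ.≃-trans (toℚᵘ-homo-* (ι (suc m)) (ℤ.+ 1 / suc m))
      (ℚᵘ.≃-trans (ℚᵘ.*-cong (toℚᵘ-ι (suc m)) (toℚᵘ-fromℚᵘ (ℚᵘ.mkℚᵘ (ℤ.+ 1) m)))
        (ℚᵘ.*≡* (cong ℤ.+_ eq))))
      where
      eq : suc m ℕ.* 1 ℕ.* 1 ≡ 1 ℕ.* (1 ℕ.* suc m)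
      eq = trans (ℕ.*-identityʳ (suc m ℕ.* 1)) (trans (ℕ.*-comm (suc m) 1) (sym (ℕ.*-identityˡ (1 ℕ.* suc m))))

    recip : ℕ → ℚ
    recip m = ℤ.+ 1 / suc m

    0<recip : ∀ m → 0ℚ < recip m
    0<recip m = positive⁻¹ (recip m) {{normalize-pos 1 (suc m)}}

    -- The denominator of `e` serves, since the numerator is at least 1.
    archimedean : ∀ e → 0ℚ < e → ∃ λ D → 1ℚ ≤ e * ι D
    archimedean e 0<e with positive 0<e
    archimedean e@(mkℚ (ℤ.+ suc a) b c) 0<e | _ = suc b , subst (1ℚ ≤_) (sym e*b) (ι-mono {1} {suc a} (s≤s z≤n))
      where
      e*b : e * ι (suc b) ≡ ι (suc a)
      e*b = toℚᵘ-injective (ℚᵘ.≃-trans (toℚᵘ-homo-* e (ι (suc b)))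
        (ℚᵘ.≃-trans (ℚᵘ.*-cong (ℚᵘ.≃-refl {toℚᵘ e}) (toℚᵘ-ι (suc b)))
          (ℚᵘ.≃-trans (ℚᵘ.*≡* (trans (ℤ.*-identityʳ _) (cong (ℤ.+ suc a ℤ.*_) (sym (ℤ.*-identityʳ (ℤ.+ suc b))))))
            (ℚᵘ.≃-sym (toℚᵘ-ι (suc a))))))

    neg-involutive : ∀ a → - (- a) ≡ a
    neg-involutive = solve-∀ ℚ-ring

    ∣∣-bounds : ∀ {a b} → ∣ a ∣ ≤ b → (- b ≤ a) × (a ≤ b)
    ∣∣-bounds {a} {b} h = lower , ≤-trans (p≤∣p∣ a) h
      where
      p≤∣p∣ : ∀ a → a ≤ ∣ a ∣
      p≤∣p∣ a with ≤-total 0ℚ a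
      ... | inj₁ 0≤a = ≤-reflexive (sym (0≤p⇒∣p∣≡p 0≤a))
      ... | inj₂ a≤0 = ≤-trans a≤0 (0≤∣p∣ a)
      lower : - b ≤ a
      lower = subst (- b ≤_) (neg-involutive a) (neg-antimono-≤ (≤-trans (p≤∣p∣ (- a)) (≤-trans (≤-reflexive (∣-p∣≡∣p∣ a)) h)))

    ∣∣-intro : ∀ {a b} → - b ≤ a → a ≤ b → ∣ a ∣ ≤ b
    ∣∣-intro {a} {b} l u with ∣p∣≡p∨∣p∣≡-p a
    ... | inj₁ e = subst (_≤ b) (sym e) u
    ... | inj₂ e = subst (_≤ b) (sym e) (subst (- a ≤_) (neg-involutive b) (neg-antimono-≤ l))

    ∣∣-* : ∀ {a b c d} → ∣ a ∣ ≤ c → ∣ b ∣ ≤ d → ∣ a * b ∣ ≤ c * d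
    ∣∣-* {a} {b} {c} {d} p q = ≤-trans (≤-reflexive (∣p*q∣≡∣p∣*∣q∣ a b))
      (*-mono (≤-trans (0≤∣p∣ a) p) (0≤∣p∣ b) p q)

    ∣∣-+ : ∀ {a b c d} → ∣ a ∣ ≤ c → ∣ b ∣ ≤ d → ∣ a + b ∣ ≤ c + d
    ∣∣-+ {a} {b} p q = ≤-trans (∣p+q∣≤∣p∣+∣q∣ a b) (+-mono-≤ p q)

    2ℚ : ℚ
    2ℚ = 1ℚ + 1ℚ

    -- The range is up to 2 because the approximants of `p` come within 1 of a `q` that is at most
    -- 1. Boundedness is included since the Lipschitz constant of a product depends on it.
    record Smooth (L : ℚ) (g : ℚ → ℚ) : Set where
      field
        bounded   : ∀ {p} → ∣ p ∣ ≤ 2ℚ → ∣ g p ∣ ≤ L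
        lipschitz : ∀ {p q} → ∣ p ∣ ≤ 2ℚ → ∣ q ∣ ≤ 2ℚ → ∣ g p - g q ∣ ≤ L * ∣ p - q ∣

      0≤L : 0ℚ ≤ L
      0≤L = ≤-trans (0≤∣p∣ (g 0ℚ)) (bounded {0ℚ} (+-mono-≤ (nonNegative⁻¹ 1ℚ) (nonNegative⁻¹ 1ℚ)))

    open Smooth

    smooth-const : ∀ {L c} → ∣ c ∣ ≤ L → Smooth L (λ _ → c)
    smooth-const {L} {c} h = record
      { bounded   = λ _ → h
      ; lipschitz = λ {p} {q} _ _ → ≤-trans (≤-reflexive (cong ∣_∣ (+-inverseʳ c))) (0≤* (≤-trans (0≤∣p∣ c) h) (0≤∣p∣ (p - q)))
      }

    smooth-id : Smooth 2ℚ (λ p → p)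
    smooth-id = record
      { bounded   = λ h → h
      ; lipschitz = λ {p} {q} _ _ → ≤-trans (≤-reflexive (sym (*-identityˡ ∣ p - q ∣)))
          (*-monoʳ-≤-nonNeg ∣ p - q ∣ {{∣-∣-nonNeg (p - q)}} (+-mono-≤ (nonNegative⁻¹ 1ℚ) (≤-refl {1ℚ})))
      }

    smooth-+ : ∀ {K L f g} → Smooth K f → Smooth L g → Smooth (K + L) (λ p → f p + g p)
    smooth-+ {K} {L} {f} {g} F G = record
      { bounded   = λ h → ∣∣-+ (bounded F h) (bounded G h)
      ; lipschitz = λ {p} {q} h k → subst₂ _≤_ (cong ∣_∣ (alg (f p) (f q) (g p) (g q)))
          (sym (*-distribʳ-+ ∣ p - q ∣ K L)) (∣∣-+ (lipschitz F h k) (lipschitz G h k))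
      }
      where
      alg : ∀ a b c d → (a - b) + (c - d) ≡ a + c - (b + d)
      alg = solve-∀ ℚ-ring

    smooth-* : ∀ {K L f g} → Smooth K f → Smooth L g → Smooth (K * L + K * L) (λ p → f p * g p)
    smooth-* {K} {L} {f} {g} F G = record
      { bounded   = λ h → ≤-trans (∣∣-* (bounded F h) (bounded G h))
          (≤-trans (≤-reflexive (sym (+-identityʳ (K * L)))) (+-monoʳ-≤ (K * L) (0≤* (0≤L F) (0≤L G))))
      ; lipschitz = λ {p} {q} h k → subst₂ _≤_ (cong ∣_∣ (alg (f p) (f q) (g p) (g q))) (alg₂ K L ∣ p - q ∣)
          (∣∣-+ (∣∣-* (bounded F h) (lipschitz G h k)) (∣∣-* (lipschitz F h k) (bounded G k)))
      }
      where
      alg : ∀ a b c d → a * (c - d) + (a - b) * d ≡ a * c - b * d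
      alg = solve-∀ ℚ-ring
      alg₂ : ∀ K L x → K * (L * x) + K * x * L ≡ (K * L + K * L) * x
      alg₂ = solve-∀ ℚ-ring

    smooth-neg : ∀ {L g} → Smooth L g → Smooth L (λ p → - g p)
    smooth-neg {L} {g} G = record
      { bounded   = λ {p} h → ≤-trans (≤-reflexive (∣-p∣≡∣p∣ (g p))) (bounded G h)
      ; lipschitz = λ {p} {q} h k → ≤-trans (≤-reflexive (trans (cong ∣_∣ (alg (g p) (g q))) (∣-p∣≡∣p∣ (g p - g q)))) (lipschitz G h k)
      }
      where
      alg : ∀ a b → - a - - b ≡ - (a - b)
      alg = solve-∀ ℚ-ring

    powL : ℕ → ℚ
    powL zero    = 1ℚ
    powL (suc d) = 2ℚ * powL d + 2ℚ * powL d

    smooth-pow : ∀ d → Smooth (powL d) (λ p → pow p d)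
    smooth-pow zero    = smooth-const ≤-refl
    smooth-pow (suc d) = smooth-* smooth-id (smooth-pow d)

    -- The constant that the rules for sums and products yield along the recursion of `E`. Its size
    -- is irrelevant, as the distance from `p` to `q` is chosen with `n` already known.
    EL : ℕ → ℚ
    EL zero    = 1ℚ
    EL (suc n) = ((1ℚ + 2ℚ) * EL n + (1ℚ + 2ℚ) * EL n) + (2ℚ * EL n + 2ℚ * EL n)

    smooth-E : ∀ {n} (f : Subset n → ℚ) → (∀ R → ∣ f R ∣ ≤ 1ℚ) → Smooth (EL n) (λ p → E p f)
    smooth-E {zero}  f h = smooth-const (h [])
    smooth-E {suc n} f h = smooth-+
      (smooth-* (smooth-+ (smooth-const {1ℚ} {1ℚ} ≤-refl) (smooth-neg smooth-id)) (smooth-E (λ R → f (outside ∷ R)) (λ R → h (outside ∷ R))))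
      (smooth-* smooth-id (smooth-E (λ R → f (inside ∷ R)) (λ R → h (inside ∷ R))))

    halve : ∀ {ε} → 0ℚ < ε → ∃ λ η → (0ℚ < η) × (η + η ≡ ε)
    halve {ε} 0<ε = ½ * ε , positive⁻¹ (½ * ε) {{pos*pos⇒pos ½ ε {{positive 0<ε}}}} ,
      trans (sym (*-distribʳ-+ ε ½ ½)) (*-identityˡ ε)

  -- Rational approximants of real probabilities.

  module RealSequences where

    open import Defs as ℝ using (ℝ; 0ℝ; 1ℝ; prob; subsets; weight)
    open ℝ.ℝ
    open Rationals
    open Expectation
    open Approximation

    seq-^ : ∀ p d m → seq (p ℝ.^ d) m ≡ pow (seq p m) d
    seq-^ p zero    m = refl
    seq-^ p (suc d) m = cong (seq p m *_) (seq-^ p d m)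

    indicator : Bool → ℚ
    indicator b = if b then 1ℚ else 0ℚ

    -- An exact identity for every `m`, because real arithmetic acts termwise on approximants. It
    -- reduces statements about `prob` to the polynomial `E`.
    seq-prob : ∀ {n} p (F : Subset n → Bool) m → seq (prob p F) m ≡ E (seq p m) (λ R → indicator (F R))
    seq-prob {n} p F m = trans (unfold (subsets n)) (weighted n (λ R → indicator (F R)))
      where
      total : ∀ {n} → (Subset n → ℚ) → List (Subset n) → ℚ
      total g = sumL (λ R → seq (weight p R) m * g R)
      unfold : ∀ xs → seq (foldr (λ R s → (if F R then weight p R else 0ℝ) ℝ.+ s) 0ℝ xs) m ≡ total (λ R → indicator (F R)) xs
      unfold []       = refl
      unfold (R ∷ xs) = cong₂ _+_ (term (F R)) (unfold xs)
        where
        term : ∀ b → seq (if b then weight p R else 0ℝ) m ≡ seq (weight p R) m * indicator b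
        term true  = sym (*-identityʳ _)
        term false = sym (*-zeroʳ (seq (weight p R) m))
      total-++ : ∀ {n} (g : Subset n → ℚ) xs ys → total g (xs ++ ys) ≡ total g xs + total g ys
      total-++ g []       ys = sym (+-identityˡ _)
      total-++ g (x ∷ xs) ys = trans (cong (seq (weight p x) m * g x +_) (total-++ g xs ys))
        (sym (+-assoc (seq (weight p x) m * g x) (total g xs) (total g ys)))
      total-∷ : ∀ {n} c b (g : Subset (suc n) → ℚ) → (∀ R → seq (weight p (b ∷ R)) m ≡ c * seq (weight p R) m) →
                ∀ xs → total g (map (b ∷_) xs) ≡ c * total (λ R → g (b ∷ R)) xs
      total-∷ c b g h []       = sym (*-zeroʳ c)
      total-∷ c b g h (R ∷ xs) = trans
        (cong₂ _+_ (trans (cong (_* g (b ∷ R)) (h R)) (*-assoc c (seq (weight p R) m) (g (b ∷ R)))) (total-∷ c b g h xs))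
        (sym (*-distribˡ-+ c (seq (weight p R) m * g (b ∷ R)) (total (λ R → g (b ∷ R)) xs)))
      weighted : ∀ n (g : Subset n → ℚ) → total g (subsets n) ≡ E (seq p m) g
      weighted zero    g = trans (+-identityʳ _) (*-identityˡ (g []))
      weighted (suc n) g = trans (total-++ g (map (outside ∷_) (subsets n)) (map (inside ∷_) (subsets n)))
        (cong₂ _+_
          (trans (total-∷ (1ℚ - seq p m) outside g (λ _ → refl) (subsets n)) (cong ((1ℚ - seq p m) *_) (weighted n (λ R → g (outside ∷ R)))))
          (trans (total-∷ (seq p m) inside g (λ _ → refl) (subsets n)) (cong (seq p m *_) (weighted n (λ R → g (inside ∷ R))))))

    -- An approximant of `p` may lie slightly outside the interval from 0 to 1. Clamping it yields a
    -- genuine probability, which `E-mono` and `pow-anti` need; the Cauchy property and the clamping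
    -- cost half of `θ` each.
    near : ∀ p → 0ℝ ℝ.≤ p → p ℝ.≤ 1ℝ → ∀ θ → 0ℚ < θ →
           ∃ λ q → (0ℚ ≤ q) × (q ≤ 1ℚ) × ∃ λ N → ∀ m → N ℕ.≤ m → ∣ seq p m - q ∣ ≤ θ
    near p 0≤p p≤1 θ 0<θ =
      let (η , 0<η , 2η≡θ) = halve 0<θ
          (N₁ , c)         = cauchy p η 0<η
          (N₂ , lo)        = 0≤p η 0<η
          (N₃ , hi)        = p≤1 η 0<η
          N                = N₁ ℕ.⊔ (N₂ ℕ.⊔ N₃)
          (q , 0≤q , q≤1 , close) = clamp (seq p N) η (<⇒≤ 0<η)
            (lo N (ℕ.≤-trans (ℕ.m≤m⊔n N₂ N₃) (ℕ.m≤n⊔m N₁ (N₂ ℕ.⊔ N₃)))) (hi N (ℕ.≤-trans (ℕ.m≤n⊔m N₂ N₃) (ℕ.m≤n⊔m N₁ (N₂ ℕ.⊔ N₃))))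
      in q , 0≤q , q≤1 , N , λ m N≤m → subst₂ _≤_ (cong ∣_∣ (alg (seq p m) (seq p N) q)) 2η≡θ
           (∣∣-+ (c m N (ℕ.≤-trans (ℕ.m≤m⊔n N₁ (N₂ ℕ.⊔ N₃)) N≤m) (ℕ.m≤m⊔n N₁ (N₂ ℕ.⊔ N₃))) close)
      where
      alg : ∀ a b q → (a - b) + (b - q) ≡ a - q
      alg = solve-∀ ℚ-ring
      clamp : ∀ x η → 0ℚ ≤ η → 0ℚ ≤ x + η → x ≤ 1ℚ + η → ∃ λ q → (0ℚ ≤ q) × (q ≤ 1ℚ) × ∣ x - q ∣ ≤ η
      clamp x η 0≤η lo hi = choose (≤-total 0ℚ x) (≤-total x 1ℚ)
        where
        alg₁ : ∀ x η → x + η + (- η) ≡ x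
        alg₁ = solve-∀ ℚ-ring
        alg₂ : ∀ x o η → o + η - x ≡ η - (x - o)
        alg₂ = solve-∀ ℚ-ring
        choose : (0ℚ ≤ x) ⊎ (x ≤ 0ℚ) → (x ≤ 1ℚ) ⊎ (1ℚ ≤ x) → ∃ λ q → (0ℚ ≤ q) × (q ≤ 1ℚ) × ∣ x - q ∣ ≤ η
        choose (inj₁ 0≤x) (inj₁ x≤1) = x , 0≤x , x≤1 , subst (_≤ η) (sym (cong ∣_∣ (+-inverseʳ x))) 0≤η
        choose (inj₂ x≤0) _ = 0ℚ , ≤-refl , nonNegative⁻¹ 1ℚ , subst (λ z → ∣ z ∣ ≤ η) (sym (+-identityʳ x))
          (∣∣-intro (subst₂ _≤_ (+-identityˡ (- η)) (alg₁ x η) (+-monoˡ-≤ (- η) lo)) (≤-trans x≤0 0≤η))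
        choose (inj₁ _) (inj₂ 1≤x) = 1ℚ , nonNegative⁻¹ 1ℚ , ≤-refl , subst (_≤ η) (sym (0≤p⇒∣p∣≡p (≤⇒0≤- 1≤x)))
          (0≤-⇒≤ (subst (0ℚ ≤_) (alg₂ x 1ℚ η) (≤⇒0≤- hi)))

  -- Order properties of the Cauchy reals.

  module RealOrder where

    open import Defs as ℝ using (ℝ; 0ℝ; 1ℝ; fromℕ)
    open ℝ.ℝ
    open Rationals
    open Approximation

    -- The choice `θ = x / (1 + A)` gives `θ + A θ = x` and avoids dividing by a possible zero.
    small : ∀ A x → 0ℚ ≤ A → 0ℚ < x → ∃ λ θ → (0ℚ < θ) × (A * θ ≤ x) × (θ ≤ x)
    small A x 0≤A 0<x = θ , 0<θ , Aθ≤x , θ≤x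
      where
      instance
        1+A-pos : Positive (1ℚ + A)
        1+A-pos = positive (+-mono-<-≤ (positive⁻¹ 1ℚ) 0≤A)
        1+A-nonZero : NonZero (1ℚ + A)
        1+A-nonZero = pos⇒nonZero (1ℚ + A)
      θ = x * 1/ (1ℚ + A)
      0<θ : 0ℚ < θ
      0<θ = positive⁻¹ θ {{pos*pos⇒pos x {{positive 0<x}} (1/ (1ℚ + A)) {{1/pos⇒pos (1ℚ + A)}}}}
      x≡ : θ + A * θ ≡ x
      x≡ = begin
        θ + A * θ  ≡⟨ cong (_+ A * θ) (*-identityˡ θ) ⟨
        1ℚ * θ + A * θ  ≡⟨ *-distribʳ-+ θ 1ℚ A ⟨
        (1ℚ + A) * (x * 1/ (1ℚ + A))  ≡⟨ alg (1ℚ + A) x (1/ (1ℚ + A)) ⟩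
        x * ((1ℚ + A) * 1/ (1ℚ + A))  ≡⟨ cong (x *_) (*-inverseʳ (1ℚ + A)) ⟩
        x * 1ℚ  ≡⟨ *-identityʳ x ⟩
        x  ∎
        where
        open ≡-Reasoning
        alg : ∀ a x y → a * (x * y) ≡ x * (a * y)
        alg = solve-∀ ℚ-ring
      Aθ≤x : A * θ ≤ x
      Aθ≤x = subst₂ _≤_ (+-identityˡ (A * θ)) x≡ (+-monoˡ-≤ (A * θ) (<⇒≤ 0<θ))
      θ≤x : θ ≤ x
      θ≤x = subst₂ _≤_ (+-identityʳ θ) x≡ (+-monoʳ-≤ θ (0≤* 0≤A (<⇒≤ 0<θ)))

    ≤ℝ-pointwise : ∀ {x y} → (∀ m → seq x m ≤ seq y m) → x ℝ.≤ y
    ≤ℝ-pointwise {x} {y} h ε 0<ε = 0 , λ m _ →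
      ≤-trans (h m) (subst (_≤ seq y m + ε) (+-identityʳ _) (+-monoʳ-≤ (seq y m) (<⇒≤ 0<ε)))

    ≤ℝ-trans : ∀ {x y z} → x ℝ.≤ y → y ℝ.≤ z → x ℝ.≤ z
    ≤ℝ-trans {x} {y} {z} p q ε 0<ε =
      let (η , 0<η , 2η≡ε) = halve 0<ε
          (M , f)          = p η 0<η
          (N , g)          = q η 0<η
      in M ℕ.⊔ N , λ m le → begin
        seq x m  ≤⟨ f m (ℕ.m⊔n≤o⇒m≤o M N le) ⟩
        seq y m + η  ≤⟨ +-monoˡ-≤ η (g m (ℕ.m⊔n≤o⇒n≤o M N le)) ⟩
        seq z m + η + η  ≡⟨ trans (+-assoc (seq z m) η η) (cong (seq z m +_) 2η≡ε) ⟩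
        seq z m + ε  ∎
      where open ≤-Reasoning

    ≤ℝ-linear : ∀ {x y u v} → (∀ m → seq y m - seq x m ≡ seq v m - seq u m) → x ℝ.≤ y → u ℝ.≤ v
    ≤ℝ-linear {x} {y} {u} {v} h p ε 0<ε with p ε 0<ε
    ... | N , f = N , λ m N≤m → 0≤-⇒≤ (subst (0ℚ ≤_) (alg (seq x m) (seq y m) (seq u m) (seq v m) (h m)) (≤⇒0≤- (f m N≤m)))
      where
      shift : ∀ a b c → b + c - a ≡ (b - a) + c
      shift = solve-∀ ℚ-ring
      alg : ∀ a b c d → b - a ≡ d - c → b + ε - a ≡ d + ε - c
      alg a b c d e = trans (shift a b ε) (trans (cong (_+ ε) e) (sym (shift c d ε)))

    boundedℝ : ∀ x → ∃ λ B → (0ℚ ≤ B) × ∃ λ N → ∀ m → N ℕ.≤ m → ∣ seq x m ∣ ≤ B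
    boundedℝ x with cauchy x 1ℚ (positive⁻¹ 1ℚ)
    ... | N , f = 1ℚ + ∣ seq x N ∣ , +-mono-≤ (nonNegative⁻¹ 1ℚ) (0≤∣p∣ (seq x N)) , N , λ m N≤m →
      subst (λ z → ∣ z ∣ ≤ 1ℚ + ∣ seq x N ∣) (alg (seq x m) (seq x N)) (∣∣-+ (f m N N≤m ℕ.≤-refl) (≤-refl {∣ seq x N ∣}))
      where
      alg : ∀ a b → a - b + b ≡ a
      alg = solve-∀ ℚ-ring

    -- The approximants `u` and `w` are only known to be at least `- θ`, so the non-negative product
    -- is that of `u + θ` and `w + θ`; the upper bounds `A` and `B` control the error
    -- `(u + w + θ) θ`.
    0≤ℝ* : ∀ {x y} → 0ℝ ℝ.≤ x → 0ℝ ℝ.≤ y → 0ℝ ℝ.≤ x ℝ.* y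
    0≤ℝ* {x} {y} 0≤x 0≤y ε 0<ε =
      let (A , 0≤A , N₁ , a) = boundedℝ x
          (B , 0≤B , N₂ , b) = boundedℝ y
          (θ , 0<θ , Cθ≤ , θ≤) = small (A + B + 1ℚ) (ε ⊓ 1ℚ) (+-mono-≤ (+-mono-≤ 0≤A 0≤B) (nonNegative⁻¹ 1ℚ)) 0<ε⊓1
          (N₃ , f) = 0≤x θ 0<θ
          (N₄ , g) = 0≤y θ 0<θ
      in (N₁ ℕ.⊔ N₂) ℕ.⊔ (N₃ ℕ.⊔ N₄) , λ m le →
        let l₁₂ = ℕ.m⊔n≤o⇒m≤o (N₁ ℕ.⊔ N₂) (N₃ ℕ.⊔ N₄) le
            l₃₄ = ℕ.m⊔n≤o⇒n≤o (N₁ ℕ.⊔ N₂) (N₃ ℕ.⊔ N₄) le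
        in bound (seq x m) (seq y m) A B θ 0<θ Cθ≤ θ≤
             (proj₂ (∣∣-bounds (a m (ℕ.m⊔n≤o⇒m≤o N₁ N₂ l₁₂)))) (proj₂ (∣∣-bounds (b m (ℕ.m⊔n≤o⇒n≤o N₁ N₂ l₁₂))))
             (f m (ℕ.m⊔n≤o⇒m≤o N₃ N₄ l₃₄)) (g m (ℕ.m⊔n≤o⇒n≤o N₃ N₄ l₃₄))
      where
      0<ε⊓1 : 0ℚ < ε ⊓ 1ℚ
      0<ε⊓1 with ⊓-sel ε 1ℚ
      ... | inj₁ e = subst (0ℚ <_) (sym e) 0<ε
      ... | inj₂ e = subst (0ℚ <_) (sym e) (positive⁻¹ 1ℚ)
      alg : ∀ u w θ → (u + θ) * (w + θ) ≡ u * w + (u + w + θ) * θ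
      alg = solve-∀ ℚ-ring
      bound : ∀ u w A B θ → 0ℚ < θ → (A + B + 1ℚ) * θ ≤ ε ⊓ 1ℚ → θ ≤ ε ⊓ 1ℚ → u ≤ A → w ≤ B →
              0ℚ ≤ u + θ → 0ℚ ≤ w + θ → 0ℚ ≤ u * w + ε
      bound u w A B θ 0<θ Cθ≤ θ≤ u≤A w≤B 0≤u 0≤w = begin
        0ℚ  ≤⟨ 0≤* 0≤u 0≤w ⟩
        (u + θ) * (w + θ)  ≡⟨ alg u w θ ⟩
        u * w + (u + w + θ) * θ  ≤⟨ +-monoʳ-≤ (u * w) (*-monoʳ-≤-nonNeg θ {{nonNegative (<⇒≤ 0<θ)}}
                                               (+-mono-≤ (+-mono-≤ u≤A w≤B) (≤-trans θ≤ (p⊓q≤q ε 1ℚ)))) ⟩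
        u * w + (A + B + 1ℚ) * θ  ≤⟨ +-monoʳ-≤ (u * w) (≤-trans Cθ≤ (p⊓q≤p ε 1ℚ)) ⟩
        u * w + ε  ∎
        where open ≤-Reasoning

    *ℝ-monoʳ : ∀ {x y z} → 0ℝ ℝ.≤ z → x ℝ.≤ y → z ℝ.* x ℝ.≤ z ℝ.* y
    *ℝ-monoʳ {x} {y} {z} 0≤z x≤y = ≤ℝ-linear {0ℝ} {z ℝ.* (y ℝ.- x)} {z ℝ.* x} {z ℝ.* y}
      (λ m → trans (+-identityʳ _) (alg (seq x m) (seq y m) (seq z m)))
      (0≤ℝ* {z} {y ℝ.- x} 0≤z (≤ℝ-linear {x} {y} {0ℝ} {y ℝ.- x} (λ m → sym (+-identityʳ _)) x≤y))
      where
      alg : ∀ x y z → z * (y - x) ≡ z * y - z * x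
      alg = solve-∀ ℚ-ring

    0≤ℝ^ : ∀ {x} d → 0ℝ ℝ.≤ x → 0ℝ ℝ.≤ x ℝ.^ d
    0≤ℝ^ zero    0≤x = ≤ℝ-pointwise {0ℝ} {1ℝ} (λ _ → nonNegative⁻¹ 1ℚ)
    0≤ℝ^ {x} (suc d) 0≤x = 0≤ℝ* {x} {x ℝ.^ d} 0≤x (0≤ℝ^ d 0≤x)

    0≤fromℕ : ∀ k → 0ℝ ℝ.≤ fromℕ k
    0≤fromℕ k = ≤ℝ-pointwise {0ℝ} {fromℕ k} (λ _ → 0≤ι k)

    -- If `∣ x ∣` exceeded `y + ε`, squaring would contradict the hypothesis. As `ε = 4 η`, the term
    -- `ε * ε` equals `4 ε η`; half of it makes the cross term `2 ε (y + η)` non-negative even if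
    -- `y` drops to `- η`, and the other half beats `η * η`.
    square-gap : ∀ {ε δ η x y} → 0ℚ < η → η + η ≡ δ → δ + δ ≡ ε → 0ℚ ≤ y + η →
                 x * x ≤ y * y + η * η → ∣ x ∣ ≤ y + ε
    square-gap {ε} {δ} {η} {x} {y} 0<η eδ eε 0≤y+η xx≤ = ≮⇒≥ λ y+ε<x → <-irrefl refl (begin-strict
        x * x  ≤⟨ xx≤ ⟩
        y * y + η * η  <⟨ +-monoʳ-< (y * y) gap ⟩
        y * y + (ε * (y + η) + ε * (y + η) + (ε * η + ε * η)) ≡⟨ alg₁ y ε η ⟩
        y * y + (ε * y + ε * y) + ε * (η + η + (η + η)) ≡⟨ cong (λ z → y * y + (ε * y + ε * y) + ε * z) (trans (cong₂ _+_ eδ eδ) eε) ⟩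
        y * y + (ε * y + ε * y) + ε * ε  ≡⟨ alg₂ y ε ⟩
        (y + ε) * (y + ε)  ≤⟨ *-mono (0≤∣p∣ x) (≤-trans 0≤y+η (+-monoʳ-≤ y η≤ε)) (<⇒≤ y+ε<x) (<⇒≤ y+ε<x) ⟩
        ∣ x ∣ * ∣ x ∣  ≡⟨ trans (sym (∣p*q∣≡∣p∣*∣q∣ x x)) (0≤p⇒∣p∣≡p (0≤square x)) ⟩
        x * x  ∎)
      where
      open ≤-Reasoning
      alg₁ : ∀ w ε η → w * w + (ε * (w + η) + ε * (w + η) + (ε * η + ε * η)) ≡ w * w + (ε * w + ε * w) + ε * (η + η + (η + η))
      alg₁ = solve-∀ ℚ-ring
      alg₂ : ∀ w ε → w * w + (ε * w + ε * w) + ε * ε ≡ (w + ε) * (w + ε)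
      alg₂ = solve-∀ ℚ-ring
      η<δ : η < δ
      η<δ = subst₂ _<_ (+-identityʳ η) eδ (+-monoʳ-< η 0<η)
      0<δ : 0ℚ < δ
      0<δ = <-trans 0<η η<δ
      δ<ε : δ < ε
      δ<ε = subst₂ _<_ (+-identityʳ δ) eε (+-monoʳ-< δ 0<δ)
      η≤ε : η ≤ ε
      η≤ε = <⇒≤ (<-trans η<δ δ<ε)
      0≤ε : 0ℚ ≤ ε
      0≤ε = ≤-trans (<⇒≤ 0<η) η≤ε
      gap : η * η < ε * (y + η) + ε * (y + η) + (ε * η + ε * η)
      gap = begin-strict
        η * η  <⟨ *-monoˡ-<-pos η {{positive 0<η}} (<-trans η<δ δ<ε) ⟩
        ε * η  ≡⟨ +-identityʳ (ε * η) ⟨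
        ε * η + 0ℚ  ≤⟨ +-monoʳ-≤ (ε * η) (0≤* 0≤ε (<⇒≤ 0<η)) ⟩
        ε * η + ε * η  ≡⟨ +-identityˡ _ ⟨
        0ℚ + (ε * η + ε * η)  ≤⟨ +-monoˡ-≤ (ε * η + ε * η) (+-mono-≤ (0≤* 0≤ε 0≤y+η) (0≤* 0≤ε 0≤y+η)) ⟩
        ε * (y + η) + ε * (y + η) + (ε * η + ε * η) ∎

    square≤⇒abs≤ : ∀ {x y} → 0ℝ ℝ.≤ y → x ℝ.* x ℝ.≤ y ℝ.* y → ℝ.abs x ℝ.≤ y
    square≤⇒abs≤ {x} {y} 0≤y xx≤yy ε 0<ε =
      let (δ , 0<δ , eε) = halve 0<ε
          (η , 0<η , eδ) = halve 0<δ
          (M , f) = 0≤y η 0<η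
          (N , g) = xx≤yy (η * η) (positive⁻¹ (η * η) {{pos*pos⇒pos η {{positive 0<η}} η {{positive 0<η}}}})
      in M ℕ.⊔ N , λ m le → square-gap {ε} {δ} {η} {seq x m} {seq y m} 0<η eδ eε
           (f m (ℕ.m⊔n≤o⇒m≤o M N le)) (g m (ℕ.m⊔n≤o⇒n≤o M N le))

  -- Markov's and Chebyshev's inequalities, transferred to a real probability.

  module Concentration where

    open import Defs as ℝ using (ℝ; 0ℝ; 1ℝ; fromℕ; prob)
    open ℝ.ℝ
    open Rationals
    open Expectation
    open Approximation
    open RealSequences
    open RealOrder

    does-true : ∀ {A : Set} (a? : Dec A) → does a? ≡ true → A
    does-true (yes a) _ = a

    does-false : ∀ {A : Set} (a? : Dec A) → does a? ≡ false → ¬ A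
    does-false (no ¬a) _ = ¬a

    -- `F` is the good event; the expectation is taken of the pointwise bound of `g` from below by
    -- `B` times the indicator of its failure.
    markov : ∀ {q} → 0ℚ ≤ q → q ≤ 1ℚ → ∀ {n} (g : Subset n → ℚ) (F : Subset n → Bool) B →
             (∀ R → 0ℚ ≤ g R) → (∀ R → F R ≡ false → B ≤ g R) → B * (1ℚ - E q (λ R → indicator (F R))) ≤ E q g
    markov {q} 0≤q q≤1 {n} g F B 0≤g B≤g = begin
      B * (1ℚ - E q (λ R → indicator (F R)))
        ≡⟨ expand B 1ℚ (E q (λ R → indicator (F R))) ⟩
      B * 1ℚ + (- B) * E q (λ R → indicator (F R))
        ≡⟨ cong₂ _+_ (E-const q {n} (B * 1ℚ)) (E-* q (- B) (λ R → indicator (F R))) ⟨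
      E q {n} (λ _ → B * 1ℚ) + E q (λ R → (- B) * indicator (F R))
        ≡⟨ E-+ q (λ _ → B * 1ℚ) (λ R → (- B) * indicator (F R)) ⟨
      E q (λ R → B * 1ℚ + (- B) * indicator (F R))
        ≤⟨ E-mono q 0≤q q≤1 (λ R → case R (F R) refl) ⟩
      E q g ∎
      where
      open ≤-Reasoning
      expand : ∀ B o e → B * (o - e) ≡ B * o + (- B) * e
      expand = solve-∀ ℚ-ring
      case : ∀ R b → F R ≡ b → B * 1ℚ + (- B) * indicator b ≤ g R
      case R true  e = ≤-trans (≤-reflexive (trans (sym (expand B 1ℚ 1ℚ)) (trans (cong (B *_) (+-inverseʳ 1ℚ)) (*-zeroʳ B)))) (0≤g R)
      case R false e = ≤-trans (≤-reflexive (trans (cong₂ _+_ (*-identityʳ B) (*-zeroʳ (- B))) (+-identityʳ B))) (B≤g R e)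

    -- For the count 0 the deviation is `τ S`. As `τ ≤ 3 η ≤ 1`, its square is at most `S² τ`, up to
    -- a multiple of `θ` because the approximant `τ` may be as low as `- θ`.
    sparse-close : ∀ {τ t η θ δ S Q} → ∣ τ - t ∣ ≤ η → t ≤ η + η → η + η + η ≤ 1ℚ → 0ℚ < θ → θ ≤ 1ℚ →
                   0ℚ ≤ τ + θ → 0ℚ ≤ Q → S * S ≤ Q → (Q + Q) * θ ≤ δ →
                   (0ℚ - τ * S) * (0ℚ - τ * S) ≤ Q * τ + δ
    sparse-close {τ} {t} {η} {θ} {δ} {S} {Q} near t≤2η 3η≤1 0<θ θ≤1 0≤τ+θ 0≤Q SS≤Q Qθ≤δ = begin
      (0ℚ - τ * S) * (0ℚ - τ * S)  ≡⟨ trans (cong (λ z → z * z) (+-identityˡ (- (τ * S)))) (alg₁ τ S) ⟩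
      S * S * (τ * τ)  ≤⟨ *-monoʳ (0≤square S) ττ≤ ⟩
      S * S * (τ + (θ + θ))  ≤⟨ *-monoʳ-≤-nonNeg (τ + (θ + θ)) {{nonNegative (≤-trans (0≤square τ) ττ≤)}} SS≤Q ⟩
      Q * (τ + (θ + θ))  ≡⟨ alg₂ Q τ θ ⟩
      Q * τ + (Q + Q) * θ  ≤⟨ +-monoʳ-≤ (Q * τ) Qθ≤δ ⟩
      Q * τ + δ  ∎
      where
      open ≤-Reasoning
      alg₁ : ∀ τ S → (- (τ * S)) * (- (τ * S)) ≡ S * S * (τ * τ)
      alg₁ = solve-∀ ℚ-ring
      alg₂ : ∀ Q τ θ → Q * (τ + (θ + θ)) ≡ Q * τ + (Q + Q) * θ
      alg₂ = solve-∀ ℚ-ring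
      alg₃ : ∀ τ θ o → (τ + θ) * (o - τ) + θ * (τ + θ + (o - θ)) ≡ o * τ + (o * θ + θ * o) - τ * τ
      alg₃ = solve-∀ ℚ-ring
      alg₄ : ∀ τ t → τ - t + t ≡ τ
      alg₄ = solve-∀ ℚ-ring
      τ≤1 : τ ≤ 1ℚ
      τ≤1 = ≤-trans (subst₂ _≤_ (alg₄ τ t) (sym (+-assoc η η η)) (+-mono-≤ (proj₂ (∣∣-bounds near)) t≤2η)) 3η≤1
      ττ≤ : τ * τ ≤ τ + (θ + θ)
      ττ≤ = 0≤-⇒≤ (subst (0ℚ ≤_) (trans (alg₃ τ θ 1ℚ)
          (cong (_- τ * τ) (cong₂ _+_ (*-identityˡ τ) (cong₂ _+_ (*-identityˡ θ) (*-identityʳ θ)))))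
        (+-mono-≤ (0≤* 0≤τ+θ (≤⇒0≤- τ≤1)) (0≤* (<⇒≤ 0<θ) (+-mono-≤ 0≤τ+θ (≤⇒0≤- θ≤1)))))

    -- From `t ≥ 2 η` follow `η ≤ τ` and `t ≤ 2 τ`. By `(a - b)² ≤ 2 a² + 2 b²` the old deviation
    -- contributes `4 Q τ`, and the shift of the centre `2 S² τ`, since `(t - τ)² ≤ η² ≤ η ≤ τ`.
    dense-close : ∀ {τ t η S Q x} → ∣ τ - t ∣ ≤ η → η + η ≤ t → 0ℚ ≤ η → η ≤ 1ℚ → 0ℚ ≤ Q →
                  (x - t * S) * (x - t * S) ≤ Q * t →
                  (x - τ * S) * (x - τ * S) ≤ (Q + Q + (Q + Q) + (S * S + S * S)) * τ
    dense-close {τ} {t} {η} {S} {Q} {x} near 2η≤t 0≤η η≤1 0≤Q close = begin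
      (x - τ * S) * (x - τ * S)
        ≤⟨ 0≤-⇒≤ (subst (0ℚ ≤_) (alg₁ x τ t S) (0≤square ((x - t * S) - (t - τ) * S))) ⟩
      (x - t * S) * (x - t * S) + (x - t * S) * (x - t * S) + ((t - τ) * (t - τ) * (S * S) + (t - τ) * (t - τ) * (S * S))
        ≤⟨ +-mono-≤ (+-mono-≤ close′ close′) (+-mono-≤ shift shift) ⟩
      Q * (τ + τ) + Q * (τ + τ) + (τ * (S * S) + τ * (S * S))
        ≡⟨ alg₂ Q τ S ⟩
      (Q + Q + (Q + Q) + (S * S + S * S)) * τ ∎
      where
      open ≤-Reasoning
      alg₁ : ∀ x τ t S → ((x - t * S) - (t - τ) * S) * ((x - t * S) - (t - τ) * S) ≡
             (x - t * S) * (x - t * S) + (x - t * S) * (x - t * S) + ((t - τ) * (t - τ) * (S * S) + (t - τ) * (t - τ) * (S * S))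
               - (x - τ * S) * (x - τ * S)
      alg₁ = solve-∀ ℚ-ring
      alg₂ : ∀ Q τ S → Q * (τ + τ) + Q * (τ + τ) + (τ * (S * S) + τ * (S * S)) ≡ (Q + Q + (Q + Q) + (S * S + S * S)) * τ
      alg₂ = solve-∀ ℚ-ring
      alg₃ : ∀ t τ η → τ - t - (- η) ≡ τ + η - t
      alg₃ = solve-∀ ℚ-ring
      alg₄ : ∀ t τ → (t - τ) * (t - τ) ≡ (τ - t) * (τ - t)
      alg₄ = solve-∀ ℚ-ring
      t≤τ+η : t ≤ τ + η
      t≤τ+η = 0≤-⇒≤ (subst (0ℚ ≤_) (alg₃ t τ η) (≤⇒0≤- (proj₁ (∣∣-bounds near))))
      η≤τ : η ≤ τ
      η≤τ = +-cancelʳ-≤ η (≤-trans 2η≤t t≤τ+η)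
        where
        +-cancelʳ-≤ : ∀ c {a b} → a + c ≤ b + c → a ≤ b
        +-cancelʳ-≤ c {a} {b} h = 0≤-⇒≤ (subst (0ℚ ≤_) (alg a b c) (≤⇒0≤- h))
          where
          alg : ∀ a b c → b + c - (a + c) ≡ b - a
          alg = solve-∀ ℚ-ring
      close′ : (x - t * S) * (x - t * S) ≤ Q * (τ + τ)
      close′ = ≤-trans close (*-monoʳ 0≤Q (≤-trans t≤τ+η (+-monoʳ-≤ τ η≤τ)))
      shift : (t - τ) * (t - τ) * (S * S) ≤ τ * (S * S)
      shift = *-monoʳ-≤-nonNeg (S * S) {{nonNegative (0≤square S)}} (begin
        (t - τ) * (t - τ)  ≡⟨ alg₄ t τ ⟩
        (τ - t) * (τ - t)  ≤⟨ proj₂ (∣∣-bounds (∣∣-* near near)) ⟩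
        η * η  ≤⟨ *-monoʳ 0≤η η≤1 ⟩
        η * 1ℚ  ≡⟨ *-identityʳ η ⟩
        η  ≤⟨ η≤τ ⟩
        τ  ∎)

    deviation : ℝ → ℕ → ℕ → ℝ
    deviation T s x = fromℕ x ℝ.- T ℝ.* fromℕ s

    -- The deviation is at most the square root of `Q T`, stated without the root.
    Close : ℝ → ℕ → ℕ → ℕ → Set
    Close T s Q x = deviation T s x ℝ.* deviation T s x ℝ.≤ fromℕ Q ℝ.* T

    Likely : ∀ {n} → ℝ → ℚ → (Subset n → Bool) → Set
    Likely p e F = ∃ λ N → ∀ m → N ℕ.≤ m → 1ℚ - e ≤ seq (prob p F) m

    0<⊓ : ∀ {a b} → 0ℚ < a → 0ℚ < b → 0ℚ < a ⊓ b
    0<⊓ {a} {b} 0<a 0<b with ⊓-sel a b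
    ... | inj₁ e = subst (0ℚ <_) (sym e) 0<a
    ... | inj₂ e = subst (0ℚ <_) (sym e) 0<b

    -- Source of the constant in Chebyshev's inequality: with `a = s * K` the failure probability
    -- `s K / Q₀` becomes at most `h`.
    scale : ∀ h → 0ℚ < h → ∀ a → ∃ λ Q → ι a ≤ h * ι (suc Q)
    scale h 0<h a with archimedean h 0<h
    ... | D , 1≤hD = D ℕ.* a , (begin
      ι a  ≡⟨ *-identityˡ (ι a) ⟨
      1ℚ * ι a  ≤⟨ *-monoʳ-≤-nonNeg (ι a) {{nonNegative (0≤ι a)}} 1≤hD ⟩
      h * ι D * ι a  ≡⟨ trans (*-assoc h (ι D) (ι a)) (cong (h *_) (sym (ι-* D a))) ⟩
      h * ι (D ℕ.* a)  ≤⟨ *-monoʳ (<⇒≤ 0<h) (ι-mono (ℕ.n≤1+n (D ℕ.* a))) ⟩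
      h * ι (suc (D ℕ.* a))  ∎)
      where open ≤-Reasoning

    tolerance : ∀ s {h} → 0ℚ < h → ∃ λ η → (0ℚ < η) × ((ι s + ι s) * η ≤ h) × (η + η + η ≤ 1ℚ)
    tolerance s {h} 0<h =
      let (η , 0<η , a , b) = small (ι s + ι s + (1ℚ + 1ℚ)) (h ⊓ 1ℚ) (+-mono-≤ (+-mono-≤ (0≤ι s) (0≤ι s)) (nonNegative⁻¹ (1ℚ + 1ℚ))) (0<⊓ 0<h (positive⁻¹ 1ℚ))
          (ζ , 0<ζ , 3ζ , _) = small (1ℚ + 1ℚ + 1ℚ) (η ⊓ 1ℚ) (nonNegative⁻¹ (1ℚ + 1ℚ + 1ℚ)) (0<⊓ 0<η (positive⁻¹ 1ℚ))
          0≤2s = +-mono-≤ (0≤ι s) (0≤ι s)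
          ζ≤η = ≤-trans (le-triple 0<ζ) (≤-trans (≤-reflexive (triple ζ)) (≤-trans 3ζ (p⊓q≤p η 1ℚ)))
      in ζ , 0<ζ ,
         ≤-trans (*-monoʳ 0≤2s ζ≤η) (≤-trans
           (*-monoʳ-≤-nonNeg η {{nonNegative (<⇒≤ 0<η)}}
             (subst (_≤ ι s + ι s + (1ℚ + 1ℚ)) (+-identityʳ (ι s + ι s)) (+-monoʳ-≤ (ι s + ι s) (nonNegative⁻¹ (1ℚ + 1ℚ)))))
           (≤-trans a (p⊓q≤p h 1ℚ))) ,
         ≤-trans (≤-reflexive (triple ζ)) (≤-trans 3ζ (p⊓q≤q η 1ℚ))
      where
      triple : ∀ z → z + z + z ≡ (1ℚ + 1ℚ + 1ℚ) * z
      triple z = sym (trans (*-distribʳ-+ z (1ℚ + 1ℚ) 1ℚ) (cong₂ _+_ (trans (*-distribʳ-+ z 1ℚ 1ℚ) (cong₂ _+_ (*-identityˡ z) (*-identityˡ z))) (*-identityˡ z)))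
      le-triple : ∀ {z} → 0ℚ < z → z ≤ z + z + z
      le-triple {z} 0<z = subst (_≤ z + z + z) (+-identityˡ z) (+-monoˡ-≤ z (+-mono-≤ (<⇒≤ 0<z) (<⇒≤ 0<z)))

    0≤EL : ∀ n → 0ℚ ≤ EL n
    0≤EL n = Smooth.0≤L (smooth-E {n} (λ _ → 1ℚ) (λ _ → ≤-refl))

    0≤powL : ∀ d ph → 0ℚ ≤ powL d * ι ph
    0≤powL d ph = 0≤* (Smooth.0≤L (smooth-pow d)) (0≤ι ph)

    small₂ : ∀ A B x y → 0ℚ ≤ A → 0ℚ ≤ B → 0ℚ < x → 0ℚ < y →
             ∃ λ θ → (0ℚ < θ) × (θ ≤ 1ℚ) × (A * θ ≤ x) × (B * θ ≤ y)
    small₂ A B x y 0≤A 0≤B 0<x 0<y =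
      let (θ , 0<θ , C≤ , θ≤) = small (A + B) ((x ⊓ y) ⊓ 1ℚ) (+-mono-≤ 0≤A 0≤B) (0<⊓ (0<⊓ 0<x 0<y) (positive⁻¹ 1ℚ))
          0≤θ = nonNegative (<⇒≤ 0<θ)
      in θ , 0<θ , ≤-trans θ≤ (p⊓q≤q (x ⊓ y) 1ℚ) ,
         ≤-trans (*-monoʳ-≤-nonNeg θ {{0≤θ}} (subst (_≤ A + B) (+-identityʳ A) (+-monoʳ-≤ A 0≤B)))
           (≤-trans C≤ (≤-trans (p⊓q≤p (x ⊓ y) 1ℚ) (p⊓q≤p x y))) ,
         ≤-trans (*-monoʳ-≤-nonNeg θ {{0≤θ}} (subst (_≤ A + B) (+-identityˡ B) (+-monoˡ-≤ B 0≤A)))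
           (≤-trans C≤ (≤-trans (p⊓q≤p (x ⊓ y) 1ℚ) (p⊓q≤q x y)))

    -- The expected count is s t with t = p ^ d ph. If t is tiny the count is
    -- almost surely 0; otherwise Chebyshev's inequality applies. Both events
    -- are decided with a rational q near p in place of p.
    module Count (e h η : ℚ) (s K Q₀ : ℕ) (0<h : 0ℚ < h) (h+h≡e : h + h ≡ e) (0<Q₀ : 0 ℕ.< Q₀)
                 (Q₀-large : ι (s ℕ.* K) ≤ h * ι Q₀) (0<η : 0ℚ < η) (2sη≤h : (ι s + ι s) * η ≤ h)
                 (3η≤1 : η + η + η ≤ 1ℚ) where

      -- The constant `4 Q₀ + 2 s²` that `dense-close` produces; it also exceeds the `s²` that
      -- `sparse-close` asks for.
      Q : ℕ
      Q = Q₀ ℕ.+ Q₀ ℕ.+ (Q₀ ℕ.+ Q₀) ℕ.+ (s ℕ.* s ℕ.+ s ℕ.* s)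

      ιQ : ι Q ≡ ι Q₀ + ι Q₀ + (ι Q₀ + ι Q₀) + (ι s * ι s + ι s * ι s)
      ιQ = trans (ι-+ (Q₀ ℕ.+ Q₀ ℕ.+ (Q₀ ℕ.+ Q₀)) (s ℕ.* s ℕ.+ s ℕ.* s))
        (cong₂ _+_ (trans (ι-+ (Q₀ ℕ.+ Q₀) (Q₀ ℕ.+ Q₀)) (cong₂ _+_ (ι-+ Q₀ Q₀) (ι-+ Q₀ Q₀)))
          (trans (ι-+ (s ℕ.* s) (s ℕ.* s)) (cong₂ _+_ (ι-* s s) (ι-* s s))))

      η≤1 : η ≤ 1ℚ
      η≤1 = ≤-trans (subst (_≤ η + η + η) (+-identityˡ η) (+-monoˡ-≤ η (+-mono-≤ (<⇒≤ 0<η) (<⇒≤ 0<η)))) 3η≤1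

      module _ {n} (p : ℝ) (0≤p : 0ℝ ℝ.≤ p) (p≤1 : p ℝ.≤ 1ℝ) (𝒜 : List (Subset n)) (d Δ ph : ℕ)
               (sizes : All (λ A → size A ≡ d) 𝒜) (deg : ∀ a → length (filter (a ∈?_) 𝒜) ℕ.≤ Δ)
               (total : length 𝒜 ≡ ph ℕ.* s) (dΔ≡K : d ℕ.* Δ ≡ K) where

        T : ℝ
        T = p ℝ.^ d ℝ.* fromℕ ph

        0≤T : 0ℝ ℝ.≤ T
        0≤T = 0≤ℝ* {p ℝ.^ d} {fromℕ ph} (0≤ℝ^ {p} d 0≤p) (0≤fromℕ ph)

        Y : Subset n → ℕ
        Y R = length (filter (_⊆? R) 𝒜)

        module AtRational (θ : ℚ) (0<θ : 0ℚ < θ) (θ≤1 : θ ≤ 1ℚ) (ELθ≤h : EL n * θ ≤ h) (powθ≤η : powL d * ι ph * θ ≤ η)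
                          (q : ℚ) (0≤q : 0ℚ ≤ q) (q≤1 : q ≤ 1ℚ) (N₀ : ℕ) (near-q : ∀ m → N₀ ℕ.≤ m → ∣ seq p m - q ∣ ≤ θ) where

          open Moments q 0≤q q≤1 𝒜 d Δ sizes deg using (X; v; 0≤v; μ; mean; variance)

          t : ℚ
          t = v * ι ph

          0≤t : 0ℚ ≤ t
          0≤t = 0≤* 0≤v (0≤ι ph)

          μ≡ : μ ≡ t * ι s
          μ≡ = trans (cong (λ l → ι l * v) total) (trans (cong (_* v) (ι-* ph s)) (alg (ι ph) (ι s) v))
            where
            alg : ∀ a b c → a * b * c ≡ c * a * b
            alg = solve-∀ ℚ-ring

          ∣q∣≤2 : ∣ q ∣ ≤ 2ℚ
          ∣q∣≤2 = ≤-trans (≤-reflexive (0≤p⇒∣p∣≡p 0≤q)) (≤-trans q≤1 (subst (_≤ 2ℚ) (+-identityʳ 1ℚ) (+-monoʳ-≤ 1ℚ (nonNegative⁻¹ 1ℚ))))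

          ∣p∣≤2 : ∀ m → N₀ ℕ.≤ m → ∣ seq p m ∣ ≤ 2ℚ
          ∣p∣≤2 m le = subst (λ z → ∣ z ∣ ≤ 2ℚ) (alg (seq p m) q)
            (∣∣-+ (≤-trans (near-q m le) θ≤1) (≤-trans (≤-reflexive (0≤p⇒∣p∣≡p 0≤q)) q≤1))
            where
            alg : ∀ a b → a - b + b ≡ a
            alg = solve-∀ ℚ-ring

          near-t : ∀ m → N₀ ℕ.≤ m → ∣ seq T m - t ∣ ≤ η
          near-t m le = begin
            ∣ seq (p ℝ.^ d) m * ι ph - v * ι ph ∣  ≡⟨ cong (λ z → ∣ z * ι ph - v * ι ph ∣) (seq-^ p d m) ⟩
            ∣ pow (seq p m) d * ι ph - v * ι ph ∣  ≡⟨ cong ∣_∣ (alg (pow (seq p m) d) v (ι ph)) ⟩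
            ∣ (pow (seq p m) d - v) * ι ph ∣  ≤⟨ ∣∣-* (Smooth.lipschitz (smooth-pow d) (∣p∣≤2 m le) ∣q∣≤2) (≤-reflexive (0≤p⇒∣p∣≡p (0≤ι ph))) ⟩
            powL d * ∣ seq p m - q ∣ * ι ph  ≡⟨ alg₂ (powL d) ∣ seq p m - q ∣ (ι ph) ⟩
            powL d * ι ph * ∣ seq p m - q ∣  ≤⟨ *-monoʳ (0≤powL d ph) (near-q m le) ⟩
            powL d * ι ph * θ  ≤⟨ powθ≤η ⟩
            η  ∎
            where
            open ≤-Reasoning
            alg : ∀ a b c → a * c - b * c ≡ (a - b) * c
            alg = solve-∀ ℚ-ring
            alg₂ : ∀ a b c → a * b * c ≡ a * c * b
            alg₂ = solve-∀ ℚ-ring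

          -- One half `h` of `e` pays for the failure of `F` at `q`, the other for the passage from
          -- `q` to the approximants of `p`.
          likely : ∀ (F : Subset n → Bool) → 1ℚ - E q (λ R → indicator (F R)) ≤ h → Likely p e F
          likely F 1-b≤h = N₀ , λ m le → subst (1ℚ - e ≤_) (sym (seq-prob p F m)) (transfer (E (seq p m) (λ R → indicator (F R)))
              (≤-trans (Smooth.lipschitz (smooth-E (λ R → indicator (F R)) ∣ind∣) (∣p∣≤2 m le) ∣q∣≤2)
                (≤-trans (*-monoʳ (0≤EL n) (near-q m le)) ELθ≤h)))
            where
            b : ℚ
            b = E q (λ R → indicator (F R))
            ∣ind∣ : ∀ R → ∣ indicator (F R) ∣ ≤ 1ℚ
            ∣ind∣ R with F R
            ... | true  = ≤-refl
            ... | false = nonNegative⁻¹ 1ℚ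
            alg : ∀ o b a h → (h - (o - b)) + (a - b - (- h)) ≡ a - (o - (h + h))
            alg = solve-∀ ℚ-ring
            transfer : ∀ a → ∣ a - b ∣ ≤ h → 1ℚ - e ≤ a
            transfer a near = 0≤-⇒≤ (subst (0ℚ ≤_) (trans (alg 1ℚ b a h) (cong (λ z → a - (1ℚ - z)) h+h≡e))
              (+-mono-≤ (≤⇒0≤- 1-b≤h) (≤⇒0≤- (proj₁ (∣∣-bounds near)))))

          Result : Set
          Result = ∃ λ (F : Subset n → Bool) → (∀ R → F R ≡ true → Close T s Q (Y R)) × Likely p e F

          sparse : t ≤ η + η → Result
          -- Markov's inequality with threshold 1: a nonzero count has probability at most its mean
          -- `t s ≤ 2 s η ≤ h`.
          sparse t≤2η = F , close , likely F (≤-trans (≤-reflexive (sym (*-identityˡ _))) (≤-trans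
              (markov 0≤q q≤1 X F 1ℚ (λ R → 0≤ι (Y R)) (λ R e → ι-mono {1} (ℕ.n≢0⇒n>0 (empty⁻ R e))))
              (≤-trans (≤-reflexive (trans mean μ≡)) (≤-trans
                (*-monoʳ-≤-nonNeg (ι s) {{nonNegative (0≤ι s)}} t≤2η)
                (≤-trans (≤-reflexive (alg η (ι s))) 2sη≤h)))))
            where
            F : Subset n → Bool
            F R = does (Y R ℕ.≟ 0)
            empty⁻ : ∀ R → F R ≡ false → Y R ≢ 0
            empty⁻ R e = does-false (Y R ℕ.≟ 0) e
            empty⁺ : ∀ R → F R ≡ true → Y R ≡ 0
            empty⁺ R e = does-true (Y R ℕ.≟ 0) e
            alg : ∀ a b → (a + a) * b ≡ (b + b) * a
            alg = solve-∀ ℚ-ring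
            ss≤Q : ι s * ι s ≤ ι Q
            ss≤Q = ≤-trans (≤-reflexive (sym (ι-* s s))) (ι-mono (ℕ.≤-trans (ℕ.m≤m+n (s ℕ.* s) (s ℕ.* s)) (ℕ.m≤n+m _ (Q₀ ℕ.+ Q₀ ℕ.+ (Q₀ ℕ.+ Q₀)))))
            close : ∀ R → F R ≡ true → Close T s Q (Y R)
            close R e δ 0<δ =
              let (ζ , 0<ζ , Qζ≤ , ζ≤) = small (ι Q + ι Q) (δ ⊓ 1ℚ) (+-mono-≤ (0≤ι Q) (0≤ι Q)) (0<⊓ 0<δ (positive⁻¹ 1ℚ))
                  (N₁ , f) = 0≤T ζ 0<ζ
              in N₀ ℕ.⊔ N₁ , λ m le → subst (λ x → (ι x - seq T m * ι s) * (ι x - seq T m * ι s) ≤ ι Q * seq T m + δ) (sym (empty⁺ R e))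
                (sparse-close {seq T m} {t} {η} {ζ} {δ} {ι s} {ι Q} (near-t m (ℕ.m⊔n≤o⇒m≤o N₀ N₁ le)) t≤2η 3η≤1 0<ζ
                  (≤-trans ζ≤ (p⊓q≤q δ 1ℚ)) (f m (ℕ.m⊔n≤o⇒n≤o N₀ N₁ le)) (0≤ι Q) ss≤Q (≤-trans Qζ≤ (p⊓q≤p δ 1ℚ)))

          dense : η + η < t → Result
          dense 2η<t = F , close , likely F 1-E≤h
            where
            open ≤-Reasoning
            dev² : Subset n → ℚ
            dev² R = (X R - t * ι s) * (X R - t * ι s)
            B : ℚ
            B = ι Q₀ * t
            F : Subset n → Bool
            F R = does (dev² R ≤? B)
            F⁻ : ∀ R → F R ≡ false → B ≤ dev² R
            F⁻ R e = <⇒≤ (≰⇒> (does-false (dev² R ≤? B) e))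
            F⁺ : ∀ R → F R ≡ true → dev² R ≤ B
            F⁺ R e = does-true (dev² R ≤? B) e
            0<t : 0ℚ < t
            0<t = <-trans (+-mono-< 0<η 0<η) 2η<t
            P : ℚ
            P = 1ℚ - E q (λ R → indicator (F R))
            V≡ : ι (length 𝒜 ℕ.* (d ℕ.* Δ)) * v ≡ ι (s ℕ.* K) * t
            V≡ = trans (cong₂ (λ l k → ι (l ℕ.* k) * v) total dΔ≡K)
              (trans (cong (_* v) (trans (ι-* (ph ℕ.* s) K) (cong (_* ι K) (ι-* ph s))))
                (trans (alg (ι ph) (ι s) (ι K) v) (cong (_* t) (sym (ι-* s K)))))
              where
              alg : ∀ a b c v → a * b * c * v ≡ b * c * (v * a)
              alg = solve-∀ ℚ-ring
            1-E≤h : P ≤ h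
            -- Chebyshev's inequality multiplied out. The factor `t` common to the variance bound
            -- and the threshold `B` cancels, as `t` is positive in this case.
            1-E≤h = *-cancelʳ-≤-pos (ι Q₀) {{positive (<-≤-trans (positive⁻¹ 1ℚ) (ι-mono {1} {Q₀} 0<Q₀))}}
              (*-cancelʳ-≤-pos t {{positive 0<t}} (begin
                P * ι Q₀ * t  ≡⟨ alg P (ι Q₀) t ⟩
                B * P  ≤⟨ markov 0≤q q≤1 dev² F B (λ R → 0≤square (X R - t * ι s)) F⁻ ⟩
                E q dev²  ≡⟨ cong (λ z → E q (λ R → (X R - z) * (X R - z))) (sym μ≡) ⟩
                E q (λ R → (X R - μ) * (X R - μ))  ≤⟨ variance ⟩
                ι (length 𝒜 ℕ.* (d ℕ.* Δ)) * v  ≡⟨ V≡ ⟩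
                ι (s ℕ.* K) * t  ≤⟨ *-monoʳ-≤-nonNeg t {{nonNegative 0≤t}} Q₀-large ⟩
                h * ι Q₀ * t  ∎))
              where
              alg : ∀ a b c → a * b * c ≡ b * c * a
              alg = solve-∀ ℚ-ring
            close : ∀ R → F R ≡ true → Close T s Q (Y R)
            close R e δ 0<δ = N₀ , λ m le → ≤-trans
              (dense-close {seq T m} {t} {η} {ι s} {ι Q₀} {X R} (near-t m le) (<⇒≤ 2η<t) (<⇒≤ 0<η) η≤1 (0≤ι Q₀) (F⁺ R e))
              (subst₂ _≤_ (trans (+-identityʳ _) (cong (_* seq T m) ιQ)) refl (+-monoʳ-≤ (ι Q * seq T m) (<⇒≤ 0<δ)))

          result : Result
          result = choose (t ≤? η + η)
            where
            choose : Dec (t ≤ η + η) → Result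
            choose (yes t≤) = sparse t≤
            choose (no t≰)  = dense (≰⇒> t≰)

        concentrated : ∃ λ (F : Subset n → Bool) → (∀ R → F R ≡ true → Close T s Q (Y R)) × Likely p e F
        concentrated =
          -- With `n` known, `θ` is made so small that replacing `p` by `q` moves probabilities by
          -- at most `h` and the value `T` by at most `η`.
          let (θ , 0<θ , θ≤1 , ELθ≤h , powθ≤η) = small₂ (EL n) (powL d * ι ph) h η (0≤EL n) (0≤powL d ph) 0<h 0<η
              (q , 0≤q , q≤1 , N₀ , near-q)    = near p 0≤p p≤1 θ 0<θ
          in AtRational.result θ 0<θ θ≤1 ELθ≤h powθ≤η q 0≤q q≤1 N₀ near-q

    -- `Q` is fixed before `n`, `p` and the family, whose influence is confined to `s` and
    -- `K = d Δ`. By this uniformity any function tending to infinity exceeds it eventually.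
    Concentrated : ℚ → ℕ → ℕ → ℕ → Set
    Concentrated e s K Q =
      ∀ {n} (p : ℝ) → 0ℝ ℝ.≤ p → p ℝ.≤ 1ℝ → (𝒜 : List (Subset n)) (d Δ ph : ℕ) →
      All (λ A → size A ≡ d) 𝒜 → (∀ a → length (filter (a ∈?_) 𝒜) ℕ.≤ Δ) → length 𝒜 ≡ ph ℕ.* s → d ℕ.* Δ ≡ K →
      ∃ λ (F : Subset n → Bool) → (∀ R → F R ≡ true → Close (p ℝ.^ d ℝ.* fromℕ ph) s Q (length (filter (_⊆? R) 𝒜))) × Likely p e F

    concentration : ∀ e → 0ℚ < e → ∀ s K → ∃ (Concentrated e s K)
    concentration e 0<e s K = step₁ (halve 0<e)
      where
      step₃ : ∀ h → 0ℚ < h → h + h ≡ e → ∀ Q₀ → ι (s ℕ.* K) ≤ h * ι (suc Q₀) →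
              (∃ λ η → (0ℚ < η) × ((ι s + ι s) * η ≤ h) × (η + η + η ≤ 1ℚ)) → ∃ (Concentrated e s K)
      step₃ h 0<h h+h≡e Q₀ large (η , 0<η , 2sη≤h , 3η≤1) =
        Count.Q e h η s K (suc Q₀) 0<h h+h≡e (s≤s z≤n) large 0<η 2sη≤h 3η≤1 ,
        Count.concentrated e h η s K (suc Q₀) 0<h h+h≡e (s≤s z≤n) large 0<η 2sη≤h 3η≤1
      step₂ : ∀ h → 0ℚ < h → h + h ≡ e → (∃ λ Q₀ → ι (s ℕ.* K) ≤ h * ι (suc Q₀)) → ∃ (Concentrated e s K)
      step₂ h 0<h h+h≡e (Q₀ , large) = step₃ h 0<h h+h≡e Q₀ large (tolerance s 0<h)
      step₁ : (∃ λ h → (0ℚ < h) × (h + h ≡ e)) → ∃ (Concentrated e s K)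
      step₁ (h , 0<h , h+h≡e) = step₂ h 0<h h+h≡e (scale h 0<h (s ℕ.* K))

  -- Divergence of the logarithm, from its definition by a limit.

  module LogarithmGrowth where

    open import Defs as ℝ using (ℝ; 0ℝ; 1ℝ; fromℕ; fromℚ; IsLog)
    open ℝ.ℝ
    open Rationals
    open Approximation
    open RealSequences
    open RealOrder

    pow-mono : ∀ {a b} → 0ℚ ≤ a → a ≤ b → ∀ d → pow a d ≤ pow b d
    pow-mono 0≤a a≤b zero    = ≤-refl
    pow-mono 0≤a a≤b (suc d) = *-mono (≤-trans 0≤a a≤b) (0≤pow 0≤a d) a≤b (pow-mono 0≤a a≤b d)

    pow-* : ∀ a i j → pow a (j ℕ.* i) ≡ pow (pow a i) j
    pow-* a i zero    = refl
    pow-* a i (suc j) = trans (pow-+ a i (j ℕ.* i)) (cong (pow a i *_) (pow-* a i j))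

    pow-ι : ∀ a k → pow (ι a) k ≡ ι (a ℕ.^ k)
    pow-ι a zero    = refl
    pow-ι a (suc k) = trans (cong (ι a *_) (pow-ι a k)) (sym (ι-* a (a ℕ.^ k)))

    -- A converse of Bernoulli's inequality: with `w = 2 i z ≤ 1`, a further factor adds `z + w z`,
    -- at most `2 z`.
    pow-1+ : ∀ {z} h → 0ℚ ≤ z → ι (h ℕ.+ h) * z ≤ 1ℚ → ∀ i → i ℕ.≤ h → pow (1ℚ + z) i ≤ 1ℚ + ι (i ℕ.+ i) * z
    pow-1+ {z} h 0≤z 2hz≤1 zero    _   = ≤-reflexive (sym (trans (cong (1ℚ +_) (*-zeroˡ z)) (+-identityʳ 1ℚ)))
    pow-1+ {z} h 0≤z 2hz≤1 (suc i) i<h = begin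
      (1ℚ + z) * pow (1ℚ + z) i  ≤⟨ *-monoʳ (+-mono-≤ (nonNegative⁻¹ 1ℚ) 0≤z) (pow-1+ h 0≤z 2hz≤1 i (ℕ.<⇒≤ i<h)) ⟩
      (1ℚ + z) * (1ℚ + w)  ≡⟨ alg₁ 1ℚ z w ⟩
      1ℚ * 1ℚ + 1ℚ * w + 1ℚ * z + w * z  ≤⟨ +-monoʳ-≤ (1ℚ * 1ℚ + 1ℚ * w + 1ℚ * z) (*-monoʳ-≤-nonNeg z {{nonNegative 0≤z}} w≤1) ⟩
      1ℚ * 1ℚ + 1ℚ * w + 1ℚ * z + 1ℚ * z  ≡⟨ alg₂ ⟩
      1ℚ + ι (suc i ℕ.+ suc i) * z  ∎
      where
      open ≤-Reasoning
      w : ℚ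
      w = ι (i ℕ.+ i) * z
      w≤1 : w ≤ 1ℚ
      w≤1 = ≤-trans (*-monoʳ-≤-nonNeg z {{nonNegative 0≤z}} (ι-mono (ℕ.+-mono-≤ (ℕ.<⇒≤ i<h) (ℕ.<⇒≤ i<h)))) 2hz≤1
      alg₁ : ∀ o z w → (o + z) * (o + w) ≡ o * o + o * w + o * z + w * z
      alg₁ = solve-∀ ℚ-ring
      alg₂ : 1ℚ * 1ℚ + 1ℚ * w + 1ℚ * z + 1ℚ * z ≡ 1ℚ + ι (suc i ℕ.+ suc i) * z
      alg₂ = begin-equality
        1ℚ * 1ℚ + 1ℚ * w + 1ℚ * z + 1ℚ * z  ≡⟨ cong₂ _+_ (cong₂ _+_ (cong₂ _+_ (*-identityˡ 1ℚ) (*-identityˡ w)) (*-identityˡ z)) (*-identityˡ z) ⟩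
        1ℚ + w + z + z  ≡⟨ alg₄ 1ℚ w z ⟩
        1ℚ + (z + z + w)  ≡⟨ cong (λ u → 1ℚ + (u + u + w)) (sym (*-identityˡ z)) ⟩
        1ℚ + (1ℚ * z + 1ℚ * z + ι (i ℕ.+ i) * z) ≡⟨ cong (1ℚ +_) (trans (cong (_+ w) (sym (*-distribʳ-+ z 1ℚ 1ℚ))) (sym (*-distribʳ-+ z (1ℚ + 1ℚ) (ι (i ℕ.+ i))))) ⟩
        1ℚ + (1ℚ + 1ℚ + ι (i ℕ.+ i)) * z  ≡⟨ cong (λ u → 1ℚ + u * z) (sym (trans (cong ι (cong suc (ℕ.+-suc i i))) (ι-+ 2 (i ℕ.+ i)))) ⟩
        1ℚ + ι (suc i ℕ.+ suc i) * z  ∎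
        where
        alg₄ : ∀ o w z → o + w + z + z ≡ o + (z + z + w)
        alg₄ = solve-∀ ℚ-ring

    -- Here `z = M / (m + 1) = 1 / (2 h)`, so each of the `2 M` blocks of `h` factors is at most 2:
    -- the crude bound of `exp M` by the power `2 M` of 2.
    exp-bound : ∀ M h m → suc m ≡ (M ℕ.+ M) ℕ.* h → pow (1ℚ + ι M * recip m) (suc m) ≤ ι (2 ℕ.^ (M ℕ.+ M))
    exp-bound M h m eq = begin
      pow (1ℚ + z) (suc m)  ≡⟨ cong (pow (1ℚ + z)) eq ⟩
      pow (1ℚ + z) ((M ℕ.+ M) ℕ.* h)  ≡⟨ pow-* (1ℚ + z) h (M ℕ.+ M) ⟩
      pow (pow (1ℚ + z) h) (M ℕ.+ M)  ≤⟨ pow-mono (0≤pow (+-mono-≤ (nonNegative⁻¹ 1ℚ) 0≤z) h) ≤2 (M ℕ.+ M) ⟩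
      pow (ι 2) (M ℕ.+ M)  ≡⟨ pow-ι 2 (M ℕ.+ M) ⟩
      ι (2 ℕ.^ (M ℕ.+ M))  ∎
      where
      open ≤-Reasoning
      z : ℚ
      z = ι M * recip m
      0≤z : 0ℚ ≤ z
      0≤z = 0≤* (0≤ι M) (<⇒≤ (0<recip m))
      2hz≡1 : ι (h ℕ.+ h) * z ≡ 1ℚ
      2hz≡1 = begin-equality
        ι (h ℕ.+ h) * (ι M * recip m)  ≡⟨ *-assoc (ι (h ℕ.+ h)) (ι M) (recip m) ⟨
        ι (h ℕ.+ h) * ι M * recip m  ≡⟨ cong (_* recip m) (ι-* (h ℕ.+ h) M) ⟨
        ι ((h ℕ.+ h) ℕ.* M) * recip m  ≡⟨ cong (λ k → ι k * recip m) (trans (trans (ℕ.*-distribʳ-+ M h h) (trans (cong₂ ℕ._+_ (ℕ.*-comm h M) (ℕ.*-comm h M)) (sym (ℕ.*-distribʳ-+ h M M)))) (sym eq)) ⟩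
        ι (suc m) * recip m  ≡⟨ ι-cancel m ⟩
        1ℚ  ∎
      ≤2 : pow (1ℚ + z) h ≤ ι 2
      ≤2 = ≤-trans (pow-1+ h 0≤z (≤-reflexive 2hz≡1) h ℕ.≤-refl) (≤-reflexive (cong (1ℚ +_) 2hz≡1))

    natural-bound : ∀ B → 0ℚ ≤ B → ∃ λ b → B ≤ ι b
    natural-bound B 0≤B =
      let (θ , 0<θ , Bθ≤1 , _) = small B 1ℚ 0≤B (positive⁻¹ 1ℚ)
          (D , 1≤θD)           = archimedean θ 0<θ
      in D , (begin
        B  ≡⟨ *-identityʳ B ⟨
        B * 1ℚ  ≤⟨ *-monoʳ 0≤B 1≤θD ⟩
        B * (θ * ι D)  ≡⟨ *-assoc B θ (ι D) ⟨
        B * θ * ι D  ≤⟨ *-monoʳ-≤-nonNeg (ι D) {{nonNegative (0≤ι D)}} Bθ≤1 ⟩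
        1ℚ * ι D  ≡⟨ *-identityˡ (ι D) ⟩
        ι D  ∎)
      where open ≤-Reasoning

    -- Powers are monotone only for non-negative bases, whence the lower bound `- (m + 1)` on `y`.
    -- Of the summand 2, one half is the distance allowed by `close` and the other the slack of a
    -- real inequality on approximants.
    approximant-bound : ∀ (y f : ℝ) n m M X N → (∀ j → seq f j ≡ pow (1ℚ + seq y j * recip m) (suc m)) →
                        pow (1ℚ + ι M * recip m) (suc m) ≤ ι X →
                        (∀ j → N ℕ.≤ j → - ι (suc m) ≤ seq y j) → (∀ j → N ℕ.≤ j → seq y j ≤ ι M) →
                        ℝ.abs (f ℝ.- fromℕ n) ℝ.≤ 1ℝ → n ℕ.≤ X ℕ.+ 2
    approximant-bound y f n m M X N seq-f exp≤ lower upper close = finish (close 1ℚ (positive⁻¹ 1ℚ))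
      where
      open ≤-Reasoning
      alg : ∀ f x → f - (f - x) ≡ x
      alg = solve-∀ ℚ-ring
      0≤c : 0ℚ ≤ recip m
      0≤c = <⇒≤ (0<recip m)
      0≤base : ∀ u → - ι (suc m) ≤ u → 0ℚ ≤ 1ℚ + u * recip m
      0≤base u l = begin
        0ℚ  ≡⟨ +-inverseʳ 1ℚ ⟨
        1ℚ + - 1ℚ  ≡⟨ cong (λ z → 1ℚ + - z) (ι-cancel m) ⟨
        1ℚ + - (ι (suc m) * recip m)  ≡⟨ cong (1ℚ +_) (neg-distribˡ-* (ι (suc m)) (recip m)) ⟩
        1ℚ + (- ι (suc m)) * recip m  ≤⟨ +-monoʳ-≤ 1ℚ (*-monoʳ-≤-nonNeg (recip m) {{nonNegative 0≤c}} l) ⟩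
        1ℚ + u * recip m  ∎
      f≤X : ∀ u → - ι (suc m) ≤ u → u ≤ ι M → pow (1ℚ + u * recip m) (suc m) ≤ ι X
      f≤X u l r = ≤-trans (pow-mono (0≤base u l) (+-monoʳ-≤ 1ℚ (*-monoʳ-≤-nonNeg (recip m) {{nonNegative 0≤c}} r)) (suc m)) exp≤
      n≤ : ∀ f → f ≤ ι X → ∣ f - ι n ∣ ≤ 1ℚ + 1ℚ → ι n ≤ ι (X ℕ.+ 2)
      n≤ f f≤ near = begin
        ι n  ≡⟨ alg f (ι n) ⟨
        f - (f - ι n)  ≤⟨ +-mono-≤ f≤ (neg-antimono-≤ (proj₁ (∣∣-bounds near))) ⟩
        ι X - (- (1ℚ + 1ℚ))  ≡⟨ cong (ι X +_) (neg-involutive (1ℚ + 1ℚ)) ⟩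
        ι X + ι 2  ≡⟨ ι-+ X 2 ⟨
        ι (X ℕ.+ 2)  ∎
      gap : suc (X ℕ.+ 2) ℕ.≤ n → ι (X ℕ.+ 2) < ι n
      gap X+2<n = <-≤-trans (subst (ι (X ℕ.+ 2) <_) (sym (ι-+ 1 (X ℕ.+ 2)))
        (subst (_< 1ℚ + ι (X ℕ.+ 2)) (+-identityˡ (ι (X ℕ.+ 2))) (+-monoˡ-< (ι (X ℕ.+ 2)) (positive⁻¹ 1ℚ)))) (ι-mono X+2<n)
      finish : (∃ λ N′ → ∀ j → N′ ℕ.≤ j → ∣ seq f j - ι n ∣ ≤ 1ℚ + 1ℚ) → n ℕ.≤ X ℕ.+ 2
      finish (N′ , near) = ℕ.≮⇒≥ λ X+2<n → <-irrefl refl (<-≤-trans (gap X+2<n) (n≤ (pow (1ℚ + seq y j * recip m) (suc m))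
          (f≤X (seq y j) (lower j (ℕ.m≤m⊔n N N′)) (upper j (ℕ.m≤m⊔n N N′)))
          (subst (λ f → ∣ f - ι n ∣ ≤ 1ℚ + 1ℚ) (seq-f j) (near j (ℕ.m≤n⊔m N N′)))))
        where
        j : ℕ
        j = N ℕ.⊔ N′

    module _ {y : ℝ} {n : ℕ} (f : ℕ → ℝ) (seq-f : ∀ m j → seq (f m) j ≡ pow (1ℚ + seq y j * recip m) (suc m))
             (converges : ℝ.Converges f (fromℕ n)) where

      limit-bound : ∀ M N → 0 ℕ.< M → (∀ j → N ℕ.≤ j → seq y j ≤ ι M) → n ℕ.≤ 2 ℕ.^ (M ℕ.+ M) ℕ.+ 2
      limit-bound M N 0<M y≤M = choose (boundedℝ y) (converges 1ℝ 0<1)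
        where
        0<1 : 0ℝ ℝ.< 1ℝ
        0<1 = 1ℚ , positive⁻¹ 1ℚ , 0 , λ _ _ → ≤-refl
        0<M+M : 0 ℕ.< M ℕ.+ M
        0<M+M = ℕ.<-≤-trans 0<M (ℕ.m≤m+n M M)
        -- `suc m` is a multiple of `2 M` as `exp-bound` wants; `n₀` brings it into the range of
        -- convergence, and `b` beyond the absolute value of `y`.
        at-multiple : ∀ B b n₀ m N₁ → suc m ≡ (M ℕ.+ M) ℕ.* suc (n₀ ℕ.+ b) → B ≤ ι b →
                      (∀ j → N₁ ℕ.≤ j → ∣ seq y j ∣ ≤ B) →
                      (∀ m → n₀ ℕ.≤ m → ℝ.abs (f m ℝ.- fromℕ n) ℝ.≤ 1ℝ) → n ℕ.≤ 2 ℕ.^ (M ℕ.+ M) ℕ.+ 2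
        at-multiple B b n₀ m N₁ m≡ B≤b y≤B conv = approximant-bound y (f m) n m M (2 ℕ.^ (M ℕ.+ M)) (N ℕ.⊔ N₁) (seq-f m)
          (exp-bound M (suc (n₀ ℕ.+ b)) m m≡)
          (λ j le → ≤-trans (neg-antimono-≤ (≤-trans B≤b (ι-mono (ℕ.≤-trans (ℕ.m≤n+m b n₀) (ℕ.m≤n⇒m≤1+n n₀+b≤m)))))
            (proj₁ (∣∣-bounds (y≤B j (ℕ.m⊔n≤o⇒n≤o N N₁ le)))))
          (λ j le → y≤M j (ℕ.m⊔n≤o⇒m≤o N N₁ le))
          (conv m (ℕ.≤-trans (ℕ.m≤m+n n₀ b) n₀+b≤m))
          where
          n₀+b≤m : n₀ ℕ.+ b ℕ.≤ m
          n₀+b≤m = ℕ.≤-pred (ℕ.≤-trans (ℕ.m≤n*m (suc (n₀ ℕ.+ b)) (M ℕ.+ M) {{ℕ.>-nonZero 0<M+M}}) (ℕ.≤-reflexive (sym m≡)))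
        choose : (∃ λ B → (0ℚ ≤ B) × ∃ λ N → ∀ m → N ℕ.≤ m → ∣ seq y m ∣ ≤ B) →
                 (∃ λ n₀ → ∀ m → n₀ ℕ.≤ m → ℝ.abs (f m ℝ.- fromℕ n) ℝ.≤ 1ℝ) → n ℕ.≤ 2 ℕ.^ (M ℕ.+ M) ℕ.+ 2
        choose (B , 0≤B , N₁ , y≤B) (n₀ , conv) =
          let (b , B≤b) = natural-bound B 0≤B
          in at-multiple B b n₀ (ℕ.pred ((M ℕ.+ M) ℕ.* suc (n₀ ℕ.+ b))) N₁
               (ℕ.suc-pred ((M ℕ.+ M) ℕ.* suc (n₀ ℕ.+ b))
                 {{ℕ.m*n≢0 (M ℕ.+ M) (suc (n₀ ℕ.+ b)) {{ℕ.>-nonZero 0<M+M}}}}) B≤b y≤B conv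

      -- `M` is compared with a single approximant of `y`, which is decidable. If that one is
      -- smaller by more than `η`, all later ones are below `M`, and `limit-bound` contradicts the
      -- size of `n`.
      limit-large : ∀ M → 0 ℕ.< M → 2 ℕ.^ (M ℕ.+ M) ℕ.+ 2 ℕ.< n → fromℕ M ℝ.≤ y
      limit-large M 0<M n-large ε 0<ε = go (halve 0<ε)
        where
        go : (∃ λ η → (0ℚ < η) × (η + η ≡ ε)) → ∃ λ N → ∀ j → N ℕ.≤ j → ι M ≤ seq y j + ε
        go (η , 0<η , 2η≡ε) = decide (cauchy y η 0<η)
          where
          decide : (∃ λ N → ∀ i j → N ℕ.≤ i → N ℕ.≤ j → ∣ seq y i - seq y j ∣ ≤ η) → ∃ λ N → ∀ j → N ℕ.≤ j → ι M ≤ seq y j + ε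
          decide (N , near) = choose (ι M ≤? seq y N + η)
            where
            choose : Dec (ι M ≤ seq y N + η) → ∃ λ N → ∀ j → N ℕ.≤ j → ι M ≤ seq y j + ε
            choose (yes M≤) = N , λ j N≤j → ≤-trans M≤ (0≤-⇒≤ (subst (0ℚ ≤_)
                (trans (alg (seq y j) (seq y N) η) (cong (λ z → seq y j + z - (seq y N + η)) 2η≡ε))
                (≤⇒0≤- (proj₁ (∣∣-bounds (near j N N≤j ℕ.≤-refl))))))
              where
              alg : ∀ a b η → a - b - (- η) ≡ a + (η + η) - (b + η)
              alg = solve-∀ ℚ-ring
            choose (no M≰) = ⊥-elim (ℕ.<⇒≱ n-large (limit-bound M N 0<M (λ j N≤j → <⇒≤ (≤-<-trans
                (0≤-⇒≤ (subst (0ℚ ≤_) (alg (seq y j) (seq y N) η) (≤⇒0≤- (proj₂ (∣∣-bounds (near j N N≤j ℕ.≤-refl))))))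
                (≰⇒> M≰)))))
              where
              alg : ∀ a b η → η - (a - b) ≡ b + η - a
              alg = solve-∀ ℚ-ring

    log-large : ∀ {y n} → IsLog y (fromℕ n) → ∀ M → 0 ℕ.< M → 2 ℕ.^ (M ℕ.+ M) ℕ.+ 2 ℕ.< n → fromℕ M ℝ.≤ y
    log-large {y} {n} isLog = limit-large {y} {n} f seq-f isLog
      where
      f : ℕ → ℝ
      f m = (1ℝ ℝ.+ y ℝ.* fromℚ (ℤ.+ 1 / suc m)) ℝ.^ suc m
      seq-f : ∀ m j → seq (f m) j ≡ pow (1ℚ + seq y j * recip m) (suc m)
      seq-f m j = trans (seq-^ (1ℝ ℝ.+ y ℝ.* fromℚ (ℤ.+ 1 / suc m)) (suc m) j) (cong (λ u → pow u (suc m)) base)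
        where
        base : seq (1ℝ ℝ.+ y ℝ.* fromℚ (ℤ.+ 1 / suc m)) j ≡ 1ℚ + seq y j * recip m
        base = refl

  -- Both asymptotic estimates from the model, the concentration bound and growth.

  module Assembly where

    open import Defs as ℝ using (ℝ; 0ℝ; 1ℝ; fromℕ; prob; φ; N; IsRoot; IsLog; Eventually)
    open ℝ.ℝ
    open Rationals
    open Approximation
    open RealSequences
    open RealOrder
    open Concentration
    open LogarithmGrowth
    open Partitions using (family; Parts; no-parts; length-family; length-family-0; parts≤sum)

    m≤m*m : ∀ m → m ℕ.≤ m ℕ.* m
    m≤m*m zero    = z≤n
    m≤m*m (suc m) = ℕ.m≤m*n (suc m) (suc m)

    -- Because `Q ≤ Q²`, the bound `Q T = Q r²` is at most the square of `Q r`, so no root of `Q` is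
    -- needed; then `Q ≤ L`.
    deviation≤ : ∀ {T r L s Q x} → IsRoot 2 r T → fromℕ Q ℝ.≤ L → Close T s Q x → ℝ.abs (deviation T s x) ℝ.≤ L ℝ.* r
    deviation≤ {T} {r} {L} {s} {Q} {x} (0≤r , _ , T≤r²) Q≤L close =
      ≤ℝ-trans {ℝ.abs D} {fromℕ Q ℝ.* r} {L ℝ.* r}
        (square≤⇒abs≤ {D} {fromℕ Q ℝ.* r} (0≤ℝ* {fromℕ Q} {r} (0≤fromℕ Q) 0≤r)
          (≤ℝ-trans {D ℝ.* D} {fromℕ Q ℝ.* T} {(fromℕ Q ℝ.* r) ℝ.* (fromℕ Q ℝ.* r)} close
            (≤ℝ-trans {fromℕ Q ℝ.* T} {fromℕ Q ℝ.* r ℝ.^ 2} {(fromℕ Q ℝ.* r) ℝ.* (fromℕ Q ℝ.* r)}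
              (*ℝ-monoʳ {T} {r ℝ.^ 2} {fromℕ Q} (0≤fromℕ Q) T≤r²)
              (≤ℝ-pointwise {fromℕ Q ℝ.* r ℝ.^ 2} {(fromℕ Q ℝ.* r) ℝ.* (fromℕ Q ℝ.* r)} square))))
        (≤ℝ-linear {r ℝ.* fromℕ Q} {r ℝ.* L} {fromℕ Q ℝ.* r} {L ℝ.* r}
          (λ m → cong₂ (λ a b → a - b) (*-comm (seq r m) (seq L m)) (*-comm (seq r m) (ι Q)))
          (*ℝ-monoʳ {fromℕ Q} {L} {r} 0≤r Q≤L))
      where
      D : ℝ
      D = deviation T s x
      alg : ∀ a b → a * a * (b * b) ≡ (a * b) * (a * b)
      alg = solve-∀ ℚ-ring
      square : ∀ m → ι Q * seq (r ℝ.^ 2) m ≤ (ι Q * seq r m) * (ι Q * seq r m)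
      square m = begin
        ι Q * seq (r ℝ.^ 2) m  ≡⟨ cong (ι Q *_) (trans (seq-^ r 2 m) (cong (seq r m *_) (*-identityʳ (seq r m)))) ⟩
        ι Q * (seq r m * seq r m)  ≤⟨ *-monoʳ-≤-nonNeg (seq r m * seq r m) {{nonNegative (0≤square (seq r m))}}
                                                   (≤-trans (ι-mono (m≤m*m Q)) (≤-reflexive (ι-* Q Q))) ⟩
        ι Q * ι Q * (seq r m * seq r m)  ≡⟨ alg (ι Q) (seq r m) ⟩
        (ι Q * seq r m) * (ι Q * seq r m)  ∎
        where open ≤-Reasoning

    abs-split : ∀ {D x U W} → (∀ m → seq D m ≡ seq x m - seq U m) → ℝ.abs D ℝ.≤ W → (U ℝ.- W ℝ.≤ x) × (x ℝ.≤ U ℝ.+ W)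
    abs-split {D} {x} {U} {W} eq ≤W =
      (λ δ 0<δ → let (N , f) = ≤W δ 0<δ in N , λ m le → lower {seq D m} {seq x m} {seq U m} {seq W m} {δ} (eq m) (f m le)) ,
      (λ δ 0<δ → let (N , f) = ≤W δ 0<δ in N , λ m le → upper {seq D m} {seq x m} {seq U m} {seq W m} {δ} (eq m) (f m le))
      where
      alg₁ : ∀ x u w δ → x - u - (- (w + δ)) ≡ x + δ - (u - w)
      alg₁ = solve-∀ ℚ-ring
      alg₂ : ∀ x u w δ → w + δ - (x - u) ≡ u + w + δ - x
      alg₂ = solve-∀ ℚ-ring
      lower : ∀ {d x u w δ} → d ≡ x - u → ∣ d ∣ ≤ w + δ → u - w ≤ x + δ
      lower {d} {x} {u} {w} {δ} refl h = 0≤-⇒≤ (subst (0ℚ ≤_) (alg₁ x u w δ) (≤⇒0≤- (proj₁ (∣∣-bounds h))))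
      upper : ∀ {d x u w δ} → d ≡ x - u → ∣ d ∣ ≤ w + δ → x ≤ u + w + δ
      upper {d} {x} {u} {w} {δ} refl h = 0≤-⇒≤ (subst (0ℚ ≤_) (alg₂ x u w δ) (≤⇒0≤- (proj₂ (∣∣-bounds h))))

    likely⇒prob : ∀ {n} {p ε e} {F : Subset n → Bool} → (∃ λ N → ∀ m → N ℕ.≤ m → 0ℚ + e ≤ seq ε m) → Likely p e F → 1ℝ ℝ.- ε ℝ.≤ prob p F
    likely⇒prob {p = p} {ε} {e} {F} (M , e≤ε) (N , likely) δ 0<δ = M ℕ.⊔ N , λ m le → begin
      1ℚ - seq ε m  ≤⟨ +-monoʳ-≤ 1ℚ (neg-antimono-≤ (e≤ε m (ℕ.m⊔n≤o⇒m≤o M N le))) ⟩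
      1ℚ - (0ℚ + e)  ≡⟨ cong (λ z → 1ℚ - z) (+-identityˡ e) ⟩
      1ℚ - e  ≤⟨ likely m (ℕ.m⊔n≤o⇒n≤o M N le) ⟩
      seq (prob p F) m  ≡⟨ +-identityʳ (seq (prob p F) m) ⟨
      seq (prob p F) m + 0ℚ  ≤⟨ +-monoʳ-≤ (seq (prob p F) m) (<⇒≤ 0<δ) ⟩
      seq (prob p F) m + δ  ∎
      where open ≤-Reasoning

    -- The bound of `degree` for `s` patterns with parts at most `b`. It must not involve `n`, so in
    -- the first part `s = 1` and `b = 0` make it 4 for all `k`.
    Δ-bound : ℕ → ℕ → ℕ
    Δ-bound s b = s ℕ.* ((2 ℕ.+ b) ℕ.* (2 ℕ.+ b))

    decompose : ∀ {n k} a → k ℕ.+ (2 ℕ.+ a) ℕ.≤ n →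
                ∃ λ ℓ′ → n ≡ suc (suc (ℓ′ ℕ.+ k)) × (n ℕ.∸ 1 ℕ.∸ k ≡ suc ℓ′) × (a ℕ.< suc ℓ′)
    decompose {n} {k} a h = ℓ′ , n≡ , trans (cong (λ z → z ℕ.∸ 1 ℕ.∸ k) n≡) (ℕ.m+n∸n≡m (suc ℓ′) k) , s≤s (ℕ.m≤n+m a _)
      where
      ℓ′ : ℕ
      ℓ′ = n ℕ.∸ (k ℕ.+ (2 ℕ.+ a)) ℕ.+ a
      n≡ : n ≡ suc (suc (ℓ′ ℕ.+ k))
      n≡ = trans (sym (ℕ.m∸n+n≡m h)) (alg (n ℕ.∸ (k ℕ.+ (2 ℕ.+ a))) k a)
        where
        alg : ∀ x k a → x ℕ.+ (k ℕ.+ (2 ℕ.+ a)) ≡ suc (suc (x ℕ.+ a ℕ.+ k))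
        alg = ℕSolver.solve-∀

    Approximated : ℚ → ℕ → ℕ → ∀ {n} → ℝ → ℝ → (Subset n → ℕ) → Set
    Approximated e s Q {n} p T Y = ∃ λ (F : Subset n → Bool) → (∀ R → F R ≡ true → Close T s Q (Y R)) × Likely p e F

    approximated-cong : ∀ {e s Q n p T} {Y Z : Subset n → ℕ} → (∀ R → Y R ≡ Z R) →
                        Approximated e s Q p T Y → Approximated e s Q p T Z
    approximated-cong {s = s} {Q} {T = T} Y≡Z (F , close , likely) = F , (λ R eq → subst (Close T s Q) (Y≡Z R) (close R eq)) , likely

    -- The condition on `n` is `d k < n - 1 - k` in additive form, under which the model describes
    -- `N` exactly.
    count : ∀ {e₀ Q} (k e b s : ℕ) → Concentrated e₀ s (suc e ℕ.* Δ-bound s b) Q →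
            length (family (e ℕ.* suc e ℕ./ 2) k e) ≡ s → (∀ {xs} → Parts k e xs → All (ℕ._≤ b) xs) →
            ∀ n .{{_ : ℕ.NonZero n}} → k ℕ.+ (2 ℕ.+ suc e ℕ.* k) ℕ.≤ n →
            ∀ p → 0ℝ ℝ.≤ p → p ℝ.≤ 1ℝ →
            Approximated e₀ s Q p (p ℝ.^ suc e ℝ.* fromℕ (φ n)) (N n (n ℕ.∸ 1 ℕ.∸ k) (suc e))
    count {e₀} {Q} k e b s concentrated s≡ parts≤b n n-large p 0≤p p≤1 = go (decompose (suc e ℕ.* k) n-large)
      where
      T : ℝ
      T = p ℝ.^ suc e ℝ.* fromℕ (φ n)
      go : (∃ λ ℓ′ → n ≡ suc (suc (ℓ′ ℕ.+ k)) × (n ℕ.∸ 1 ℕ.∸ k ≡ suc ℓ′) × (suc e ℕ.* k ℕ.< suc ℓ′)) →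
           Approximated e₀ s Q p T (N n (n ℕ.∸ 1 ℕ.∸ k) (suc e))
      go (ℓ′ , n≡ , ℓ≡ , big) = approximated-cong {e₀} {s} {Q} {n} {p} {T} {λ R → length (filter (_⊆? R) supports)} {N n (n ℕ.∸ 1 ℕ.∸ k) (suc e)}
          (λ R → trans (sym (N≡ R)) (cong (λ ℓ → N n ℓ (suc e) R) (sym ℓ≡)))
          (concentrated p 0≤p p≤1 supports (suc e) (Δ-bound s b) (φ n) size-supports degrees lengths refl)
        where
        open Model n ℓ′ k e n≡ big
        degrees : ∀ a → length (filter (a ∈?_) supports) ℕ.≤ Δ-bound s b
        degrees a = subst (λ z → length (filter (a ∈?_) supports) ℕ.≤ Δ-bound z b) s≡ (degree b parts≤b a)
        lengths : length supports ≡ φ n ℕ.* s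
        lengths = trans length-supports (cong (φ n ℕ.*_) s≡)

    power-large : ∀ {x M} d → 0 ℕ.< M → fromℕ M ℝ.≤ x → fromℕ M ℝ.≤ x ℝ.^ suc d
    power-large {x} {M} d 0<M M≤x = ≤ℝ-trans {fromℕ M} {x} {x ℝ.^ suc d} M≤x
      (≤ℝ-linear {x ℝ.* 1ℝ} {x ℝ.* x ℝ.^ d} {x} {x ℝ.* x ℝ.^ d} (λ m → cong (λ z → seq x m * seq (x ℝ.^ d) m - z) (*-identityʳ (seq x m)))
        (*ℝ-monoʳ {1ℝ} {x ℝ.^ d} {x} 0≤x (1≤x^ d)))
      where
      1≤x : 1ℝ ℝ.≤ x
      1≤x = ≤ℝ-trans {1ℝ} {fromℕ M} {x} (≤ℝ-pointwise {1ℝ} {fromℕ M} (λ _ → ι-mono {1} 0<M)) M≤x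
      0≤x : 0ℝ ℝ.≤ x
      0≤x = ≤ℝ-trans {0ℝ} {1ℝ} {x} (0≤fromℕ 1) 1≤x
      1≤x^ : ∀ d → 1ℝ ℝ.≤ x ℝ.^ d
      1≤x^ zero    = ≤ℝ-pointwise {1ℝ} {1ℝ} (λ _ → ≤-refl)
      1≤x^ (suc d) = ≤ℝ-trans {1ℝ} {x} {x ℝ.^ suc d} 1≤x
        (≤ℝ-linear {x ℝ.* 1ℝ} {x ℝ.* x ℝ.^ d} {x} {x ℝ.* x ℝ.^ d} (λ m → cong (λ z → seq x m * seq (x ℝ.^ d) m - z) (*-identityʳ (seq x m)))
          (*ℝ-monoʳ {1ℝ} {x ℝ.^ d} {x} 0≤x (1≤x^ d)))

    SingleEvent : ℕ → ℝ → ℝ → ∀ n → .{{_ : ℕ.NonZero n}} → Subset n → Set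
    SingleEvent k p ω n R = ∀ r → IsRoot 2 r (p ℝ.* fromℕ (φ n)) →
      (p ℝ.* fromℕ (φ n) ℝ.- ω ℝ.* r ℝ.≤ fromℕ (N n (n ℕ.∸ 1 ℕ.∸ k) 1 R)) ×
      (fromℕ (N n (n ℕ.∸ 1 ℕ.∸ k) 1 R) ℝ.≤ p ℝ.* fromℕ (φ n) ℝ.+ ω ℝ.* r)

    single : (k : ℕ → ℕ) (p ω : ℕ → ℝ) → Eventually (λ n → k n ℕ.≤ n ℕ./ 3) →
             (∀ n → 0ℝ ℝ.≤ p n × p n ℝ.≤ 1ℝ) → ℝ.TendsToInfinity ω → ℝ.AAS p (λ n → SingleEvent (k n) (p n) (ω n) n)
    single k p ω (n₁ , k≤n/3) 0≤p≤1 ω→∞ ε (e , 0<e , e≤ε) = go (concentration e 0<e 1 (1 ℕ.* Δ-bound 1 0))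
      where
      Event : ∀ n → .{{_ : ℕ.NonZero n}} → Subset n → Set
      Event n = SingleEvent (k n) (p n) (ω n) n
      -- Three times the left side is `2 (3 k) + 6`, at most `2 n + n`; this is where 6 comes from.
      enough : ∀ k n → 6 ℕ.≤ n → k ℕ.≤ n ℕ./ 3 → k ℕ.+ (2 ℕ.+ 1 ℕ.* k) ℕ.≤ n
      enough k n 6≤n k≤ = ℕ.*-cancelˡ-≤ 3 (begin
        3 ℕ.* (k ℕ.+ (2 ℕ.+ 1 ℕ.* k))  ≡⟨ alg k ⟩
        2 ℕ.* (k ℕ.* 3) ℕ.+ 6  ≤⟨ ℕ.+-mono-≤ (ℕ.*-monoʳ-≤ 2 (ℕ.≤-trans (ℕ.*-monoˡ-≤ 3 k≤) (ℕ.m/n*n≤m n 3))) 6≤n ⟩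
        2 ℕ.* n ℕ.+ n  ≡⟨ ℕ.+-comm (2 ℕ.* n) n ⟩
        3 ℕ.* n  ∎)
        where
        open ℕ.≤-Reasoning
        alg : ∀ k → 3 ℕ.* (k ℕ.+ (2 ℕ.+ 1 ℕ.* k)) ≡ 2 ℕ.* (k ℕ.* 3) ℕ.+ 6
        alg = ℕSolver.solve-∀
      finish : ∀ n .{{_ : ℕ.NonZero n}} Q → fromℕ Q ℝ.≤ ω n →
               Approximated e 1 Q (p n) (p n ℝ.^ 1 ℝ.* fromℕ (φ n)) (N n (n ℕ.∸ 1 ℕ.∸ k n) 1) →
               ℝ.ProbAtLeast (p n) (Event n) (1ℝ ℝ.- ε)
      finish n Q Q≤ω (F , close , likely) = F , event , likely⇒prob {p = p n} {ε} {e} {F} e≤ε likely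
        where
        T T′ : ℝ
        T  = p n ℝ.^ 1 ℝ.* fromℕ (φ n)
        T′ = p n ℝ.* fromℕ (φ n)
        T≡T′ : ∀ m → seq T m ≡ seq T′ m
        T≡T′ m = cong (_* ι (φ n)) (*-identityʳ (seq (p n) m))
        event : ∀ R → F R ≡ true → Event n R
        event R eq r (0≤r , r²≤ , ≤r²) = abs-split {deviation T 1 x} {fromℕ x} {T′} {ω n ℝ.* r}
            (λ m → cong (λ z → ι x - z) (trans (*-identityʳ (seq T m)) (T≡T′ m)))
            (deviation≤ {T} {r} {ω n} {1} {Q} {x}
              (0≤r , ≤ℝ-trans {r ℝ.^ 2} {T′} {T} r²≤ (≤ℝ-pointwise {T′} {T} (λ m → ≤-reflexive (sym (T≡T′ m))))
                   , ≤ℝ-trans {T} {T′} {r ℝ.^ 2} (≤ℝ-pointwise {T} {T′} (λ m → ≤-reflexive (T≡T′ m))) ≤r²)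
              Q≤ω (close R eq))
          where
          x : ℕ
          x = N n (n ℕ.∸ 1 ℕ.∸ k n) 1 R
      go : ∃ (Concentrated e 1 (1 ℕ.* Δ-bound 1 0)) → Eventually (λ n → .{{_ : ℕ.NonZero n}} → ℝ.ProbAtLeast (p n) (Event n) (1ℝ ℝ.- ε))
      go (Q , concentrated) = start (ω→∞ (fromℕ Q))
        where
        start : Eventually (λ n → fromℕ Q ℝ.≤ ω n) → Eventually (λ n → .{{_ : ℕ.NonZero n}} → ℝ.ProbAtLeast (p n) (Event n) (1ℝ ℝ.- ε))
        start (n₂ , Q≤ω) = (n₁ ℕ.⊔ n₂) ℕ.⊔ 6 , λ n le →
          let n₁₂≤n = ℕ.m⊔n≤o⇒m≤o (n₁ ℕ.⊔ n₂) 6 le in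
          finish n Q (Q≤ω n (ℕ.m⊔n≤o⇒n≤o n₁ n₂ n₁₂≤n))
            (count {e} {Q} (k n) 0 0 1 concentrated (length-family-0 (k n)) (λ P → subst (All (ℕ._≤ 0)) (sym (no-parts P)) [])
              n (enough (k n) n (ℕ.m⊔n≤o⇒n≤o (n₁ ℕ.⊔ n₂) 6 le) (k≤n/3 n (ℕ.m⊔n≤o⇒m≤o n₁ n₂ n₁₂≤n)))
              (p n) (proj₁ (0≤p≤1 n)) (proj₂ (0≤p≤1 n)))

    -- The factor `1ℝ` is the constant `c` of the theorem, kept so that the two events coincide by
    -- computation.
    SeveralEvent : ℕ → ℕ → ℝ → ℝ → ∀ n → .{{_ : ℕ.NonZero n}} → Subset n → Set
    SeveralEvent k e p L n R = ∀ r → IsRoot 2 r (p ℝ.^ suc e ℝ.* fromℕ (φ n)) →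
      ℝ.abs (deviation (p ℝ.^ suc e ℝ.* fromℕ (φ n)) (ℝ.sumFromTo (e ℕ.* suc e ℕ./ 2) k (λ j → ℝ.q j e))
        (N n (n ℕ.∸ 1 ℕ.∸ k) (suc e) R)) ℝ.≤ 1ℝ ℝ.* (r ℝ.* L)

    several : (log : ℕ → ℝ) → (∀ n → 1 ℕ.≤ n → IsLog (log n) (fromℕ n)) → ∀ k e (p : ℕ → ℝ) →
              (∀ n → 0ℝ ℝ.≤ p n × p n ℝ.≤ 1ℝ) → ℝ.AAS p (λ n → SeveralEvent k e (p n) (log n ℝ.^ suc e) n)
    several log isLog k e p 0≤p≤1 ε (e₀ , 0<e₀ , e₀≤ε) = go (concentration e₀ 0<e₀ s (suc e ℕ.* Δ-bound s k))
      where
      s : ℕ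
      s = ℝ.sumFromTo (e ℕ.* suc e ℕ./ 2) k (λ j → ℝ.q j e)
      Event : ∀ n → .{{_ : ℕ.NonZero n}} → Subset n → Set
      Event n = SeveralEvent k e (p n) (log n ℝ.^ suc e) n
      finish : ∀ n .{{_ : ℕ.NonZero n}} Q → fromℕ Q ℝ.≤ log n ℝ.^ suc e →
               Approximated e₀ s Q (p n) (p n ℝ.^ suc e ℝ.* fromℕ (φ n)) (N n (n ℕ.∸ 1 ℕ.∸ k) (suc e)) →
               ℝ.ProbAtLeast (p n) (Event n) (1ℝ ℝ.- ε)
      finish n Q Q≤L (F , close , likely) = F , event , likely⇒prob {p = p n} {ε} {e₀} {F} e₀≤ε likely
        where
        T L : ℝ
        T = p n ℝ.^ suc e ℝ.* fromℕ (φ n)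
        L = log n ℝ.^ suc e
        event : ∀ R → F R ≡ true → Event n R
        event R eq r root = ≤ℝ-trans {ℝ.abs (deviation T s x)} {L ℝ.* r} {1ℝ ℝ.* (r ℝ.* L)}
            (deviation≤ {T} {r} {L} {s} {Q} {x} root Q≤L (close R eq))
            (≤ℝ-pointwise {L ℝ.* r} {1ℝ ℝ.* (r ℝ.* L)}
              (λ m → ≤-reflexive (trans (*-comm (seq L m) (seq r m)) (sym (*-identityˡ (seq r m * seq L m))))))
          where
          x : ℕ
          x = N n (n ℕ.∸ 1 ℕ.∸ k) (suc e) R
      go : ∃ (Concentrated e₀ s (suc e ℕ.* Δ-bound s k)) →
           Eventually (λ n → .{{_ : ℕ.NonZero n}} → ℝ.ProbAtLeast (p n) (Event n) (1ℝ ℝ.- ε))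
      go (Q , concentrated) = A ℕ.⊔ B , λ n le →
        let n>B = ℕ.m⊔n≤o⇒n≤o A B le in
        finish n Q (≤ℝ-trans {fromℕ Q} {fromℕ M} {log n ℝ.^ suc e} (≤ℝ-pointwise {fromℕ Q} {fromℕ M} (λ _ → ι-mono (ℕ.n≤1+n Q)))
            (power-large {log n} {M} e (s≤s z≤n) (log-large {log n} {n} (isLog n (ℕ.≤-trans (s≤s z≤n) n>B)) M (s≤s z≤n) n>B)))
          (count {e₀} {Q} k e k s concentrated (length-family (e ℕ.* suc e ℕ./ 2) k e)
            (λ {xs} P → All.map (λ x≤ → ℕ.≤-trans x≤ (Parts.sum≤ P)) (parts≤sum {xs}))
            n (ℕ.m⊔n≤o⇒m≤o A B le) (p n) (proj₁ (0≤p≤1 n)) (proj₂ (0≤p≤1 n)))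
        where
        -- From `A` on the model applies, and from `B` on `log n` is at least `M`. The successor in
        -- `M` keeps it positive, and the one in `B` makes the bound on `n` strict.
        M A B : ℕ
        M = suc Q
        A = k ℕ.+ (2 ℕ.+ suc e ℕ.* k)
        B = suc (2 ℕ.^ (M ℕ.+ M) ℕ.+ 2)

open import Data.Nat.Base as ℕ using (ℕ; zero; suc)
open import Data.Product using (∃; _×_; _,_)
open import Defs

theorem5 : (log loglog : ℕ → ℝ) →
    (∀ n → 1 ℕ.≤ n → IsLog (log n) (fromℕ n)) →
    (∀ n → 2 ℕ.≤ n → IsLog (loglog n) (log n)) →
    ( (k : ℕ → ℕ) (p threshold ω : ℕ → ℝ) →
    Eventually (λ n → k n ℕ.≤ n ℕ./ 3) →
    (∀ n → 0ℝ ≤ p n × p n ≤ 1ℝ) →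
    (∀ n → 2 ℕ.≤ n → IsQuotient (threshold n) (loglog n) (fromℕ n)) →
    p ≫ threshold →
    TendsToInfinity ω →
    AAS p (λ n R → ∀ √pφ → IsRoot 2 √pφ (p n * fromℕ (φ n)) →
    (p n * fromℕ (φ n) - ω n * √pφ ≤ fromℕ (N n (n ℕ.∸ 1 ℕ.∸ k n) 1 R)) ×
    (fromℕ (N n (n ℕ.∸ 1 ℕ.∸ k n) 1 R) ≤ p n * fromℕ (φ n) + ω n * √pφ)) )
    ×
    ( (k : ℕ) → ∃ λ (c : ℝ) →
    (d : ℕ) (p loglog^1/d n^1/d threshold : ℕ → ℝ) →
    2 ℕ.≤ d →
    (∀ n → 0ℝ ≤ p n × p n ≤ 1ℝ) →
    (∀ n → 3 ℕ.≤ n → IsRoot d (loglog^1/d n) (loglog n)) →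
    (∀ n → 3 ℕ.≤ n → IsRoot d (n^1/d n) (fromℕ n)) →
    (∀ n → 3 ℕ.≤ n → IsQuotient (threshold n) (log n ^ 2 * loglog^1/d n) (n^1/d n)) →
    p ≫ threshold →
    AAS p (λ n R → ∀ √p^dφ → IsRoot 2 √p^dφ (p n ^ d * fromℕ (φ n)) →
    abs (fromℕ (N n (n ℕ.∸ 1 ℕ.∸ k) d R)
    - p n ^ d * fromℕ (φ n)
    * fromℕ (sumFromTo ((d ℕ.∸ 1) ℕ.* d ℕ./ 2) k (λ j → q j (d ℕ.∸ 1))))
    ≤ c * (√p^dφ * log n ^ d)) )
theorem5 log loglog isLog _ =
  (λ k p _ ω k≤ 0≤p≤1 _ _ ω→∞ ε 0<ε → Probability.Assembly.single k p ω k≤ 0≤p≤1 ω→∞ ε 0<ε) ,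
  -- The constant 1 suffices for every `k`: for each failure probability the deviation is at most a
  -- fixed multiple of the root, and the power of `log n` eventually exceeds that multiple.
  λ k → 1ℝ , λ { zero _ _ _ _ () ; (suc e) p _ _ _ _ 0≤p≤1 _ _ _ _ ε 0<ε → Probability.Assembly.several log isLog k e p 0≤p≤1 ε 0<ε }
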